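{- Let $d>1$ be a squarefree integer and let $m,n$ be nonzero integers with $m^2-dn^2=-4$. Let $p$ be a prime with $p\nmid n$ and $p=x^2+3dy^2$, where $x,y$ are integers with $3\nmid y$ and $x\equiv y\pmod 3$. Then $$U_{\frac{p-1}{3}}(m,-1)\equiv \begin{cases} 0\pmod p & \text{if } m\equiv 0,\pm4\pmod 9,\\ \big(\frac{mn/3}{3}\big)\frac{x}{dny}\pmod p & \text{if } m\equiv\pm3\pmod 9,\\ -\big(\frac{mn}{3}\big)\frac{x}{dny}\pmod p & \text{if } m\equiv\pm1\pmod 9,\\ \big(\frac{mn}{3}\big)\frac{x}{dny}\pmod p & \text{if } m\equiv\pm2\pmod 9,\end{cases}$$ where $\big(\frac{\cdot}{3}\big)$ is the Legendre symbol.
   Context: $\{U_k(b,c)\}_{k\ge0}$ is the Lucas sequence defined by $U_0=0$, $U_1=1$, $U_{k+1}=bU_k-cU_{k-1}$ for $k\ge1$. The denominator $dny$ is prime to $p$ and is inverted modulo $p$. -}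

module Defs where

open import Data.Fin.Base using (toℕ)
open import Data.Fin.Properties using (any?)
open import Data.Integer.Base using (ℤ; +_; _*_; _-_; -_; ∣_∣; 0ℤ; 1ℤ; -1ℤ)
open import Data.Integer.Divisibility.Signed using (_∣_; _∣?_)
open import Data.Nat.Base using (ℕ; zero; suc)
open import Data.Product.Base using (_×_; ∃-syntax)
open import Data.Sum.Base using (_⊎_)
open import Relation.Binary.PropositionalEquality using (_≡_)
open import Relation.Nullary.Decidable using (yes; no)

infix 4 _≡_[mod_] _≡±_[mod_] _≡_÷_[mod_]

SquareFree : ℤ → Set
SquareFree d = ∀ k → k * k ∣ d → ∣ k ∣ ≡ 1

U : ℕ → ℤ → ℤ → ℤ
U zero          b c = 0ℤ
U (suc zero)    b c = 1ℤ
U (suc (suc k)) b c = b * U (suc k) b c - c * U k b c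

_≡_[mod_] : ℤ → ℤ → ℕ → Set
a ≡ b [mod n ] = + n ∣ a - b

_≡±_[mod_] : ℤ → ℤ → ℕ → Set
a ≡± b [mod n ] = a ≡ b [mod n ] ⊎ a ≡ - b [mod n ]

-- u ≡ a / b (mod n), with b inverted modulo n.  The relation includes the
-- invertibility of b; the inverse v is then unique modulo n.
_≡_÷_[mod_] : ℤ → ℤ → ℤ → ℕ → Set
u ≡ a ÷ b [mod n ] = ∃[ v ] (b * v ≡ 1ℤ [mod n ] × u ≡ a * v [mod n ])

-- The Legendre symbol (a / q); meaningful for q an odd prime.
legendre : ℤ → ℕ → ℤ
legendre a q with + q ∣? a
... | yes _ = 0ℤ
... | no  _ with any? {n = q} (λ r → + q ∣? (+ toℕ r * + toℕ r - a))
...   | yes _ = 1ℤ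
...   | no  _ = -1ℤ

{-# OPTIONS --safe #-}
-- Work in the Eisenstein integers, with w a cube root of unity and √−3 = 1 + 2w.  Modulo p the
-- quotient x / (√−3 y) is a square root of d, so that α = n x + m y √−3 is, up to the factor 2 y √−3,
-- the unit (m + n √d) / 2, and Binet's formula reduces U_{(p−1)/3}(m, −1) to the cube root of unity
-- w^e ≡ (α / ᾱ)^{(p−1)/3}.  This is a cubic residue symbol, which cubic reciprocity turns into the
-- symbol (p / β) of the rational integer p, where β is the primary associate of α.  Since
-- N(β) = p n² − 3 (2y)², the symbol (p / β) is a product of (3 / β), (2y / β) and (n / β), and the
-- last two are computed by reciprocity once more, because n and 2y divide α² − ᾱ².  What remains
-- is the value of e modulo 3, which depends only on m and n modulo 9.
--
-- Reciprocity is needed only between a composite β and a rational prime q.  For a prime β it comes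
-- from raising a Gauss sum to the q-th power; Jacobi sums provide the primary primes themselves.
module Submission where

open import Defs
open import Algebra.Bundles using (CommutativeRing; CommutativeSemiring)
import Algebra.Properties.CommutativeSemiring.Binomial as CommutativeSemiringBinomial
import Algebra.Properties.CommutativeSemiring.Exp as CommutativeSemiringExp
import Algebra.Properties.Ring as RingProperties
import Algebra.Properties.Semiring.Mult as SemiringMult
import Algebra.Properties.Semiring.Sum as SemiringSum
import Algebra.Structures.Biased as Biased
open import Data.Fin.Base as Fin using (Fin; toℕ; fromℕ; inject₁)
import Data.Fin.Permutation as Permutation
import Data.Fin.Properties as Fin
open import Data.Integer.Base as ℤ
  using (ℤ; +_; -[1+_]; _+_; _*_; _-_; -_; 0ℤ; 1ℤ; -1ℤ; _<_; _/_)
open import Data.Integer.Divisibility.Signed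
  using (_∣_; _∣?_; divides; ∣ᵤ⇒∣; ∣⇒∣ᵤ; ∣m∣n⇒∣m+n; ∣m∣n⇒∣m-n; ∣m⇒∣-m; ∣m⇒∣m*n; ∣n⇒∣m*n)
import Data.Integer.DivMod as ℤDivMod
import Data.Integer.Properties as ℤ
open import Data.Integer.Tactic.RingSolver using (solve-∀)
open import Data.List.Base as List using (List; []; _∷_)
import Data.List.Properties as List
open import Data.List.Relation.Unary.All using (All; []; _∷_)
open import Data.Maybe.Base using (just; nothing)
open import Data.Nat.Base as ℕ using (ℕ; zero; suc; _!)
open import Data.Nat.Combinatorics using (_C_; nCk≡n!/k![n-k]!; nCn≡1)
open import Data.Nat.Combinatorics.Specification using ([n∸k]!k!∣n!)
import Data.Nat.Coprimality as ℕCoprimality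
import Data.Nat.DivMod as ℕ/
import Data.Nat.Divisibility as ℕ∣
import Data.Nat.GCD as ℕGCD
open import Data.Nat.GeneralisedArithmetic using (fold)
open import Data.Nat.ListAction using (product)
open import Data.Nat.Primality
open import Data.Nat.Primality.Factorisation using (factorise; PrimeFactorisation)
import Data.Nat.Properties as ℕ
open import Data.Product.Base using (_×_; _,_; ∃-syntax; proj₁; proj₂)
open import Data.Sum.Base using (_⊎_; inj₁; inj₂)
open import Function.Base using (_∘_; case_of_)
open import Level using (0ℓ)
open import Relation.Binary.PropositionalEquality hiding (setoid; J)
import Relation.Binary.Reasoning.Setoid as SetoidReasoning
open import Relation.Binary.Structures using (IsEquivalence)
open import Relation.Nullary.Decidable using (Dec; yes; no; toWitness)
open import Relation.Nullary.Negation using (¬_; contradiction)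
import Tactic.RingSolver as RingSolver
open import Tactic.RingSolver.Core.AlmostCommutativeRing
  using (AlmostCommutativeRing; fromCommutativeRing)

-- Eisenstein integers

-- In place of a ring containing both w and an l-th root of unity, multiplication by the Gauss sum
-- becomes convolution with the character on functions of ℤ, and the powers of the sum are iterates
-- of this operator. Reciprocity is recorded in `Symbol` as a congruence modulo the rational prime q
-- whose two sides are multiplicative in β. It therefore passes from Jacobi sums and rational
-- integers to all primary β, by descent on the norm. The law involves powers of β modulo q. They
-- are evaluated where β² ≡ wⁱ β̄² modulo q; knowing the square of a symbol is enough, because
-- squaring permutes the cube roots of unity. The arguments n and 2y must then be coprime to the
-- norm of β, hence to each other. This is why their common factors are divided out, the parity of m
-- deciding where the factor 2 goes. If 3 does not divide m, then α becomes primary only after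
-- division by w or by w²; replacing n by -n exchanges the two, so that only w has to be treated.

infixl 6 _⊕_ _⊖_
infixl 7 _⊗_
infix  8 ⊝_

-- ⟨ a , b ⟩ is a + b w with w² + w + 1 = 0.
record E : Set where
  no-eta-equality
  pattern
  constructor ⟨_,_⟩
  field
    re im : ℤ
open E public

_⊕_ _⊗_ _⊖_ : E → E → E
⟨ a , b ⟩ ⊕ ⟨ c , d ⟩ = ⟨ a + c , b + d ⟩
⟨ a , b ⟩ ⊗ ⟨ c , d ⟩ = ⟨ a * c - b * d , a * d + b * c - b * d ⟩
⊝_ conj : E → E
⊝_ ⟨ a , b ⟩ = ⟨ - a , - b ⟩
_⊖_ x y = x ⊕ ⊝ y
conj ⟨ a , b ⟩ = ⟨ a - b , - b ⟩

ι : ℤ → E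
ι a = ⟨ a , 0ℤ ⟩

0E 1E w √-3 : E
0E = ι 0ℤ
1E = ι 1ℤ
w = ⟨ 0ℤ , 1ℤ ⟩
√-3 = ⟨ 1ℤ , + 2 ⟩

norm : E → ℤ
norm ⟨ a , b ⟩ = a * a - a * b + b * b

⊗-assoc : ∀ x y z → (x ⊗ y) ⊗ z ≡ x ⊗ (y ⊗ z)
⊗-assoc ⟨ a , b ⟩ ⟨ c , d ⟩ ⟨ e , f ⟩ = cong₂ ⟨_,_⟩ (p a b c d e f) (q a b c d e f)
  where
  p : ∀ a b c d e f → (a * c - b * d) * e - (a * d + b * c - b * d) * f
    ≡ a * (c * e - d * f) - b * (c * f + d * e - d * f)
  p = solve-∀
  q : ∀ a b c d e f → (a * c - b * d) * f + (a * d + b * c - b * d) * e - (a * d + b * c - b * d) * f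
    ≡ a * (c * f + d * e - d * f) + b * (c * e - d * f) - b * (c * f + d * e - d * f)
  q = solve-∀

⊗-comm : ∀ x y → x ⊗ y ≡ y ⊗ x
⊗-comm ⟨ a , b ⟩ ⟨ c , d ⟩ = cong₂ ⟨_,_⟩ (p a b c d) (q a b c d)
  where
  p : ∀ a b c d → a * c - b * d ≡ c * a - d * b
  p = solve-∀
  q : ∀ a b c d → a * d + b * c - b * d ≡ c * b + d * a - d * b
  q = solve-∀

⊗-identityˡ : ∀ x → 1E ⊗ x ≡ x
⊗-identityˡ ⟨ a , b ⟩ = cong₂ ⟨_,_⟩ (p a b) (q a b)
  where
  p : ∀ a b → 1ℤ * a - 0ℤ * b ≡ a
  p = solve-∀
  q : ∀ a b → 1ℤ * b + 0ℤ * a - 0ℤ * b ≡ b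
  q = solve-∀

⊗-distribʳ-⊕ : ∀ x y z → (y ⊕ z) ⊗ x ≡ y ⊗ x ⊕ z ⊗ x
⊗-distribʳ-⊕ ⟨ a , b ⟩ ⟨ c , d ⟩ ⟨ e , f ⟩ = cong₂ ⟨_,_⟩ (p a b c d e f) (q a b c d e f)
  where
  p : ∀ a b c d e f → (c + e) * a - (d + f) * b ≡ c * a - d * b + (e * a - f * b)
  p = solve-∀
  q : ∀ a b c d e f → (c + e) * b + (d + f) * a - (d + f) * b
    ≡ c * b + d * a - d * b + (e * b + f * a - f * b)
  q = solve-∀

eisensteinRing : CommutativeRing 0ℓ 0ℓ
eisensteinRing = record
  { Carrier = E ; _≈_ = _≡_ ; _+_ = _⊕_ ; _*_ = _⊗_ ; -_ = ⊝_ ; 0# = 0E ; 1# = 1E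
  ; isCommutativeRing = record
    { isRing = record
      { +-isAbelianGroup = record
        { isGroup = record
          { isMonoid = record
            { isSemigroup = record
              { isMagma = record { isEquivalence = isEquivalence ; ∙-cong = cong₂ _⊕_ }
              ; assoc = λ { ⟨ a , b ⟩ ⟨ c , d ⟩ ⟨ e , f ⟩ → cong₂ ⟨_,_⟩ (ℤ.+-assoc a c e) (ℤ.+-assoc b d f) } }
            ; identity = (λ { ⟨ a , b ⟩ → cong₂ ⟨_,_⟩ (ℤ.+-identityˡ a) (ℤ.+-identityˡ b) })
                       , (λ { ⟨ a , b ⟩ → cong₂ ⟨_,_⟩ (ℤ.+-identityʳ a) (ℤ.+-identityʳ b) }) }
          ; inverse = (λ { ⟨ a , b ⟩ → cong₂ ⟨_,_⟩ (ℤ.+-inverseˡ a) (ℤ.+-inverseˡ b) })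
                    , (λ { ⟨ a , b ⟩ → cong₂ ⟨_,_⟩ (ℤ.+-inverseʳ a) (ℤ.+-inverseʳ b) })
          ; ⁻¹-cong = cong ⊝_ }
        ; comm = λ { ⟨ a , b ⟩ ⟨ c , d ⟩ → cong₂ ⟨_,_⟩ (ℤ.+-comm a c) (ℤ.+-comm b d) } }
      ; *-cong = cong₂ _⊗_
      ; *-assoc = ⊗-assoc
      ; *-identity = ⊗-identityˡ , λ x → trans (⊗-comm x 1E) (⊗-identityˡ x)
      ; distrib = (λ x y z → trans (⊗-comm x (y ⊕ z))
                    (trans (⊗-distribʳ-⊕ x y z) (cong₂ _⊕_ (⊗-comm y x) (⊗-comm z x))))
                , ⊗-distribʳ-⊕ }
    ; *-comm = ⊗-comm } }

E-solver : AlmostCommutativeRing 0ℓ 0ℓ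
E-solver = fromCommutativeRing eisensteinRing λ where
  ⟨ + 0 , + 0 ⟩ → just refl
  _             → nothing


-- The Frobenius map

prime∣!⇒≤ : ∀ {q} → Prime q → ∀ k → q ℕ∣.∣ k ! → q ℕ.≤ k
prime∣!⇒≤ {q} q-prime zero q∣1 = contradiction (subst Prime (ℕ∣.∣1⇒≡1 q∣1) q-prime) ¬prime[1]
prime∣!⇒≤ q-prime (suc k) q∣ with euclidsLemma (suc k) (k !) q-prime q∣
... | inj₁ q∣k+1 = ℕ∣.∣⇒≤ q∣k+1
... | inj₂ q∣k! = ℕ.m≤n⇒m≤1+n (prime∣!⇒≤ q-prime k q∣k!)

prime∣C : ∀ {q} → Prime q → ∀ k → 0 ℕ.< k → k ℕ.< q → q ℕ∣.∣ q C k
prime∣C {q} q-prime k 0<k k<q with euclidsLemma (q C k) (k ! ℕ.* (q ℕ.∸ k) !) q-prime q∣product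
  where
  instance _ = prime⇒nonZero q-prime
  instance _ = k ℕ.!* (q ℕ.∸ k) !≢0
  k≤q = ℕ.<⇒≤ k<q
  product≡ : (q C k) ℕ.* (k ! ℕ.* (q ℕ.∸ k) !) ≡ q !
  product≡ = trans (cong (ℕ._* (k ! ℕ.* (q ℕ.∸ k) !)) (nCk≡n!/k![n-k]! k≤q))
    (ℕ/.m/n*n≡m (subst (ℕ∣._∣ q !) (ℕ.*-comm ((q ℕ.∸ k) !) (k !)) ([n∸k]!k!∣n! k≤q)))
  q∣q! : ∀ m .{{_ : ℕ.NonZero m}} → m ℕ∣.∣ m !
  q∣q! (suc m) = ℕ∣.m∣m*n (m !)
  q∣product = subst (q ℕ∣.∣_) (sym product≡) (q∣q! q)
... | inj₁ q∣C = q∣C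
... | inj₂ q∣k!l! with euclidsLemma (k !) ((q ℕ.∸ k) !) q-prime q∣k!l!
...   | inj₁ q∣k! = contradiction (prime∣!⇒≤ q-prime k q∣k!) (ℕ.<⇒≱ k<q)
...   | inj₂ q∣l! = contradiction (prime∣!⇒≤ q-prime (q ℕ.∸ k) q∣l!)
                      (ℕ.<⇒≱ (ℕ.∸-monoʳ-< 0<k (ℕ.<⇒≤ k<q)))

-- Additivity of the q-th power involves no subtraction, so a semiring is enough; this permits the
-- application to `groupRing`, for which only addition and multiplication are set up.
module Frobenius {a ℓ} (S : CommutativeSemiring a ℓ) {q : ℕ} (q-prime : Prime q)
  (q·≈0 : ∀ x → CommutativeSemiring._≈_ S
    (SemiringMult._×_ (CommutativeSemiring.semiring S) q x) (CommutativeSemiring.0# S)) where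

  open CommutativeSemiring S hiding (refl; sym; trans) renaming (_+_ to _⊞_; _*_ to _⊠_)

  private
    open SemiringMult semiring renaming (_×_ to _·_)
    open SemiringSum semiring
    open CommutativeSemiringExp S
    open CommutativeSemiringBinomial S
    module ≈ = CommutativeSemiring S
    open SetoidReasoning setoid

    ∣⇒·≈0 : ∀ {n} → q ℕ∣.∣ n → ∀ x → n · x ≈ 0#
    ∣⇒·≈0 {n} (ℕ∣.divides c eq) x = begin
      n · x           ≡⟨ cong (_· x) (trans eq (ℕ.*-comm c q)) ⟩
      (q ℕ.* c) · x   ≈⟨ ×-assocˡ x q c ⟨
      q · (c · x)     ≈⟨ q·≈0 _ ⟩
      0#              ∎

    expansion : ∀ x y n → (∀ k → 0 ℕ.< k → k ℕ.< suc n → q ℕ∣.∣ suc n C k) →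
      binomialExpansion x y (suc n) ≈ x ^ suc n ⊞ y ^ suc n
    expansion x y n q∣C = begin
      f Fin.zero ⊞ sum (f ∘ Fin.suc)
        ≈⟨ +-congˡ (sum-init-last (f ∘ Fin.suc)) ⟩
      f Fin.zero ⊞ (sum (f ∘ Fin.suc ∘ inject₁) ⊞ f (Fin.suc (fromℕ n)))
        ≈⟨ +-cong first (+-cong middle final) ⟩
      y ^ suc n ⊞ (0# ⊞ x ^ suc n)
        ≈⟨ +-congˡ (+-identityˡ _) ⟩
      y ^ suc n ⊞ x ^ suc n
        ≈⟨ +-comm _ _ ⟩
      x ^ suc n ⊞ y ^ suc n ∎
      where
      f = binomialTerm x y (suc n)
      first : f Fin.zero ≈ y ^ suc n
      first = begin
        1 · (1# ⊠ y ^ suc n)  ≈⟨ ×-homo-1 _ ⟩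
        1# ⊠ y ^ suc n        ≈⟨ *-identityˡ _ ⟩
        y ^ suc n             ∎
      term≈0 : ∀ i → f (Fin.suc (inject₁ i)) ≈ 0#
      term≈0 i = ∣⇒·≈0 (q∣C (suc (toℕ (inject₁ i))) (ℕ.s≤s ℕ.z≤n)
        (ℕ.s≤s (subst (ℕ._< n) (sym (Fin.toℕ-inject₁ i)) (Fin.toℕ<n i)))) _
      middle : sum (f ∘ Fin.suc ∘ inject₁) ≈ 0#
      middle = begin
        sum (f ∘ Fin.suc ∘ inject₁)  ≈⟨ sum-cong-≋ term≈0 ⟩
        sum {n} (λ _ → 0#)           ≈⟨ sum-replicate-zero n ⟩
        0#                           ∎
      final : f (Fin.suc (fromℕ n)) ≈ x ^ suc n
      final = begin
        f (Fin.suc (fromℕ n))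
          ≡⟨ cong (λ m → (suc n C suc m) · (x ^ suc m ⊠ y ^ (n ℕ.∸ m))) (Fin.toℕ-fromℕ n) ⟩
        (suc n C suc n) · (x ^ suc n ⊠ y ^ (n ℕ.∸ n))
          ≡⟨ cong₂ (λ i j → i · (x ^ suc n ⊠ y ^ j)) (nCn≡1 (suc n)) (ℕ.n∸n≡0 n) ⟩
        1 · (x ^ suc n ⊠ 1#)  ≈⟨ ×-homo-1 _ ⟩
        x ^ suc n ⊠ 1#        ≈⟨ *-identityʳ _ ⟩
        x ^ suc n             ∎

  ^q-distrib-+ : ∀ x y → (x ⊞ y) ^ q ≈ x ^ q ⊞ y ^ q
  ^q-distrib-+ x y = ≈.trans (theorem q x y) (go q q-prime (prime∣C q-prime))
    where
    -- The exponent n is separated from q, so that it can be written as a successor while the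
    -- binomial coefficients remain divisible by q.
    go : ∀ n → Prime n → (∀ k → 0 ℕ.< k → k ℕ.< n → q ℕ∣.∣ n C k) →
      binomialExpansion x y n ≈ x ^ n ⊞ y ^ n
    go zero 0-prime _ = contradiction 0-prime ¬prime[0]
    go (suc n) _ = expansion x y n

-- The group ring of ℤ, acting on functions by translations

-- A list of pairs (c , t) stands for the sum of the operators f ↦ c · f (· - t); two lists are
-- identified when they act in the same way on every function.
module GroupRing (K : CommutativeRing 0ℓ 0ℓ) where

  open CommutativeRing K hiding (refl; sym; trans)
    renaming (_+_ to _⊞_; _*_ to _⊠_; _-_ to _⊟_; -_ to neg)
  private
    module ≈ = CommutativeRing K
    open SetoidReasoning setoid
    open SemiringSum semiring using (sum)

  GroupRing : Set
  GroupRing = List (Carrier × ℤ)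

  act : GroupRing → (ℤ → Carrier) → ℤ → Carrier
  act []             f z = 0#
  act ((c , t) ∷ xs) f z = c ⊠ f (z - t) ⊞ act xs f z

  infix 4 _≈ᴳ_
  _≈ᴳ_ : GroupRing → GroupRing → Set
  xs ≈ᴳ ys = ∀ f z → act xs f z ≈ act ys f z

  translate : Carrier → ℤ → GroupRing → GroupRing
  translate c t = List.map λ (d , s) → c ⊠ d , t + s

  infixl 7 _*ᴳ_
  _*ᴳ_ : GroupRing → GroupRing → GroupRing
  []             *ᴳ ys = []
  ((c , t) ∷ xs) *ᴳ ys = translate c t ys List.++ xs *ᴳ ys

  act-++ : ∀ xs ys f z → act (xs List.++ ys) f z ≈ act xs f z ⊞ act ys f z
  act-++ []             ys f z = ≈.sym (+-identityˡ _)
  act-++ ((c , t) ∷ xs) ys f z = ≈.trans (+-congˡ (act-++ xs ys f z)) (≈.sym (+-assoc _ _ _))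

  act-cong : ∀ xs {f g} → (∀ z → f z ≈ g z) → ∀ z → act xs f z ≈ act xs g z
  act-cong []             f≈g z = ≈.refl
  act-cong ((c , t) ∷ xs) f≈g z = +-cong (*-congˡ (f≈g (z - t))) (act-cong xs f≈g z)

  interchange : ∀ a b c d → (a ⊞ b) ⊞ (c ⊞ d) ≈ (a ⊞ c) ⊞ (b ⊞ d)
  interchange a b c d = begin
    (a ⊞ b) ⊞ (c ⊞ d)  ≈⟨ +-assoc a b _ ⟩
    a ⊞ (b ⊞ (c ⊞ d))  ≈⟨ +-congˡ (+-assoc b c d) ⟨
    a ⊞ ((b ⊞ c) ⊞ d)  ≈⟨ +-congˡ (+-congʳ (+-comm b c)) ⟩
    a ⊞ ((c ⊞ b) ⊞ d)  ≈⟨ +-congˡ (+-assoc c b d) ⟩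
    a ⊞ (c ⊞ (b ⊞ d))  ≈⟨ +-assoc a c _ ⟨
    (a ⊞ c) ⊞ (b ⊞ d)  ∎

  act-+ : ∀ xs f g z → act xs (λ y → f y ⊞ g y) z ≈ act xs f z ⊞ act xs g z
  act-+ []             f g z = ≈.sym (+-identityˡ 0#)
  act-+ ((c , t) ∷ xs) f g z = ≈.trans (+-cong (distribˡ c _ _) (act-+ xs f g z)) (interchange _ _ _ _)

  act-0 : ∀ xs z → act xs (λ _ → 0#) z ≈ 0#
  act-0 []             z = ≈.refl
  act-0 ((c , t) ∷ xs) z = ≈.trans (+-cong (zeroʳ c) (act-0 xs z)) (+-identityˡ 0#)

  act-scale : ∀ xs c f z → act xs (λ y → c ⊠ f y) z ≈ c ⊠ act xs f z
  act-scale []             c f z = ≈.sym (zeroʳ c)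
  act-scale ((d , t) ∷ xs) c f z = begin
    d ⊠ (c ⊠ f (z - t)) ⊞ act xs (λ y → c ⊠ f y) z  ≈⟨ +-cong swap (act-scale xs c f z) ⟩
    c ⊠ (d ⊠ f (z - t)) ⊞ c ⊠ act xs f z            ≈⟨ distribˡ c _ _ ⟨
    c ⊠ (d ⊠ f (z - t) ⊞ act xs f z)                ∎
    where
    swap : d ⊠ (c ⊠ f (z - t)) ≈ c ⊠ (d ⊠ f (z - t))
    swap = ≈.trans (≈.sym (*-assoc d c _)) (≈.trans (*-congʳ (*-comm d c)) (*-assoc c d _))

  act-shift : ∀ xs t f z → act xs (λ y → f (y - t)) z ≡ act xs f (z - t)
  act-shift []             t f z = refl
  act-shift ((d , s) ∷ xs) t f z = cong₂ (λ y u → d ⊠ f y ⊞ u) (shifts z s t) (act-shift xs t f z)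
    where
    shifts : ∀ z s t → z - s - t ≡ z - t - s
    shifts = solve-∀

  act-translate : ∀ c t ys f z → act (translate c t ys) f z ≈ c ⊠ act ys f (z - t)
  act-translate c t []             f z = ≈.sym (zeroʳ c)
  act-translate c t ((d , s) ∷ ys) f z = begin
    (c ⊠ d) ⊠ f (z - (t + s)) ⊞ act (translate c t ys) f z
      ≈⟨ +-cong (*-assoc c d _) (act-translate c t ys f z) ⟩
    c ⊠ (d ⊠ f (z - (t + s))) ⊞ c ⊠ act ys f (z - t)
      ≡⟨ cong (λ y → c ⊠ (d ⊠ f y) ⊞ c ⊠ act ys f (z - t)) (shifts z t s) ⟩
    c ⊠ (d ⊠ f (z - t - s)) ⊞ c ⊠ act ys f (z - t)
      ≈⟨ distribˡ c _ _ ⟨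
    c ⊠ (d ⊠ f (z - t - s) ⊞ act ys f (z - t)) ∎
    where
    shifts : ∀ z t s → z - (t + s) ≡ z - t - s
    shifts = solve-∀

  act-* : ∀ xs ys f z → act (xs *ᴳ ys) f z ≈ act xs (act ys f) z
  act-* []             ys f z = ≈.refl
  act-* ((c , t) ∷ xs) ys f z = begin
    act (translate c t ys List.++ xs *ᴳ ys) f z        ≈⟨ act-++ (translate c t ys) _ f z ⟩
    act (translate c t ys) f z ⊞ act (xs *ᴳ ys) f z  ≈⟨ +-cong (act-translate c t ys f z) (act-* xs ys f z) ⟩
    c ⊠ act ys f (z - t) ⊞ act xs (act ys f) z       ∎

  -- Translations of ℤ commute with each other and the coefficients commute in K; through `act-*`
  -- this makes `_*ᴳ_` commutative.
  act-comm : ∀ xs ys f z → act xs (act ys f) z ≈ act ys (act xs f) z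
  act-comm []             ys f z = ≈.sym (act-0 ys z)
  act-comm ((c , t) ∷ xs) ys f z = begin
    c ⊠ act ys f (z - t) ⊞ act xs (act ys f) z
      ≡⟨ cong (λ u → c ⊠ u ⊞ act xs (act ys f) z) (act-shift ys t f z) ⟨
    c ⊠ act ys (λ y → f (y - t)) z ⊞ act xs (act ys f) z
      ≈⟨ +-cong (act-scale ys c _ z) (≈.sym (act-comm xs ys f z)) ⟨
    act ys (λ y → c ⊠ f (y - t)) z ⊞ act ys (act xs f) z
      ≈⟨ act-+ ys _ _ z ⟨
    act ys (λ y → c ⊠ f (y - t) ⊞ act xs f y) z ∎

  groupRing : CommutativeSemiring 0ℓ 0ℓ
  groupRing = record
    { Carrier = GroupRing ; _≈_ = _≈ᴳ_ ; _+_ = List._++_ ; _*_ = _*ᴳ_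
    ; 0# = [] ; 1# = (1# , 0ℤ) ∷ []
    ; isCommutativeSemiring = Biased.isCommutativeSemiringˡ record
      { +-isCommutativeMonoid = record
        { isMonoid = record
          { isSemigroup = record
            { isMagma = record
              { isEquivalence = isEquivalenceᴳ
              ; ∙-cong = λ {x} {y} {u} {v} x≈y u≈v f z → ≈.trans (act-++ x u f z)
                  (≈.trans (+-cong (x≈y f z) (u≈v f z)) (≈.sym (act-++ y v f z))) }
            ; assoc = λ x y z f u → ≈.reflexive (cong (λ l → act l f u) (List.++-assoc x y z)) }
          ; identity = (λ x f z → ≈.refl)
                     , (λ x f u → ≈.reflexive (cong (λ l → act l f u) (List.++-identityʳ x))) }
        ; comm = λ x y f z → ≈.trans (act-++ x y f z)
            (≈.trans (+-comm _ _) (≈.sym (act-++ y x f z))) }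
      ; *-isCommutativeMonoid = Biased.isCommutativeMonoidˡ record
        { isSemigroup = record
          { isMagma = record { isEquivalence = isEquivalenceᴳ ; ∙-cong = λ {x} {y} {u} {v} → *-congᴳ x y u v }
          ; assoc = λ x y z f u → ≈.trans (act-* (x *ᴳ y) z f u) (≈.trans (act-* x y _ u)
              (≈.sym (≈.trans (act-* x (y *ᴳ z) f u) (act-cong x (act-* y z f) u)))) }
        ; identityˡ = λ x f z → ≈.trans (act-* ((1# , 0ℤ) ∷ []) x f z)
            (≈.trans (+-identityʳ _) (≈.trans (*-identityˡ _)
              (≈.reflexive (cong (act x f) (ℤ.+-identityʳ z)))))
        ; comm = λ x y f z → ≈.trans (act-* x y f z)
            (≈.trans (act-comm x y f z) (≈.sym (act-* y x f z))) }
      ; distribʳ = λ x y z f u → ≈.trans (act-* (y List.++ z) x f u)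
          (≈.trans (act-++ y z (act x f) u) (≈.sym (≈.trans (act-++ (y *ᴳ x) (z *ᴳ x) f u)
            (+-cong (act-* y x f u) (act-* z x f u)))))
      ; zeroˡ = λ x f z → ≈.refl } }
    where
    isEquivalenceᴳ : IsEquivalence _≈ᴳ_
    isEquivalenceᴳ = record
      { refl = λ f z → ≈.refl
      ; sym = λ p f z → ≈.sym (p f z)
      ; trans = λ p q f z → ≈.trans (p f z) (q f z) }
    *-congᴳ : ∀ x y u v → x ≈ᴳ y → u ≈ᴳ v → x *ᴳ u ≈ᴳ y *ᴳ v
    *-congᴳ x y u v x≈y u≈v f z = begin
      act (x *ᴳ u) f z   ≈⟨ act-* x u f z ⟩
      act x (act u f) z  ≈⟨ act-cong x (u≈v f) z ⟩
      act x (act v f) z  ≈⟨ x≈y (act v f) z ⟩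
      act y (act v f) z  ≈⟨ act-* y v f z ⟨
      act (y *ᴳ v) f z   ∎

  private
    module K^ = CommutativeSemiringExp (commutativeSemiring)
    module G^ = CommutativeSemiringExp groupRing
    module K× = SemiringMult semiring
    module G× = SemiringMult (CommutativeSemiring.semiring groupRing)

  act-^ : ∀ xs n f z → act (xs G^.^ n) f z ≈ fold f (act xs) n z
  act-^ xs zero    f z = ≈.trans (+-identityʳ _) (≈.trans (*-identityˡ _)
    (≈.reflexive (cong f (ℤ.+-identityʳ z))))
  act-^ xs (suc n) f z = ≈.trans (act-* xs (xs G^.^ n) f z) (act-cong xs (act-^ xs n f) z)

  act-× : ∀ n xs f z → act (n G×.× xs) f z ≈ n K×.× act xs f z
  act-× zero    xs f z = ≈.refl
  act-× (suc n) xs f z = ≈.trans (act-++ xs (n G×.× xs) f z) (+-congˡ (act-× n xs f z))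

  monomial-^ : ∀ c t n → ((c , t) ∷ []) G^.^ n ≈ᴳ (c K^.^ n , + n * t) ∷ []
  monomial-^ c t zero    f z = ≈.refl
  monomial-^ c t (suc n) f z = begin
    act (((c , t) ∷ []) G^.^ suc n) f z
      ≈⟨ act-* ((c , t) ∷ []) (((c , t) ∷ []) G^.^ n) f z ⟩
    c ⊠ act (((c , t) ∷ []) G^.^ n) f (z - t) ⊞ 0#
      ≈⟨ +-congʳ (*-congˡ (monomial-^ c t n f (z - t))) ⟩
    c ⊠ (c K^.^ n ⊠ f (z - t - + n * t) ⊞ 0#) ⊞ 0#
      ≈⟨ +-congʳ (*-congˡ (+-identityʳ _)) ⟩
    c ⊠ (c K^.^ n ⊠ f (z - t - + n * t)) ⊞ 0#
      ≈⟨ +-congʳ (*-assoc _ _ _) ⟨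
    c K^.^ suc n ⊠ f (z - t - + n * t) ⊞ 0#
      ≡⟨ cong (λ y → c K^.^ suc n ⊠ f y ⊞ 0#) (shifts z t (+ n)) ⟩
    c K^.^ suc n ⊠ f (z - + suc n * t) ⊞ 0# ∎
    where
    shifts : ∀ z t n → z - t - n * t ≡ z - (1ℤ + n) * t
    shifts = solve-∀

  convolve : ∀ {l} → (Fin l → Carrier) → (ℤ → Carrier) → ℤ → Carrier
  convolve χ f z = sum λ i → χ i ⊠ f (z - + toℕ i)

  module _ {q} (q-prime : Prime q) (q×≈0 : ∀ x → q K×.× x ≈ 0#) where

    act-frobenius : ∀ xs → xs G^.^ q ≈ᴳ List.map (λ (c , t) → c K^.^ q , + q * t) xs
    act-frobenius [] = []^ q q-prime
      where
      []^ : ∀ n → Prime n → [] G^.^ n ≈ᴳ []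
      []^ zero    0-prime = contradiction 0-prime ¬prime[0]
      []^ (suc n) _       f z = ≈.refl
    act-frobenius ((c , t) ∷ xs) f z = begin
      act (((c , t) ∷ xs) G^.^ q) f z
        ≈⟨ ^q-distrib-+ ((c , t) ∷ []) xs f z ⟩
      act (((c , t) ∷ []) G^.^ q List.++ xs G^.^ q) f z
        ≈⟨ act-++ (((c , t) ∷ []) G^.^ q) _ f z ⟩
      act (((c , t) ∷ []) G^.^ q) f z ⊞ act (xs G^.^ q) f z
        ≈⟨ +-cong (≈.trans (monomial-^ c t q f z) (+-identityʳ _)) (act-frobenius xs f z) ⟩
      c K^.^ q ⊠ f (z - + q * t) ⊞ act (List.map (λ (c , t) → c K^.^ q , + q * t) xs) f z ∎
      where open Frobenius groupRing q-prime (λ x f z → ≈.trans (act-× q x f z) (q×≈0 _))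

    -- Convolving q times is acting by the q-th power of one group-ring element, and in
    -- characteristic q that power only raises the coefficients to the q-th power and dilates the
    -- translations by q. This stands in for raising a Gauss sum to the q-th power.
    convolve-frobenius : ∀ {l} (χ : Fin l → Carrier) f z →
      fold f (convolve χ) q z ≈ sum λ i → χ i K^.^ q ⊠ f (z - + q * + toℕ i)
    convolve-frobenius {l} χ f z = begin
      fold f (convolve χ) q z  ≈⟨ fold-convolve q z ⟨
      fold f (act G) q z       ≈⟨ act-^ G q f z ⟨
      act (G G^.^ q) f z       ≈⟨ act-frobenius G f z ⟩
      act (List.map _ G) f z
        ≡⟨ cong (λ xs → act xs f z) (List.map-tabulate (λ i → χ i , + toℕ i) _) ⟩
      act (List.tabulate λ i → χ i K^.^ q , + q * + toℕ i) f z
        ≈⟨ act-tabulate (λ i → χ i K^.^ q , + q * + toℕ i) f z ⟩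
      sum (λ i → χ i K^.^ q ⊠ f (z - + q * + toℕ i)) ∎
      where
      G = List.tabulate λ i → χ i , + toℕ i
      act-tabulate : ∀ {l} (g : Fin l → Carrier × ℤ) f z →
        act (List.tabulate g) f z ≈ sum λ i → proj₁ (g i) ⊠ f (z - proj₂ (g i))
      act-tabulate {zero}  g f z = ≈.refl
      act-tabulate {suc l} g f z = +-congˡ (act-tabulate (g ∘ Fin.suc) f z)
      fold-convolve : ∀ n z → fold f (act G) n z ≈ fold f (convolve χ) n z
      fold-convolve zero    z = ≈.refl
      fold-convolve (suc n) z = ≈.trans (act-cong G (fold-convolve n) z)
        (act-tabulate (λ i → χ i , + toℕ i) _ z)

-- Congruences

-- The quotient ring keeps the carrier and coarsens the equality, so that representatives are used
-- directly and a congruence carries its explicit quotient.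
module Quotient (R : CommutativeRing 0ℓ 0ℓ) (m : CommutativeRing.Carrier R) where

  private
    R-solver = fromCommutativeRing R λ _ → nothing
    open AlmostCommutativeRing R-solver renaming (_+_ to _⊞_; _*_ to _⊠_; -_ to neg) hiding (sym; refl; trans)
    module ≈ = CommutativeRing R
    open RingProperties ≈.ring using (-‿distribʳ-*)
    open SetoidReasoning ≈.setoid

  infix 4 _≋_
  record _≋_ (x y : Carrier) : Set where
    constructor by
    field
      quotient : Carrier
      equality : x ≈ y ⊞ m ⊠ quotient

  ≋-reflexive : ∀ {x y} → x ≈ y → x ≋ y
  ≋-reflexive {x} {y} x≈y = by 0# (begin
    x            ≈⟨ x≈y ⟩
    y            ≈⟨ ≈.+-identityʳ y ⟨
    y ⊞ 0#       ≈⟨ ≈.+-congˡ (≈.zeroʳ m) ⟨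
    y ⊞ m ⊠ 0#   ∎)

  ≋-sym : ∀ {x y} → x ≋ y → y ≋ x
  ≋-sym {x} {y} (by c eq) = by (neg c) (begin
    y                        ≈⟨ ≈.+-identityʳ y ⟨
    y ⊞ 0#                   ≈⟨ ≈.+-congˡ (≈.zeroʳ m) ⟨
    y ⊞ m ⊠ 0#               ≈⟨ ≈.+-congˡ (≈.*-congˡ (≈.-‿inverseʳ c)) ⟨
    y ⊞ m ⊠ (c ⊞ neg c)      ≈⟨ lemma y m c (neg c) ⟩
    (y ⊞ m ⊠ c) ⊞ m ⊠ neg c  ≈⟨ ≈.+-congʳ eq ⟨
    x ⊞ m ⊠ neg c            ∎)
    where
    lemma : ∀ y m c d → y ⊞ m ⊠ (c ⊞ d) ≈ (y ⊞ m ⊠ c) ⊞ m ⊠ d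
    lemma = RingSolver.solve-∀ R-solver

  ≋-trans : ∀ {x y z} → x ≋ y → y ≋ z → x ≋ z
  ≋-trans {x} {y} {z} (by c p) (by d q) = by (d ⊞ c) (≈.trans p (≈.trans (≈.+-congʳ q) (lemma z m c d)))
    where
    lemma : ∀ z m c d → (z ⊞ m ⊠ d) ⊞ m ⊠ c ≈ z ⊞ m ⊠ (d ⊞ c)
    lemma = RingSolver.solve-∀ R-solver

  ring : CommutativeRing 0ℓ 0ℓ
  ring = record
    { Carrier = Carrier ; _≈_ = _≋_ ; _+_ = _⊞_ ; _*_ = _⊠_ ; -_ = neg ; 0# = 0# ; 1# = 1#
    ; isCommutativeRing = record
      { isRing = record
        { +-isAbelianGroup = record
          { isGroup = record
            { isMonoid = record
              { isSemigroup = record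
                { isMagma = record
                  { isEquivalence = record
                    { refl = ≋-reflexive ≈.refl ; sym = ≋-sym ; trans = ≋-trans }
                  ; ∙-cong = λ {x} {y} {u} {v} (by c p) (by d q) →
                      by (c ⊞ d) (≈.trans (≈.+-cong p q) (add y v m c d)) }
                ; assoc = λ x y z → ≋-reflexive (≈.+-assoc x y z) }
              ; identity = ≋-reflexive ∘ ≈.+-identityˡ , ≋-reflexive ∘ ≈.+-identityʳ }
            ; inverse = ≋-reflexive ∘ ≈.-‿inverseˡ , ≋-reflexive ∘ ≈.-‿inverseʳ
            ; ⁻¹-cong = λ {x} {y} (by c p) → by (neg c) (≈.trans (≈.-‿cong p) (negate y m c)) }
          ; comm = λ x y → ≋-reflexive (≈.+-comm x y) }
        ; *-cong = λ {x} {y} {u} {v} p q → ≋-trans (multiply u p)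
            (≋-trans (≋-reflexive (≈.*-comm y u)) (≋-trans (multiply y q) (≋-reflexive (≈.*-comm v y))))
        ; *-assoc = λ x y z → ≋-reflexive (≈.*-assoc x y z)
        ; *-identity = ≋-reflexive ∘ ≈.*-identityˡ , ≋-reflexive ∘ ≈.*-identityʳ
        ; distrib = (λ x y z → ≋-reflexive (≈.distribˡ x y z)) , (λ x y z → ≋-reflexive (≈.distribʳ x y z)) }
      ; *-comm = λ x y → ≋-reflexive (≈.*-comm x y) } }
    where
    add : ∀ y v m c d → (y ⊞ m ⊠ c) ⊞ (v ⊞ m ⊠ d) ≈ (y ⊞ v) ⊞ m ⊠ (c ⊞ d)
    add = RingSolver.solve-∀ R-solver
    negate : ∀ y m c → neg (y ⊞ m ⊠ c) ≈ neg y ⊞ m ⊠ neg c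
    negate y m c = ≈.trans (≈.sym (-‿+-comm y (m ⊠ c))) (≈.+-congˡ (-‿distribʳ-* m c))
    multiply : ∀ {x y} z → x ≋ y → x ⊠ z ≋ y ⊠ z
    multiply {x} {y} z (by c p) = by (c ⊠ z)
      (≈.trans (≈.*-congʳ p) (≈.trans (≈.distribʳ z y _) (≈.+-congˡ (≈.*-assoc m c z))))

  m≋0 : ∀ c → m ⊠ c ≋ 0#
  m≋0 c = by c (≈.sym (≈.+-identityˡ _))

  open CommutativeRing ring public using (setoid)
    renaming (refl to ≋-refl; +-cong to ≋-+; *-cong to ≋-*; -‿cong to ≋-neg;
              *-congˡ to ≋-*ˡ; *-congʳ to ≋-*ʳ; +-congˡ to ≋-+ˡ; +-congʳ to ≋-+ʳ)

module E/ (q : ℤ) = Quotient eisensteinRing (ι q)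
module ℤ/ (q : ℤ) = Quotient ℤ.+-*-commutativeRing q

module E+ = CommutativeRing eisensteinRing
module EΣ = SemiringSum E+.semiring
open EΣ using () renaming (sum to sumᴱ) public
module E^ = CommutativeSemiringExp E+.commutativeSemiring
open E^ public using () renaming (_^_ to _^ᴱ_)

^-≋ : ∀ {q x y} n → E/._≋_ q x y → E/._≋_ q (x ^ᴱ n) (y ^ᴱ n)
^-≋ {q} zero    x≋y = E/.≋-refl q
^-≋ {q} (suc n) x≋y = E/.≋-* q x≋y (^-≋ n x≋y)

1^ : ∀ n → 1E ^ᴱ n ≡ 1E
1^ zero    = refl
1^ (suc n) = trans (⊗-identityˡ _) (1^ n)

module Frobeniusᴱ {q} (q-prime : Prime q) where
  open E/ (+ q)
  private
    K : CommutativeRing 0ℓ 0ℓ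
    K = ring
    module K = CommutativeRing K
    module K^ = CommutativeSemiringExp K.commutativeSemiring
    module K× = SemiringMult K.semiring

  ^-agree : ∀ x n → x K^.^ n ≡ x ^ᴱ n
  ^-agree x zero    = refl
  ^-agree x (suc n) = cong (x ⊗_) (^-agree x n)

  ×≋0 : ∀ x → q K×.× x ≋ 0E
  ×≋0 x = ≋-trans (≋-reflexive (×-ι q)) (m≋0 x)
    where
    zero-⊗ : ∀ x → ι 0ℤ ⊗ x ≡ 0E
    zero-⊗ = RingSolver.solve-∀ E-solver
    suc-⊗ : ∀ x n → x ⊕ n ⊗ x ≡ (1E ⊕ n) ⊗ x
    suc-⊗ = RingSolver.solve-∀ E-solver
    ×-ι : ∀ n → n K×.× x ≡ ι (+ n) ⊗ x
    ×-ι zero    = sym (zero-⊗ x)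
    ×-ι (suc n) = trans (cong (x ⊕_) (×-ι n)) (suc-⊗ x (ι (+ n)))

  ^q-⊕ : ∀ x y → (x ⊕ y) ^ᴱ q ≋ x ^ᴱ q ⊕ y ^ᴱ q
  ^q-⊕ x y = subst₂ _≋_ (^-agree (x ⊕ y) q) (cong₂ _⊕_ (^-agree x q) (^-agree y q)) (^q-distrib-+ x y)
    where open Frobenius K.commutativeSemiring q-prime ×≋0

  open GroupRing K public using () renaming (convolve to convolveᴱ)

  convolve-frobeniusᴱ : ∀ {l} (χ : Fin l → E) f z →
    fold f (convolveᴱ χ) q z ≋ sumᴱ (λ i → χ i ^ᴱ q ⊗ f (z - + q * + toℕ i))
  convolve-frobeniusᴱ χ f z = ≋-trans (GroupRing.convolve-frobenius K q-prime ×≋0 χ f z)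
    (≋-reflexive (sum-cong-≗ λ i → cong (_⊗ f (z - + q * + toℕ i)) (^-agree (χ i) q)))
    where open SemiringSum K.semiring

-- Conjugation, rational integers and the norm

conj-⊕ : ∀ x y → conj (x ⊕ y) ≡ conj x ⊕ conj y
conj-⊕ ⟨ a , b ⟩ ⟨ c , d ⟩ = cong₂ ⟨_,_⟩ (p a b c d) (q b d)
  where
  p : ∀ a b c d → a + c - (b + d) ≡ a - b + (c - d)
  p = solve-∀
  q : ∀ b d → - (b + d) ≡ - b + - d
  q = solve-∀

conj-⊗ : ∀ x y → conj (x ⊗ y) ≡ conj x ⊗ conj y
conj-⊗ ⟨ a , b ⟩ ⟨ c , d ⟩ = cong₂ ⟨_,_⟩ (p a b c d) (q a b c d)
  where
  p : ∀ a b c d → a * c - b * d - (a * d + b * c - b * d) ≡ (a - b) * (c - d) - (- b) * (- d)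
  p = solve-∀
  q : ∀ a b c d → - (a * d + b * c - b * d) ≡ (a - b) * (- d) + (- b) * (c - d) - (- b) * (- d)
  q = solve-∀

conj-involutive : ∀ x → conj (conj x) ≡ x
conj-involutive ⟨ a , b ⟩ = cong₂ ⟨_,_⟩ (p a b) (ℤ.neg-involutive b)
  where
  p : ∀ a b → a - b - (- b) ≡ a
  p = solve-∀

conj-ι : ∀ a → conj (ι a) ≡ ι a
conj-ι a = cong (λ b → ⟨ b , 0ℤ ⟩) (ℤ.+-identityʳ a)

ι-* : ∀ a b → ι (a * b) ≡ ι a ⊗ ι b
ι-* a b = cong₂ ⟨_,_⟩ (p a b) (q a b)
  where
  p : ∀ a b → a * b ≡ a * b - 0ℤ * 0ℤ
  p = solve-∀
  q : ∀ a b → 0ℤ ≡ a * 0ℤ + 0ℤ * b - 0ℤ * 0ℤ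
  q = solve-∀

ι-injective : ∀ {a b} → ι a ≡ ι b → a ≡ b
ι-injective refl = refl

ι-^ : ∀ a n → ι (a ℤ.^ n) ≡ ι a ^ᴱ n
ι-^ a zero    = refl
ι-^ a (suc n) = trans (ι-* a (a ℤ.^ n)) (cong (ι a ⊗_) (ι-^ a n))

⟨⟩-ι : ∀ a b → ⟨ a , b ⟩ ≡ ι a ⊕ w ⊗ ι b
⟨⟩-ι a b = cong₂ ⟨_,_⟩ (p a b) (q a b)
  where
  p : ∀ a b → a ≡ a + (0ℤ * b - 1ℤ * 0ℤ)
  p = solve-∀
  q : ∀ a b → b ≡ 0ℤ + (0ℤ * 0ℤ + 1ℤ * b - 1ℤ * 0ℤ)
  q = solve-∀

conj-⟨⟩ : ∀ a b → conj ⟨ a , b ⟩ ≡ ι a ⊕ w ⊗ w ⊗ ι b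
conj-⟨⟩ a b = cong₂ ⟨_,_⟩ (p a b) (q a b)
  where
  p : ∀ a b → a - b ≡ a + (-1ℤ * b - -1ℤ * 0ℤ)
  p = solve-∀
  q : ∀ a b → - b ≡ 0ℤ + (-1ℤ * 0ℤ + -1ℤ * b - -1ℤ * 0ℤ)
  q = solve-∀

⊗-conj : ∀ x → x ⊗ conj x ≡ ι (norm x)
⊗-conj ⟨ a , b ⟩ = cong₂ ⟨_,_⟩ (p a b) (q a b)
  where
  p : ∀ a b → a * (a - b) - b * (- b) ≡ a * a - a * b + b * b
  p = solve-∀
  q : ∀ a b → a * (- b) + b * (a - b) - b * (- b) ≡ 0ℤ
  q = solve-∀

norm-⊗ : ∀ x y → norm (x ⊗ y) ≡ norm x * norm y
norm-⊗ ⟨ a , b ⟩ ⟨ c , d ⟩ = p a b c d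
  where
  p : ∀ a b c d → (a * c - b * d) * (a * c - b * d) - (a * c - b * d) * (a * d + b * c - b * d)
      + (a * d + b * c - b * d) * (a * d + b * c - b * d)
    ≡ (a * a - a * b + b * b) * (c * c - c * d + d * d)
  p = solve-∀

norm-conj : ∀ x → norm (conj x) ≡ norm x
norm-conj ⟨ a , b ⟩ = p a b
  where
  p : ∀ a b → (a - b) * (a - b) - (a - b) * (- b) + (- b) * (- b) ≡ a * a - a * b + b * b
  p = solve-∀

conj-^ : ∀ x n → conj (x ^ᴱ n) ≡ conj x ^ᴱ n
conj-^ x zero    = refl
conj-^ x (suc n) = trans (conj-⊗ x (x ^ᴱ n)) (cong (conj x ⊗_) (conj-^ x n))

-- κ β = N(β) β is the quantity to which the Frobenius map relates a Jacobi sum β.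
κ : E → E
κ β = β ⊗ β ⊗ conj β

module ModE (q : ℤ) where
  open E/ q public hiding (ring)
  open SetoidReasoning setoid public

  conj-≋ : ∀ {x y} → x ≋ y → conj x ≋ conj y
  conj-≋ {x} {y} (by c eq) = by (conj c) (trans (cong conj eq) (trans (conj-⊕ y (ι q ⊗ c))
    (cong (conj y ⊕_) (trans (conj-⊗ (ι q) c) (cong (_⊗ conj c) (conj-ι q))))))

  private
    re-ι : ∀ a b c → re (ι b ⊕ ι a ⊗ c) ≡ b + a * re c
    re-ι a b ⟨ c , d ⟩ = p a b c d
      where
      p : ∀ a b c d → b + (a * c - 0ℤ * d) ≡ b + a * c
      p = solve-∀

  ι-≋ : ∀ {a b} → ℤ/._≋_ q a b → ι a ≋ ι b
  ι-≋ {a} {b} (ℤ/.by c eq) = by (ι c) (trans (cong ι eq) (cong₂ ⟨_,_⟩ (p b q c) (p′ q c)))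
    where
    p : ∀ b q c → b + q * c ≡ b + (q * c - 0ℤ * 0ℤ)
    p = solve-∀
    p′ : ∀ q c → 0ℤ ≡ 0ℤ + (q * 0ℤ + 0ℤ * c - 0ℤ * 0ℤ)
    p′ = solve-∀

  ι-≋⁻¹ : ∀ {a b} → ι a ≋ ι b → ℤ/._≋_ q a b
  ι-≋⁻¹ {a} {b} (by c eq) = ℤ/.by (re c) (trans (cong re eq) (re-ι q b c))

-- Cube roots of unity

data μ₃ : E → Set where
  one : μ₃ 1E
  ω   : μ₃ w
  ω²  : μ₃ (w ⊗ w)

μ₃-⊗ : ∀ {x y} → μ₃ x → μ₃ y → μ₃ (x ⊗ y)
μ₃-⊗ one one = one
μ₃-⊗ one ω   = ω
μ₃-⊗ one ω²  = ω²
μ₃-⊗ ω   one = ω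
μ₃-⊗ ω   ω   = ω²
μ₃-⊗ ω   ω²  = one
μ₃-⊗ ω²  one = ω²
μ₃-⊗ ω²  ω   = one
μ₃-⊗ ω²  ω²  = ω

μ₃-conj : ∀ {x} → μ₃ x → μ₃ (conj x)
μ₃-conj one = one
μ₃-conj ω   = ω²
μ₃-conj ω²  = ω

μ₃-⊗-conj : ∀ {x} → μ₃ x → x ⊗ conj x ≡ 1E
μ₃-⊗-conj one = refl
μ₃-⊗-conj ω   = refl
μ₃-⊗-conj ω²  = refl

μ₃-conj≡² : ∀ {x} → μ₃ x → conj x ≡ x ⊗ x
μ₃-conj≡² one = refl
μ₃-conj≡² ω   = refl
μ₃-conj≡² ω²  = refl

μ₃-³ : ∀ {x} → μ₃ x → x ⊗ x ⊗ x ≡ 1E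
μ₃-³ one = refl
μ₃-³ ω   = refl
μ₃-³ ω²  = refl

μ₃-idempotent : ∀ {x} → μ₃ x → x ≡ x ⊗ x → x ≡ 1E
μ₃-idempotent one _ = refl
μ₃-idempotent ω ()
μ₃-idempotent ω² ()

μ₃-involutive : ∀ {x} → μ₃ x → x ⊗ x ≡ 1E → x ≡ 1E
μ₃-involutive one _ = refl
μ₃-involutive ω ()
μ₃-involutive ω² ()

-- Distinct cube roots of unity differ by an associate of √-3. Hence they stay distinct modulo every
-- prime other than 3, which turns congruences between symbols into equalities.
μ₃-norm : ∀ {x y} → μ₃ x → μ₃ y → x ≡ y ⊎ norm (x ⊖ y) ≡ + 3
μ₃-norm one one = inj₁ refl
μ₃-norm one ω   = inj₂ refl
μ₃-norm one ω²  = inj₂ refl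
μ₃-norm ω   one = inj₂ refl
μ₃-norm ω   ω   = inj₁ refl
μ₃-norm ω   ω²  = inj₂ refl
μ₃-norm ω²  one = inj₂ refl
μ₃-norm ω²  ω   = inj₂ refl
μ₃-norm ω²  ω²  = inj₁ refl

-- The powers of w with exponents in ℤ, where w ⊗ w serves as the inverse of w. Symbols are computed
-- through these exponents, which matter only modulo 3 (`W-≋`).
W : ℤ → E
W (+ n)    = w ^ᴱ n
W -[1+ n ] = (w ⊗ w) ^ᴱ suc n

W-suc : ∀ i → W (1ℤ + i) ≡ w ⊗ W i
W-suc (+ n)          = refl
W-suc -[1+ zero ]    = refl
W-suc -[1+ (suc n) ] = p ((w ⊗ w) ^ᴱ suc n)
  where
  p : ∀ x → x ≡ w ⊗ (w ⊗ w ⊗ x)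
  p = RingSolver.solve-∀ E-solver

W-pred : ∀ i → W (-1ℤ + i) ≡ w ⊗ w ⊗ W i
W-pred i = trans (p (W (-1ℤ + i))) (cong (w ⊗ w ⊗_) (trans (sym (W-suc (-1ℤ + i))) (cong W (q i))))
  where
  p : ∀ x → x ≡ w ⊗ w ⊗ (w ⊗ x)
  p = RingSolver.solve-∀ E-solver
  q : ∀ i → 1ℤ + (-1ℤ + i) ≡ i
  q = solve-∀

W-+ : ∀ i j → W (i + j) ≡ W i ⊗ W j
W-+ (+ zero) j = trans (cong W (ℤ.+-identityˡ j)) (sym (⊗-identityˡ (W j)))
W-+ (+ suc n) j = begin
  W (+ suc n + j)       ≡⟨ cong W (ℤ.+-assoc 1ℤ (+ n) j) ⟩
  W (1ℤ + (+ n + j))    ≡⟨ W-suc (+ n + j) ⟩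
  w ⊗ W (+ n + j)       ≡⟨ cong (w ⊗_) (W-+ (+ n) j) ⟩
  w ⊗ (W (+ n) ⊗ W j)   ≡⟨ ⊗-assoc w (W (+ n)) (W j) ⟨
  W (+ suc n) ⊗ W j     ∎
  where open ≡-Reasoning
W-+ -[1+ zero ] j = W-pred j
W-+ -[1+ suc n ] j = begin
  W (-[1+ suc n ] + j)                 ≡⟨ cong W (ℤ.+-assoc -1ℤ -[1+ n ] j) ⟩
  W (-1ℤ + (-[1+ n ] + j))             ≡⟨ W-pred (-[1+ n ] + j) ⟩
  w ⊗ w ⊗ W (-[1+ n ] + j)             ≡⟨ cong (w ⊗ w ⊗_) (W-+ -[1+ n ] j) ⟩
  w ⊗ w ⊗ (W -[1+ n ] ⊗ W j)           ≡⟨ ⊗-assoc (w ⊗ w) (W -[1+ n ]) (W j) ⟨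
  W -[1+ suc n ] ⊗ W j                 ∎
  where open ≡-Reasoning

W-μ₃ : ∀ i → μ₃ (W i)
W-μ₃ (+ zero)      = one
W-μ₃ (+ suc n)     = μ₃-⊗ ω (W-μ₃ (+ n))
W-μ₃ -[1+ zero ]   = ω²
W-μ₃ -[1+ suc n ]  = μ₃-⊗ ω² (W-μ₃ -[1+ n ])

W-3* : ∀ i → W (+ 3 * i) ≡ 1E
W-3* i = begin
  W (+ 3 * i)          ≡⟨ cong W (p i) ⟩
  W (i + i + i)        ≡⟨ W-+ (i + i) i ⟩
  W (i + i) ⊗ W i      ≡⟨ cong (_⊗ W i) (W-+ i i) ⟩
  W i ⊗ W i ⊗ W i      ≡⟨ μ₃-³ (W-μ₃ i) ⟩
  1E                   ∎
  where
  open ≡-Reasoning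
  p : ∀ i → + 3 * i ≡ i + i + i
  p = solve-∀

W-≋ : ∀ {i j} → ℤ/._≋_ (+ 3) i j → W i ≡ W j
W-≋ {i} {j} (ℤ/.by c eq) = begin
  W i                  ≡⟨ cong W eq ⟩
  W (j + + 3 * c)      ≡⟨ W-+ j (+ 3 * c) ⟩
  W j ⊗ W (+ 3 * c)    ≡⟨ cong (W j ⊗_) (W-3* c) ⟩
  W j ⊗ 1E             ≡⟨ E+.*-identityʳ (W j) ⟩
  W j                  ∎
  where open ≡-Reasoning

W-neg : ∀ i → W (- i) ≡ conj (W i)
W-neg i = begin
  W (- i)              ≡⟨ W-≋ { - i} {i + i} (ℤ/.by (- i) (p i)) ⟩
  W (i + i)            ≡⟨ W-+ i i ⟩
  W i ⊗ W i            ≡⟨ μ₃-conj≡² (W-μ₃ i) ⟨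
  conj (W i)           ∎
  where
  open ≡-Reasoning
  p : ∀ i → - i ≡ i + i + + 3 * (- i)
  p = solve-∀

W-⊗-neg : ∀ i → W i ⊗ W (- i) ≡ 1E
W-⊗-neg i = trans (cong (W i ⊗_) (W-neg i)) (μ₃-⊗-conj (W-μ₃ i))

W-* : ∀ i n → W (+ n * i) ≡ W i ^ᴱ n
W-* i zero    = cong W (ℤ.*-zeroˡ i)
W-* i (suc n) = begin
  W (+ suc n * i)       ≡⟨ cong W (p (+ n) i) ⟩
  W (i + + n * i)       ≡⟨ W-+ i (+ n * i) ⟩
  W i ⊗ W (+ n * i)     ≡⟨ cong (W i ⊗_) (W-* i n) ⟩
  W i ⊗ W i ^ᴱ n        ∎
  where
  open ≡-Reasoning
  p : ∀ n i → (1ℤ + n) * i ≡ i + n * i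
  p = solve-∀

-- Coprime integers

-- With Bézout's identity as the definition, closure under products, factors and congruence becomes
-- a polynomial identity, and inverses modulo a are at hand.
data Coprime (a b : ℤ) : Set where
  bezout : ∀ x y → a * x + b * y ≡ 1ℤ → Coprime a b

coprime-sym : ∀ {a b} → Coprime a b → Coprime b a
coprime-sym {a} {b} (bezout x y eq) = bezout y x (trans (ℤ.+-comm (b * y) (a * x)) eq)

coprime-* : ∀ {a b c} → Coprime a b → Coprime a c → Coprime a (b * c)
coprime-* {a} {b} {c} (bezout x y p) (bezout u v q) =
  bezout (x * (a * u + c * v) + b * y * u) (y * v) (trans (lemma a b c x y u v) (cong₂ _*_ p q))
  where
  lemma : ∀ a b c x y u v → a * (x * (a * u + c * v) + b * y * u) + b * c * (y * v)
    ≡ (a * x + b * y) * (a * u + c * v)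
  lemma = solve-∀

coprime-factorˡ : ∀ {a} b c → Coprime a (b * c) → Coprime a b
coprime-factorˡ {a} b c (bezout x y p) = bezout x (c * y) (trans (cong (_+_ (a * x)) (sym (ℤ.*-assoc b c y))) p)

coprime-factorʳ : ∀ {a} b c → Coprime a (b * c) → Coprime a c
coprime-factorʳ {a} b c co = coprime-factorˡ c b (subst (Coprime a) (ℤ.*-comm b c) co)

coprime-≋ : ∀ {a b c} → ℤ/._≋_ a b c → Coprime a b → Coprime a c
coprime-≋ {a} {b} {c} (ℤ/.by d eq) (bezout x y p) =
  bezout (x + d * y) y (trans (lemma a c d x y) (trans (cong (λ b → a * x + b * y) (sym eq)) p))
  where
  lemma : ∀ a c d x y → a * (x + d * y) + c * y ≡ a * x + (c + a * d) * y
  lemma = solve-∀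

≋0⇒∣ : ∀ {m a} → ℤ/._≋_ m a 0ℤ → m ∣ a
≋0⇒∣ {m} (ℤ/.by c eq) = divides c (trans eq (trans (ℤ.+-identityˡ _) (ℤ.*-comm m c)))

∣⇒≋0 : ∀ {m a} → m ∣ a → ℤ/._≋_ m a 0ℤ
∣⇒≋0 {m} (divides c eq) = ℤ/.by c (trans eq (trans (ℤ.*-comm c m) (sym (ℤ.+-identityˡ _))))

≋⇒∣ : ∀ {m a b} → ℤ/._≋_ m a b → m ∣ a - b
≋⇒∣ {m} {a} {b} (ℤ/.by c eq) = divides c (trans (cong (_- b) eq) (lemma b m c))
  where
  lemma : ∀ b m c → b + m * c - b ≡ c * m
  lemma = solve-∀

∣⇒≋ : ∀ {m a b} → m ∣ a - b → ℤ/._≋_ m a b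
∣⇒≋ {m} {a} {b} (divides c eq) = ℤ/.by c (trans (lemma a b) (trans (cong (_+_ b) eq) (cong (_+_ b) (ℤ.*-comm c m))))
  where
  lemma : ∀ a b → a ≡ b + (a - b)
  lemma = solve-∀

coprime-∣ : ∀ {a b} → Coprime a b → ∀ c → a ∣ b * c → a ∣ c
coprime-∣ {a} {b} (bezout x y p) c (divides d eq) = divides (x * c + d * y)
  (trans (sym (ℤ.*-identityˡ c)) (trans (cong (_* c) (sym p)) (trans (lemma a b c x y)
    (trans (cong (λ e → a * x * c + e * y) eq) (lemma′ a c d x y)))))
  where
  lemma : ∀ a b c x y → (a * x + b * y) * c ≡ a * x * c + b * c * y
  lemma = solve-∀
  lemma′ : ∀ a c d x y → a * x * c + d * a * y ≡ (x * c + d * y) * a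
  lemma′ = solve-∀

prime-∣* : ∀ {q} → Prime q → ∀ a b → + q ∣ a * b → + q ∣ a ⊎ + q ∣ b
prime-∣* {q} q-prime a b q∣ab with euclidsLemma ℤ.∣ a ∣ ℤ.∣ b ∣ q-prime (subst (q ℕ∣.∣_) (ℤ.abs-* a b) (∣⇒∣ᵤ q∣ab))
... | inj₁ q∣a = inj₁ (∣ᵤ⇒∣ q∣a)
... | inj₂ q∣b = inj₂ (∣ᵤ⇒∣ q∣b)

coprime-∣∣ : ∀ {m} a → Coprime m (+ ℤ.∣ a ∣) → Coprime m a
coprime-∣∣ (+ n) co = co
coprime-∣∣ {m} -[1+ n ] (bezout x y p) = bezout x (- y) (trans (lemma m (+ suc n) x y) p)
  where
  lemma : ∀ m n x y → m * x + (- n) * (- y) ≡ m * x + n * y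
  lemma = solve-∀

ℕcoprime⇒coprime : ∀ {m n} → ℕCoprimality.Coprime m n → Coprime (+ m) (+ n)
ℕcoprime⇒coprime {m} {n} co with ℕCoprimality.coprime-Bézout co
... | ℕGCD.Bézout.+- x y eq = bezout (+ x) (- + y) (begin
  + m * + x + + n * (- + y)   ≡⟨ lemma (+ m) (+ x) (+ n) (+ y) ⟩
  + x * + m - + y * + n       ≡⟨ cong₂ _-_ (ℤ.pos-* x m) (ℤ.pos-* y n) ⟨
  + (x ℕ.* m) - + (y ℕ.* n)   ≡⟨ cong (λ e → + e - + (y ℕ.* n)) eq ⟨
  1ℤ + + (y ℕ.* n) - + (y ℕ.* n)  ≡⟨ lemma′ (+ (y ℕ.* n)) ⟩
  1ℤ                          ∎)
  where
  open ≡-Reasoning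
  lemma : ∀ m x n y → m * x + n * (- y) ≡ x * m - y * n
  lemma = solve-∀
  lemma′ : ∀ e → 1ℤ + e - e ≡ 1ℤ
  lemma′ = solve-∀
... | ℕGCD.Bézout.-+ x y eq = bezout (- + x) (+ y) (begin
  + m * (- + x) + + n * + y   ≡⟨ lemma (+ m) (+ x) (+ n) (+ y) ⟩
  + y * + n - + x * + m       ≡⟨ cong₂ _-_ (ℤ.pos-* y n) (ℤ.pos-* x m) ⟨
  + (y ℕ.* n) - + (x ℕ.* m)   ≡⟨ cong (λ e → + e - + (x ℕ.* m)) eq ⟨
  1ℤ + + (x ℕ.* m) - + (x ℕ.* m)  ≡⟨ lemma′ (+ (x ℕ.* m)) ⟩
  1ℤ                          ∎)
  where
  open ≡-Reasoning
  lemma : ∀ m x n y → m * (- x) + n * y ≡ y * n - x * m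
  lemma = solve-∀
  lemma′ : ∀ e → 1ℤ + e - e ≡ 1ℤ
  lemma′ = solve-∀

prime-∤⇒coprime : ∀ {q} → Prime q → ∀ a → ¬ + q ∣ a → Coprime (+ q) a
prime-∤⇒coprime {q} q-prime a q∤a = coprime-∣∣ a (ℕcoprime⇒coprime co)
  where
  co : ℕCoprimality.Coprime q ℤ.∣ a ∣
  co (d∣q , d∣a) with prime⇒irreducible q-prime d∣q
  ... | inj₁ d≡1 = d≡1
  ... | inj₂ refl = contradiction (∣ᵤ⇒∣ d∣a) q∤a

prime-∤1 : ∀ {q} → Prime q → ¬ + q ∣ 1ℤ
prime-∤1 q-prime q∣1 = ¬prime[1] (subst Prime (ℕ∣.∣1⇒≡1 (∣⇒∣ᵤ q∣1)) q-prime)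

coprime⇒∤ : ∀ {q} → Prime q → ∀ {a} → Coprime (+ q) a → ¬ + q ∣ a
coprime⇒∤ q-prime (bezout x y eq) q∣a =
  prime-∤1 q-prime (subst (_ ∣_) eq (∣m∣n⇒∣m+n (∣m⇒∣m*n x (divides 1ℤ (sym (ℤ.*-identityˡ _)))) (∣m⇒∣m*n y q∣a)))

prime[3] : Prime 3
prime[3] = toWitness {a? = prime? 3} _

prime-∣3 : ∀ {q} → Prime q → + q ∣ + 3 → q ≡ 3
prime-∣3 q-prime q∣3 with prime⇒irreducible prime[3] (∣⇒∣ᵤ q∣3)
... | inj₁ refl = contradiction q-prime ¬prime[1]
... | inj₂ q≡3  = q≡3

-- A cubic character modulo l

-- The fields from `unit` on witness that the character is nontrivial; the vanishing of its sum over
-- the residues rests on them.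
record CubicCharacter (l : ℕ) : Set where
  field
    χ    : ℤ → E
    χ-≋  : ∀ {a b} → ℤ/._≋_ (+ l) a b → χ a ≡ χ b
    χ-*  : ∀ a b → χ (a * b) ≡ χ a ⊗ χ b
    χ-0  : ∀ {a} → + l ∣ a → χ a ≡ 0E
    χ-μ₃ : ∀ {a} → ¬ + l ∣ a → μ₃ (χ a)
    unit : ℤ
    unit-∤ : ¬ + l ∣ unit
    χ-unit : χ unit ≢ 1E

-- Fermat's theorem and the Frobenius map on Eisenstein integers

module _ {q} (q-prime : Prime q) where
  open ModE (+ q)
  open Frobeniusᴱ q-prime

  private
    0^ : ∀ n → Prime n → 0E ^ᴱ n ≡ 0E
    0^ zero    0-prime = contradiction 0-prime ¬prime[0]
    0^ (suc n) _ = E+.zeroˡ (0E ^ᴱ n)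

    fermat-ℕ : ∀ n → ι (+ n) ^ᴱ q ≋ ι (+ n)
    fermat-ℕ zero    = ≋-reflexive (0^ q q-prime)
    fermat-ℕ (suc n) = begin
      (1E ⊕ ι (+ n)) ^ᴱ q       ≈⟨ ^q-⊕ 1E (ι (+ n)) ⟩
      1E ^ᴱ q ⊕ ι (+ n) ^ᴱ q    ≈⟨ ≋-+ (≋-reflexive (1^ q)) (fermat-ℕ n) ⟩
      ι (+ suc n)               ∎

  fermat : ∀ a → ι a ^ᴱ q ≋ ι a
  fermat (+ n)    = fermat-ℕ n
  -- Frobenius is applied to the sum of the negative number and its opposite, which is 0. The sign
  -- of (-1)^q does not enter, so q = 2 is no exception.
  fermat -[1+ n ] = begin
    x ^ᴱ q                          ≡⟨ p (x ^ᴱ q) y ⟩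
    x ^ᴱ q ⊕ y ⊖ y                  ≈⟨ ≋-+ʳ (≋-+ˡ (fermat-ℕ (suc n))) ⟨
    x ^ᴱ q ⊕ y ^ᴱ q ⊖ y             ≈⟨ ≋-+ʳ (^q-⊕ x y) ⟨
    (x ⊕ y) ^ᴱ q ⊖ y                ≡⟨ cong (λ z → z ^ᴱ q ⊖ y) (E+.-‿inverseˡ y) ⟩
    0E ^ᴱ q ⊖ y                     ≡⟨ cong (_⊖ y) (0^ q q-prime) ⟩
    x                               ∎
    where
    x = ι -[1+ n ]
    y = ι (+ suc n)
    p : ∀ x y → x ≡ x ⊕ y ⊖ y
    p = RingSolver.solve-∀ E-solver

  -- Frobenius fixes rational integers, so it acts on a + b w only through w^q: as the identity for
  -- q ≡ 1 and as conjugation for q ≡ 2 modulo 3.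
  ^q : ∀ a b → ⟨ a , b ⟩ ^ᴱ q ≋ ι a ⊕ w ^ᴱ q ⊗ ι b
  ^q a b = begin
    ⟨ a , b ⟩ ^ᴱ q                  ≡⟨ cong (_^ᴱ q) (⟨⟩-ι a b) ⟩
    (ι a ⊕ w ⊗ ι b) ^ᴱ q            ≈⟨ ^q-⊕ (ι a) (w ⊗ ι b) ⟩
    ι a ^ᴱ q ⊕ (w ⊗ ι b) ^ᴱ q       ≡⟨ cong (ι a ^ᴱ q ⊕_) (E^.^-distrib-* w (ι b) q) ⟩
    ι a ^ᴱ q ⊕ w ^ᴱ q ⊗ ι b ^ᴱ q    ≈⟨ ≋-+ (fermat a) (≋-*ˡ (fermat b)) ⟩
    ι a ⊕ w ^ᴱ q ⊗ ι b              ∎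

  ^q-split : ∀ {k} → q ≡ 1 ℕ.+ 3 ℕ.* k → ∀ x → x ^ᴱ q ≋ x
  ^q-split {k} refl ⟨ a , b ⟩ = begin
    ⟨ a , b ⟩ ^ᴱ q              ≈⟨ ^q a b ⟩
    ι a ⊕ w ^ᴱ q ⊗ ι b          ≡⟨ cong (λ x → ι a ⊕ x ⊗ ι b) (W-≋ {+ q} {+ 1} (ℤ/.by (+ k) (cong (_+_ 1ℤ) (ℤ.pos-* 3 k)))) ⟩
    ι a ⊕ w ⊗ ι b               ≡⟨ ⟨⟩-ι a b ⟨
    ⟨ a , b ⟩                   ∎

  ^q-inert : ∀ {k} → q ≡ 2 ℕ.+ 3 ℕ.* k → ∀ x → x ^ᴱ q ≋ conj x
  ^q-inert {k} refl ⟨ a , b ⟩ = begin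
    ⟨ a , b ⟩ ^ᴱ q              ≈⟨ ^q a b ⟩
    ι a ⊕ w ^ᴱ q ⊗ ι b          ≡⟨ cong (λ x → ι a ⊕ x ⊗ ι b) (W-≋ {+ q} {+ 2} (ℤ/.by (+ k) (cong (_+_ (+ 2)) (ℤ.pos-* 3 k)))) ⟩
    ι a ⊕ w ⊗ w ⊗ ι b           ≡⟨ conj-⟨⟩ a b ⟨
    conj ⟨ a , b ⟩              ∎

  μ₃-≋ : ∀ {x y} → μ₃ x → μ₃ y → x ≋ y → q ≢ 3 → x ≡ y
  μ₃-≋ {x} {y} μx μy x≋y q≢3 with μ₃-norm μx μy
  ... | inj₁ x≡y = x≡y
  ... | inj₂ norm≡3 = contradiction (prime-∣3 q-prime (≋0⇒∣ (ι-≋⁻¹ 3≋0))) q≢3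
    where
    3≋0 : ι (+ 3) ≋ ι 0ℤ
    3≋0 = begin
      ι (+ 3)                         ≡⟨ cong ι norm≡3 ⟨
      ι (norm (x ⊖ y))                ≡⟨ ⊗-conj (x ⊖ y) ⟨
      (x ⊖ y) ⊗ conj (x ⊖ y)          ≈⟨ ≋-*ʳ (≋-+ʳ x≋y) ⟩
      (y ⊖ y) ⊗ conj (x ⊖ y)          ≡⟨ p y (conj (x ⊖ y)) ⟩
      ι 0ℤ                            ∎
      where
      p : ∀ y z → (y ⊖ y) ⊗ z ≡ 0E
      p = RingSolver.solve-∀ E-solver

data Mod3 (n : ℕ) : Set where
  3k   : ∀ k → n ≡ 3 ℕ.* k → Mod3 n
  3k+1 : ∀ k → n ≡ 1 ℕ.+ 3 ℕ.* k → Mod3 n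
  3k+2 : ∀ k → n ≡ 2 ℕ.+ 3 ℕ.* k → Mod3 n

mod3 : ∀ n → Mod3 n
mod3 zero = 3k 0 refl
mod3 (suc n) with mod3 n
... | 3k k refl   = 3k+1 k refl
... | 3k+1 k refl = 3k+2 k refl
... | 3k+2 k refl = 3k (suc k) (sym (ℕ.*-suc 3 k))

prime-3k : ∀ {q} k → Prime q → q ≡ 3 ℕ.* k → q ≡ 3
prime-3k k q-prime refl with prime⇒irreducible q-prime (ℕ∣.m∣m*n k)
... | inj₂ 3≡q = sym 3≡q

-- Finite differences

Δ : (ℤ → ℤ) → ℤ → ℤ
Δ f x = f (x + 1ℤ) - f x

Difference : ℕ → ℤ → (ℤ → ℤ) → Set
Difference zero    c f = ∀ x → f x ≡ c
Difference (suc n) c f = Difference n c (Δ f)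

Difference-cong : ∀ n {c d f g} → c ≡ d → (∀ x → f x ≡ g x) → Difference n c f → Difference n d g
Difference-cong zero    c≡d f≡g D x = trans (sym (f≡g x)) (trans (D x) c≡d)
Difference-cong (suc n) c≡d f≡g D = Difference-cong n c≡d (λ x → cong₂ _-_ (f≡g (x + 1ℤ)) (f≡g x)) D

Difference-+ : ∀ n {c d f g} → Difference n c f → Difference n d g → Difference n (c + d) (λ x → f x + g x)
Difference-+ zero    D D′ x = cong₂ _+_ (D x) (D′ x)
Difference-+ (suc n) {f = f} {g} D D′ = Difference-cong n refl
  (λ x → p (f (x + 1ℤ)) (f x) (g (x + 1ℤ)) (g x)) (Difference-+ n D D′)
  where
  p : ∀ a b c d → a - b + (c - d) ≡ a + c - (b + d)
  p = solve-∀

Difference-shift : ∀ n {c f} → Difference n c f → Difference n c (λ x → f (x + 1ℤ))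
Difference-shift zero    D x = D (x + 1ℤ)
Difference-shift (suc n) D = Difference-shift n D

-- The Leibniz rule Δ(x g) = x Δg + g(x + 1): each further difference contributes one more copy of
-- the constant c.
Difference-x* : ∀ n {c g} → Difference n c g → Difference (suc n) (+ suc n * c) (λ x → x * g x)
Difference-x* zero {c} {g} D x = trans (cong₂ (λ u v → (x + 1ℤ) * u - x * v) (D (x + 1ℤ)) (D x)) (p x c)
  where
  p : ∀ x c → (x + 1ℤ) * c - x * c ≡ 1ℤ * c
  p = solve-∀
Difference-x* (suc n) {c} {g} D = Difference-cong (suc n) (q (+ suc n) c)
  (λ x → p x (g (x + 1ℤ)) (g x))
  (Difference-+ (suc n) {f = λ x → x * Δ g x} {g = λ x → g (x + 1ℤ)}
    (Difference-x* n {g = Δ g} D) (Difference-shift (suc n) {f = g} D))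
  where
  q : ∀ n c → n * c + c ≡ (1ℤ + n) * c
  q = solve-∀
  p : ∀ x a b → x * (a - b) + a ≡ (x + 1ℤ) * a - x * b
  p = solve-∀

Difference-^ : ∀ n → Difference n (+ (n !)) (ℤ._^ n)
Difference-^ zero    x = refl
Difference-^ (suc n) = Difference-cong (suc n) {f = λ x → x * x ℤ.^ n} (sym (ℤ.pos-* (suc n) (n !))) (λ x → refl)
  (Difference-x* n {g = ℤ._^ n} (Difference-^ n))

-- The n-th difference at 1 is an integral combination of f(1), ..., f(n + 1). Together with
-- `Difference-^` this serves as a bound on the number of consecutive roots modulo a prime.
Difference-vanish : ∀ {m} n {c f} → Difference n c f →
  (∀ i → i ℕ.≤ n → ℤ/._≋_ m (f (+ suc i)) 0ℤ) → ℤ/._≋_ m c 0ℤ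
Difference-vanish {m} zero    D f≋0 = subst (λ c → ℤ/._≋_ m c 0ℤ) (D (+ 1)) (f≋0 0 ℕ.z≤n)
Difference-vanish {m} (suc n) {f = f} D f≋0 = Difference-vanish n D λ i i≤n →
  ∣⇒≋0 (∣m∣n⇒∣m-n (≋0⇒∣ (subst (λ j → ℤ/._≋_ m (f j) 0ℤ) (cong +_ (ℕ.+-comm 1 (suc i))) (f≋0 (suc i) (ℕ.s≤s i≤n))))
    (≋0⇒∣ (f≋0 i (ℕ.m≤n⇒m≤1+n i≤n))))

-- The cubic residue character modulo a prime l ≡ 1 (mod 3)

-- Reduction modulo a prime above l sends w to r.
module Character {l k : ℕ} (l-prime : Prime l) (l≡ : l ≡ 1 ℕ.+ 3 ℕ.* k)
  (r : ℤ) (l∣r²+r+1 : + l ∣ r * r + r + 1ℤ) where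

  private
    module L = ℤ/ (+ l)
    open L using (_≋_; by)
    module LR = CommutativeRing L.ring
    open SetoidReasoning L.setoid

  φ : E → ℤ
  φ ⟨ a , b ⟩ = a + b * r

  φ-⊗ : ∀ x y → φ (x ⊗ y) ≋ φ x * φ y
  φ-⊗ ⟨ a , b ⟩ ⟨ c , d ⟩ = ∣⇒≋ (subst (+ l ∣_) (sym (p a b c d r)) (∣n⇒∣m*n (- (b * d)) l∣r²+r+1))
    where
    p : ∀ a b c d r → a * c - b * d + (a * d + b * c - b * d) * r - (a + b * r) * (c + d * r)
      ≡ - (b * d) * (r * r + r + 1ℤ)
    p = solve-∀

  φ-⊖ : ∀ x y → φ (x ⊖ y) ≡ φ x - φ y
  φ-⊖ ⟨ a , b ⟩ ⟨ c , d ⟩ = p a b c d r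
    where
    p : ∀ a b c d r → a + (- c) + (b + (- d)) * r ≡ a + b * r - (c + d * r)
    p = solve-∀

  φ-ι : ∀ a → φ (ι a) ≡ a
  φ-ι a = ℤ.+-identityʳ a

  l≢3 : l ≢ 3
  l≢3 l≡3 with trans (sym l≡3) l≡
  ... | eq = 3≢ k eq
    where
    3≢ : ∀ k → 3 ≢ 1 ℕ.+ 3 ℕ.* k
    3≢ zero ()
    3≢ (suc k) eq with trans eq (cong suc (ℕ.*-suc 3 k))
    ... | ()

  φ-injective : ∀ {x y} → μ₃ x → μ₃ y → φ x ≋ φ y → x ≡ y
  φ-injective {x} {y} μx μy φx≋φy with μ₃-norm μx μy
  ... | inj₁ x≡y = x≡y
  ... | inj₂ norm≡3 = contradiction (prime-∣3 l-prime (≋0⇒∣ 3≋0)) l≢3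
    where
    z = x ⊖ y
    3≋0 : + 3 ≋ 0ℤ
    3≋0 = begin
      + 3                        ≡⟨ norm≡3 ⟨
      norm z                     ≡⟨ φ-ι (norm z) ⟨
      φ (ι (norm z))             ≡⟨ cong φ (⊗-conj z) ⟨
      φ (z ⊗ conj z)             ≈⟨ φ-⊗ z (conj z) ⟩
      φ z * φ (conj z)           ≡⟨ cong (_* φ (conj z)) (φ-⊖ x y) ⟩
      (φ x - φ y) * φ (conj z)   ≈⟨ LR.*-congʳ (LR.+-congʳ φx≋φy) ⟩
      (φ y - φ y) * φ (conj z)   ≡⟨ cong (_* φ (conj z)) (ℤ.+-inverseʳ (φ y)) ⟩
      0ℤ                         ∎

  fermat-ℤ : ∀ t → t ℤ.^ l ≋ t
  fermat-ℤ t = ModE.ι-≋⁻¹ (+ l) (E/.≋-trans (+ l) (E/.≋-reflexive (+ l) (ι-^ t l)) (fermat l-prime t))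

  cube-factor : ∀ t → t ℤ.^ l - t ≡ t * ((t ℤ.^ k) * (t ℤ.^ k) * (t ℤ.^ k) - 1ℤ)
  cube-factor t = trans (cong (_- t) cube) (p t (t ℤ.^ k))
    where
    p : ∀ t u → t * (u * u * u) - t ≡ t * (u * u * u - 1ℤ)
    p = solve-∀
    q : ∀ u → u * (u * (u * 1ℤ)) ≡ u * u * u
    q = solve-∀
    cube : t ℤ.^ l ≡ t * (t ℤ.^ k * t ℤ.^ k * t ℤ.^ k)
    cube = trans (cong (t ℤ.^_) (trans l≡ (cong suc (ℕ.*-comm 3 k))))
      (cong (t *_) (trans (sym (ℤ.^-*-assoc t k 3)) (q (t ℤ.^ k))))

  -- Since r² + r + 1 ≡ 0, u³ - 1 factors modulo l as (u - 1)(u - r)(u + 1 + r), and the three roots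
  -- are the images of 1, w and w² under `φ`.
  cube-root : ∀ u → + l ∣ u * u * u - 1ℤ → ∃[ x ] (μ₃ x × φ x ≋ u)
  cube-root u l∣u³-1 = case prime-∣* l-prime (u - 1ℤ) ((u - r) * (u + 1ℤ + r)) l∣factors of λ
    { (inj₁ l∣u-1) → 1E , one , L.≋-sym (∣⇒≋ l∣u-1)
    ; (inj₂ l∣)    → case prime-∣* l-prime (u - r) (u + 1ℤ + r) l∣ of λ
      { (inj₁ l∣u-r)   → w , ω , L.≋-sym (∣⇒≋ (subst (+ l ∣_) (root₁ u r) l∣u-r))
      ; (inj₂ l∣u+1+r) → w ⊗ w , ω² , L.≋-sym (∣⇒≋ (subst (+ l ∣_) (root₂ u r) l∣u+1+r)) } }
    where
    factors : ∀ u r → u * u * u - 1ℤ - (u - 1ℤ) * (r * r + r + 1ℤ) ≡ (u - 1ℤ) * ((u - r) * (u + 1ℤ + r))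
    factors = solve-∀
    l∣factors : + l ∣ (u - 1ℤ) * ((u - r) * (u + 1ℤ + r))
    l∣factors = subst (+ l ∣_) (factors u r) (∣m∣n⇒∣m-n l∣u³-1 (∣n⇒∣m*n (u - 1ℤ) l∣r²+r+1))
    root₁ : ∀ u r → u - r ≡ u - (0ℤ + 1ℤ * r)
    root₁ = solve-∀
    root₂ : ∀ u r → u + 1ℤ + r ≡ u - (-1ℤ + -1ℤ * r)
    root₂ = solve-∀

  ^k-μ₃ : ∀ t → ¬ + l ∣ t → ∃[ x ] (μ₃ x × φ x ≋ t ℤ.^ k)
  ^k-μ₃ t l∤t = case prime-∣* l-prime t _ (subst (+ l ∣_) (cube-factor t) (≋⇒∣ (fermat-ℤ t))) of λ where
    (inj₁ l∣t)    → contradiction l∣t l∤t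
    (inj₂ l∣u³-1) → cube-root (t ℤ.^ k) l∣u³-1

  -- Euler's criterion taken as the definition of the cubic residue character: at t prime to l, the
  -- cube root of unity above t^k with k = (l - 1)/3.
  χ : ℤ → E
  χ t with + l ∣? t
  ... | yes _  = 0E
  ... | no l∤t = proj₁ (^k-μ₃ t l∤t)

  χ-∣ : ∀ {t} → + l ∣ t → χ t ≡ 0E
  χ-∣ {t} l∣t with + l ∣? t
  ... | yes _  = refl
  ... | no l∤t = contradiction l∣t l∤t

  χ-∤ : ∀ {t} → ¬ + l ∣ t → μ₃ (χ t) × φ (χ t) ≋ t ℤ.^ k
  χ-∤ {t} l∤t with + l ∣? t
  ... | yes l∣t = contradiction l∣t l∤t
  ... | no l∤t  = proj₂ (^k-μ₃ t l∤t)

  ^-≋ℤ : ∀ {a b} n → a ≋ b → a ℤ.^ n ≋ b ℤ.^ n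
  ^-≋ℤ zero    a≋b = L.≋-refl
  ^-≋ℤ (suc n) a≋b = L.≋-* a≋b (^-≋ℤ n a≋b)

  χ-cong : ∀ {a b} → a ≋ b → χ a ≡ χ b
  χ-cong {a} {b} a≋b with + l ∣? b
  ... | yes l∣b = χ-∣ (≋0⇒∣ (L.≋-trans a≋b (∣⇒≋0 l∣b)))
  ... | no l∤b  = φ-injective (proj₁ (χ-∤ l∤a)) (proj₁ (proj₂ (^k-μ₃ b l∤b)))
    (L.≋-trans (proj₂ (χ-∤ l∤a)) (L.≋-trans (^-≋ℤ k a≋b) (L.≋-sym (proj₂ (proj₂ (^k-μ₃ b l∤b))))))
    where l∤a = λ l∣a → l∤b (≋0⇒∣ (L.≋-trans (L.≋-sym a≋b) (∣⇒≋0 l∣a)))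

  χ-* : ∀ a b → χ (a * b) ≡ χ a ⊗ χ b
  χ-* a b = go (+ l ∣? a) (+ l ∣? b)
    where
    ^-distrib : ∀ n → (a * b) ℤ.^ n ≡ a ℤ.^ n * b ℤ.^ n
    ^-distrib zero    = refl
    ^-distrib (suc n) = trans (cong (_*_ (a * b)) (^-distrib n)) (p a b (a ℤ.^ n) (b ℤ.^ n))
      where
      p : ∀ a b c d → a * b * (c * d) ≡ a * c * (b * d)
      p = solve-∀
    units : ¬ + l ∣ a → ¬ + l ∣ b → χ (a * b) ≡ χ a ⊗ χ b
    units l∤a l∤b = φ-injective (proj₁ (χ-∤ l∤ab)) (μ₃-⊗ (proj₁ (χ-∤ l∤a)) (proj₁ (χ-∤ l∤b))) (begin
      φ (χ (a * b))        ≈⟨ proj₂ (χ-∤ l∤ab) ⟩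
      (a * b) ℤ.^ k        ≡⟨ ^-distrib k ⟩
      a ℤ.^ k * b ℤ.^ k    ≈⟨ L.≋-* (proj₂ (χ-∤ l∤a)) (proj₂ (χ-∤ l∤b)) ⟨
      φ (χ a) * φ (χ b)    ≈⟨ φ-⊗ (χ a) (χ b) ⟨
      φ (χ a ⊗ χ b)        ∎)
      where
      l∤ab : ¬ + l ∣ a * b
      l∤ab l∣ab = case prime-∣* l-prime a b l∣ab of λ
        { (inj₁ l∣a) → l∤a l∣a
        ; (inj₂ l∣b) → l∤b l∣b }
    go : Dec (+ l ∣ a) → Dec (+ l ∣ b) → χ (a * b) ≡ χ a ⊗ χ b
    go (yes l∣a) _ = trans (χ-∣ (∣m⇒∣m*n b l∣a)) (sym (trans (cong (_⊗ χ b) (χ-∣ l∣a)) (E+.zeroˡ (χ b))))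
    go (no _) (yes l∣b) = trans (χ-∣ (∣n⇒∣m*n a l∣b)) (sym (trans (cong (χ a ⊗_) (χ-∣ l∣b)) (E+.zeroʳ (χ a))))
    go (no l∤a) (no l∤b) = units l∤a l∤b

  private
    k≢0 : k ≢ 0
    k≢0 refl = ¬prime[1] (subst Prime l≡ l-prime)

    small-∤ : ∀ i → i ℕ.< 3 ℕ.* k → ¬ + l ∣ + suc i
    small-∤ i i<3k l∣ = ℕ.<⇒≱ (subst (suc i ℕ.<_) (sym l≡) (ℕ.s≤s i<3k)) (ℕ∣.∣⇒≤ (∣⇒∣ᵤ l∣))

    k<3k : k ℕ.< 3 ℕ.* k
    k<3k = subst (k ℕ.<_) (ℕ.*-comm k 3) (ℕ.m<m*n k 3 {{ℕ.≢-nonZero k≢0}} (ℕ.s≤s (ℕ.s≤s ℕ.z≤n)))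

  -- If t^k ≡ 1 for every t from 1 to l - 1, then x^k is constant modulo l at 1, ..., k + 1. Its
  -- k-th difference k! would then be divisible by l, although k < l.
  ^k-nontrivial : ¬ (∀ (i : Fin (3 ℕ.* k)) → + l ∣ (+ suc (toℕ i)) ℤ.^ k - 1ℤ)
  ^k-nontrivial all = ℕ.<⇒≱ k<l (prime∣!⇒≤ l-prime k (∣⇒∣ᵤ (≋0⇒∣ k!≋0)))
    where
    k<l : k ℕ.< l
    k<l = subst (k ℕ.<_) (sym l≡) (ℕ.m≤n⇒m≤1+n k<3k)
    k≡ : k ≡ suc (ℕ.pred k)
    k≡ = sym (ℕ.suc-pred k {{ℕ.≢-nonZero k≢0}})
    pow : ∀ i → i ℕ.≤ k → + l ∣ (+ suc i) ℤ.^ k - 1ℤ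
    pow i i≤k = subst (λ j → + l ∣ (+ suc j) ℤ.^ k - 1ℤ) (Fin.toℕ-fromℕ< bound) (all (Fin.fromℕ< bound))
      where bound = ℕ.≤-<-trans i≤k k<3k
    difference : ∀ i → i ℕ.≤ ℕ.pred k → ℤ/._≋_ (+ l) (Δ (ℤ._^ k) (+ suc i)) 0ℤ
    difference i i≤k-1 = ∣⇒≋0 (subst (+ l ∣_) (p ((+ suc i + 1ℤ) ℤ.^ k) ((+ suc i) ℤ.^ k))
      (∣m∣n⇒∣m-n (subst (λ j → + l ∣ j ℤ.^ k - 1ℤ) (cong +_ (ℕ.+-comm 1 (suc i))) (pow (suc i) i<k))
        (pow i (ℕ.<⇒≤ i<k))))
      where
      i<k : i ℕ.< k
      i<k = subst (suc i ℕ.≤_) (sym k≡) (ℕ.s≤s i≤k-1)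
      p : ∀ a b → a - 1ℤ - (b - 1ℤ) ≡ a - b
      p = solve-∀
    k!≋0 : ℤ/._≋_ (+ l) (+ (k !)) 0ℤ
    k!≋0 = Difference-vanish (ℕ.pred k) {f = Δ (ℤ._^ k)}
      (subst (λ n → Difference n (+ (k !)) (ℤ._^ k)) k≡ (Difference-^ k)) difference

  cubicCharacter : CubicCharacter l
  cubicCharacter = record
    { χ = χ ; χ-≋ = χ-cong ; χ-* = χ-* ; χ-0 = χ-∣ ; χ-μ₃ = proj₁ ∘ χ-∤
    ; unit = + suc (toℕ i)
    ; unit-∤ = u∤
    ; χ-unit = λ χu≡1 → proj₂ witness (≋⇒∣ (L.≋-trans (L.≋-sym (proj₂ (χ-∤ u∤)))
        (L.≋-reflexive (cong φ χu≡1)))) }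
    where
    witness = Fin.¬∀⟶∃¬ (3 ℕ.* k) _ (λ i → + l ∣? ((+ suc (toℕ i)) ℤ.^ k - 1ℤ)) ^k-nontrivial
    i = proj₁ witness
    u∤ = small-∤ (toℕ i) (Fin.toℕ<n i)

-- Sums over residues and Jacobi sums

ι-cancel : ∀ {n x} → n ≢ 0ℤ → ι n ⊗ x ≡ 0E → x ≡ 0E
ι-cancel {n} {⟨ a , b ⟩} n≢0 eq = cong₂ ⟨_,_⟩
  (cancel a (trans (sym (p n a b)) (cong re eq))) (cancel b (trans (sym (q n a b)) (cong im eq)))
  where
  p : ∀ n a b → n * a - 0ℤ * b ≡ n * a
  p = solve-∀
  q : ∀ n a b → n * b + 0ℤ * a - 0ℤ * b ≡ n * b
  q = solve-∀
  cancel : ∀ c → n * c ≡ 0ℤ → c ≡ 0ℤ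
  cancel c nc≡0 = case ℤ.i*j≡0⇒i≡0∨j≡0 n nc≡0 of λ
    { (inj₁ n≡0) → contradiction n≡0 n≢0
    ; (inj₂ c≡0) → c≡0 }

-- Opaque, so that the summand can be inferred from a sum.
opaque
  ∑ : ℕ → (ℤ → E) → E
  ∑ l f = sumᴱ {l} λ i → f (+ toℕ i)

  ∑-def : ∀ l f → ∑ l f ≡ sumᴱ {l} λ i → f (+ toℕ i)
  ∑-def l f = refl

  ∑-cong : ∀ l {f g} → (∀ i → f i ≡ g i) → ∑ l f ≡ ∑ l g
  ∑-cong l f≡g = EΣ.sum-cong-≗ {l} λ i → f≡g (+ toℕ i)

  ∑-⊗ : ∀ l c f → ∑ l (λ i → c ⊗ f i) ≡ c ⊗ ∑ l f
  ∑-⊗ l c f = sym (EΣ.*-distribˡ-sum {l} c λ i → f (+ toℕ i))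

  ∑-⊕ : ∀ l f g → ∑ l (λ i → f i ⊕ g i) ≡ ∑ l f ⊕ ∑ l g
  ∑-⊕ l f g = EΣ.∑-distrib-+ {l} (λ i → f (+ toℕ i)) (λ i → g (+ toℕ i))

  ∑-swap : ∀ l m (f : ℤ → ℤ → E) → ∑ l (λ i → ∑ m (f i)) ≡ ∑ m (λ j → ∑ l (λ i → f i j))
  ∑-swap l m f = EΣ.∑-comm {l} {m} λ i j → f (+ toℕ i) (+ toℕ j)

  ∑-const : ∀ l x → ∑ l (λ _ → x) ≡ ι (+ l) ⊗ x
  ∑-const l x = go l
    where
    p : ∀ x n → x ⊕ n ⊗ x ≡ (1E ⊕ n) ⊗ x
    p = RingSolver.solve-∀ E-solver
    go : ∀ n → sumᴱ {n} (λ _ → x) ≡ ι (+ n) ⊗ x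
    go zero    = sym (E+.zeroˡ x)
    go (suc n) = trans (cong (x ⊕_) (go n)) (p x (ι (+ n)))

  conj-∑ : ∀ l f → conj (∑ l f) ≡ ∑ l (conj ∘ f)
  conj-∑ l f = go {l} λ i → f (+ toℕ i)
    where
    go : ∀ {n} (f : Fin n → E) → conj (sumᴱ f) ≡ sumᴱ (conj ∘ f)
    go {zero}  f = refl
    go {suc n} f = trans (conj-⊕ (f Fin.zero) _) (cong (conj (f Fin.zero) ⊕_) (go (f ∘ Fin.suc)))

Γ : (l : ℕ) → (ℤ → E) → (ℤ → E) → ℤ → E
Γ l χ f z = ∑ l λ i → χ i ⊗ f (z - i)

Γ-cong : ∀ l χ {f g} → (∀ z → f z ≡ g z) → ∀ z → Γ l χ f z ≡ Γ l χ g z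
Γ-cong l χ f≡g z = ∑-cong l λ i → cong (χ i ⊗_) (f≡g (z - i))

Γ-scale : ∀ l χ c f z → Γ l χ (λ y → c ⊗ f y) z ≡ c ⊗ Γ l χ f z
Γ-scale l χ c f z = trans (∑-cong l λ i → p (χ i) c (f (z - i))) (∑-⊗ l c _)
  where
  p : ∀ x c y → x ⊗ (c ⊗ y) ≡ c ⊗ (x ⊗ y)
  p = RingSolver.solve-∀ E-solver

Γ-comm : ∀ l χ ψ f z → Γ l χ (Γ l ψ f) z ≡ Γ l ψ (Γ l χ f) z
Γ-comm l χ ψ f z = begin
  Γ l χ (Γ l ψ f) z                                        ≡⟨ ∑-cong l (λ i → ∑-⊗ l (χ i) _) ⟨
  ∑ l (λ i → ∑ l λ j → χ i ⊗ (ψ j ⊗ f (z - i - j)))        ≡⟨ ∑-swap l l _ ⟩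
  ∑ l (λ j → ∑ l λ i → χ i ⊗ (ψ j ⊗ f (z - i - j)))        ≡⟨ ∑-cong l (λ j → ∑-cong l λ i → swap (χ i) (ψ j) i j) ⟩
  ∑ l (λ j → ∑ l λ i → ψ j ⊗ (χ i ⊗ f (z - j - i)))        ≡⟨ ∑-cong l (λ j → ∑-⊗ l (ψ j) _) ⟩
  Γ l ψ (Γ l χ f) z                                        ∎
  where
  open ≡-Reasoning
  p : ∀ x y c → x ⊗ (y ⊗ c) ≡ y ⊗ (x ⊗ c)
  p = RingSolver.solve-∀ E-solver
  shifts : ∀ z s t → z - s - t ≡ z - t - s
  shifts = solve-∀
  swap : ∀ x y s t → x ⊗ (y ⊗ f (z - s - t)) ≡ y ⊗ (x ⊗ f (z - t - s))
  swap x y s t = trans (p x y _) (cong (λ u → y ⊗ (x ⊗ f u)) (shifts z s t))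

module Residues (l : ℕ) .{{_ : ℕ.NonZero l}} where
  private module L = ℤ/ (+ l)
  open L using (_≋_)

  Periodic : (ℤ → E) → Set
  Periodic f = ∀ {a b} → a ≋ b → f a ≡ f b

  residue : ℤ → Fin l
  residue a = Fin.fromℕ< (ℤDivMod.n%ℕd<d a l)

  residue-≋ : ∀ a → + toℕ (residue a) ≋ a
  residue-≋ a = subst (λ r → + r ≋ a) (sym (Fin.toℕ-fromℕ< (ℤDivMod.n%ℕd<d a l)))
    (L.≋-sym (L.by (a ℤDivMod./ℕ l) (trans (ℤDivMod.a≡a%ℕn+[a/ℕn]*n a l) (cong (_+_ (+ (a ℤDivMod.%ℕ l))) (ℤ.*-comm (a ℤDivMod./ℕ l) (+ l))))))

  toℕ-injective-≋ : ∀ (i j : Fin l) → + toℕ i ≋ + toℕ j → i ≡ j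
  toℕ-injective-≋ i j i≋j = Fin.toℕ-injective (case ℕ.≤-total (toℕ i) (toℕ j) of λ
    { (inj₁ i≤j) → sym (below j i i≤j (L.≋-sym i≋j))
    ; (inj₂ j≤i) → below i j j≤i i≋j })
    where
    below : ∀ (i j : Fin l) → toℕ j ℕ.≤ toℕ i → + toℕ i ≋ + toℕ j → toℕ i ≡ toℕ j
    below i j j≤i i≋j = ℕ.≤-antisym (ℕ.m∸n≡0⇒m≤n (zero-multiple (ℕ.≤-<-trans (ℕ.m∸n≤m (toℕ i) (toℕ j)) (Fin.toℕ<n i)) l∣i-j)) j≤i
      where
      l∣i-j : l ℕ∣.∣ toℕ i ℕ.∸ toℕ j
      l∣i-j = ∣⇒∣ᵤ (subst (+ l ∣_) (trans (ℤ.m-n≡m⊖n (toℕ i) (toℕ j)) (ℤ.⊖-≥ j≤i)) (≋⇒∣ i≋j))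
      zero-multiple : ∀ {m} → m ℕ.< l → l ℕ∣.∣ m → m ≡ 0
      zero-multiple {zero}  _ _ = refl
      zero-multiple {suc m} m<l l∣m = contradiction m<l (ℕ.≤⇒≯ (ℕ∣.∣⇒≤ l∣m))

  -- The map g has to permute only the residue classes, with inverse h; composing with `residue`
  -- makes it a permutation of the summation range, and periodicity of f absorbs the change of
  -- representative.
  reindex : ∀ {f} → Periodic f → (g h : ℤ → ℤ) →
    (∀ {a b} → a ≋ b → g a ≋ g b) → (∀ {a b} → a ≋ b → h a ≋ h b) →
    (∀ a → g (h a) ≋ a) → (∀ a → h (g a) ≋ a) → ∑ l (f ∘ g) ≡ ∑ l f
  reindex {f} f-≋ g h g-≋ h-≋ gh hg = begin
    ∑ l (f ∘ g)                                ≡⟨ ∑-def l (f ∘ g) ⟩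
    sumᴱ {l} (λ i → f (g (+ toℕ i)))           ≡⟨ EΣ.sum-cong-≗ {l} (λ i → f-≋ (residue-≋ (g (+ toℕ i)))) ⟨
    sumᴱ {l} (λ i → f (+ toℕ (residue (g (+ toℕ i)))))  ≡⟨ EΣ.sum-permute {l} {l} (λ i → f (+ toℕ i)) π ⟨
    sumᴱ {l} (λ i → f (+ toℕ i))               ≡⟨ ∑-def l f ⟨
    ∑ l f                                      ∎
    where
    open ≡-Reasoning
    inverse : ∀ (g h : ℤ → ℤ) → (∀ {a b} → a ≋ b → g a ≋ g b) → (∀ a → g (h a) ≋ a) →
      ∀ i → residue (g (+ toℕ (residue (h (+ toℕ i))))) ≡ i
    inverse g h g-≋ gh i = toℕ-injective-≋ _ i (L.≋-trans (residue-≋ _)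
      (L.≋-trans (g-≋ (residue-≋ _)) (gh (+ toℕ i))))
    π = Permutation.permutation (λ i → residue (g (+ toℕ i))) (λ i → residue (h (+ toℕ i)))
      (inverse g h g-≋ gh) (inverse h g h-≋ hg)

  ∑-translate : ∀ {f} → Periodic f → ∀ c → ∑ l (λ i → f (c - i)) ≡ ∑ l f
  ∑-translate f-≋ c = reindex f-≋ (_-_ c) (_-_ c) reflect reflect (λ a → L.≋-reflexive (p c a)) (λ a → L.≋-reflexive (p c a))
    where
    module LR = CommutativeRing L.ring
    reflect : ∀ {a b} → a ≋ b → c - a ≋ c - b
    reflect a≋b = LR.+-congˡ {c} (LR.-‿cong a≋b)
    p : ∀ c a → c - (c - a) ≡ a
    p = solve-∀

  ∑-scale : ∀ {f} → Periodic f → ∀ {u} → Coprime (+ l) u → ∑ l (λ i → f (u * i)) ≡ ∑ l f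
  ∑-scale f-≋ {u} (bezout y v eq) = reindex f-≋ (u *_) (v *_) (L.≋-*ˡ {u}) (L.≋-*ˡ {v}) uv (λ a → L.≋-trans (L.≋-reflexive (p v u a)) (uv a))
    where
    p : ∀ u v a → u * (v * a) ≡ v * (u * a)
    p = solve-∀
    q : ∀ l u v y a → u * (v * a) ≡ (l * y + u * v) * a + l * (- (y * a))
    q = solve-∀
    uv : ∀ a → u * (v * a) ≋ a
    uv a = L.by (- (y * a)) (trans (q (+ l) u v y a) (cong (_+ + l * (- (y * a))) (trans (cong (_* a) eq) (ℤ.*-identityˡ a))))

  δ : ℤ → E
  δ a with + l ∣? a
  ... | yes _ = 1E
  ... | no _  = 0E

  δ-∣ : ∀ {a} → + l ∣ a → δ a ≡ 1E
  δ-∣ {a} l∣a with + l ∣? a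
  ... | yes _ = refl
  ... | no l∤a = contradiction l∣a l∤a

  δ-∤ : ∀ {a} → ¬ + l ∣ a → δ a ≡ 0E
  δ-∤ {a} l∤a with + l ∣? a
  ... | yes l∣a = contradiction l∣a l∤a
  ... | no _ = refl

  δ-≋ : Periodic δ
  δ-≋ {a} {b} a≋b with + l ∣? b
  ... | yes l∣b = δ-∣ (≋0⇒∣ (L.≋-trans a≋b (∣⇒≋0 l∣b)))
  ... | no l∤b  = δ-∤ λ l∣a → l∤b (≋0⇒∣ (L.≋-trans (L.≋-sym a≋b) (∣⇒≋0 l∣a)))

  ∑δ≡1 : ∑ l δ ≡ 1E
  ∑δ≡1 = trans (∑-def l δ) (go l λ i i<l → δ-∤ λ l∣ → ℕ.<⇒≱ i<l (ℕ∣.∣⇒≤ (∣⇒∣ᵤ l∣)))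
    where
    go : ∀ n .{{_ : ℕ.NonZero n}} → (∀ i → suc i ℕ.< n → δ (+ suc i) ≡ 0E) → sumᴱ {n} (λ i → δ (+ toℕ i)) ≡ 1E
    go (suc n) δ≡0 = begin
      δ 0ℤ ⊕ sumᴱ {n} (λ i → δ (+ suc (toℕ i)))
        ≡⟨ cong₂ _⊕_ (δ-∣ {0ℤ} (divides 0ℤ refl)) (EΣ.sum-cong-≗ {n} λ i → δ≡0 (toℕ i) (ℕ.s≤s (Fin.toℕ<n i))) ⟩
      1E ⊕ sumᴱ {n} (λ i → 0E)                   ≡⟨ cong (1E ⊕_) (EΣ.sum-replicate-zero n) ⟩
      1E ∎
      where open ≡-Reasoning

  Γ-δ : ∀ {f} → Periodic f → ∀ z → Γ l f δ z ≡ f z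
  Γ-δ {f} f-≋ z = begin
    ∑ l (λ i → f i ⊗ δ (z - i))   ≡⟨ ∑-cong l concentrated ⟩
    ∑ l (λ i → f z ⊗ δ (z - i))   ≡⟨ ∑-⊗ l (f z) _ ⟩
    f z ⊗ ∑ l (λ i → δ (z - i))  ≡⟨ cong (f z ⊗_) (trans (∑-translate δ-≋ z) ∑δ≡1) ⟩
    f z ⊗ 1E                                    ≡⟨ E+.*-identityʳ (f z) ⟩
    f z                                         ∎
    where
    open ≡-Reasoning
    concentrated : ∀ i → f i ⊗ δ (z - i) ≡ f z ⊗ δ (z - i)
    concentrated i = go (+ l ∣? (z - i))
      where
      go : Dec (+ l ∣ z - i) → f i ⊗ δ (z - i) ≡ f z ⊗ δ (z - i)
      go (yes l∣z-i) = cong (_⊗ δ (z - i)) (f-≋ (L.≋-sym (∣⇒≋ l∣z-i)))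
      go (no l∤z-i) = trans (cong (f i ⊗_) (δ-∤ l∤z-i)) (trans (E+.zeroʳ (f i))
        (sym (trans (cong (f z ⊗_) (δ-∤ l∤z-i)) (E+.zeroʳ (f z)))))


-- Gauss and Jacobi sums

-- The group-ring element G = Σ χ(t) · translation by t plays the role of a Gauss sum; it satisfies
-- G δ = χ, G χ = J χ̄ and G χ̄ = l δ − 1, hence G³ χ = l J χ, and G^q is computed modulo a prime q by
-- the Frobenius map.
module Gauss {l : ℕ} (l-prime : Prime l) (l≢3 : l ≢ 3) (X : CubicCharacter l) where

  open CubicCharacter X
  private
    instance
      l≢0 : ℕ.NonZero l
      l≢0 = prime⇒nonZero l-prime
  open Residues l
  private
    module L = ℤ/ (+ l)
    module LR = CommutativeRing L.ring
    open L using (_≋_)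
    open ≡-Reasoning

  χ̄ : ℤ → E
  χ̄ = conj ∘ χ

  χ-cases : ∀ a → (+ l ∣ a × χ a ≡ 0E) ⊎ (Coprime (+ l) a × μ₃ (χ a))
  χ-cases a = go (+ l ∣? a)
    where
    go : Dec (+ l ∣ a) → (+ l ∣ a × χ a ≡ 0E) ⊎ (Coprime (+ l) a × μ₃ (χ a))
    go (yes l∣a) = inj₁ (l∣a , χ-0 l∣a)
    go (no l∤a)  = inj₂ (prime-∤⇒coprime l-prime a l∤a , χ-μ₃ l∤a)

  χ̄-≋ : Periodic χ̄
  χ̄-≋ a≋b = cong conj (χ-≋ a≋b)

  χ̄-* : ∀ a b → χ̄ (a * b) ≡ χ̄ a ⊗ χ̄ b
  χ̄-* a b = trans (cong conj (χ-* a b)) (conj-⊗ (χ a) (χ b))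

  χ-1 : χ 1ℤ ≡ 1E
  χ-1 = μ₃-idempotent (χ-μ₃ (prime-∤1 l-prime)) (χ-* 1ℤ 1ℤ)

  χ-neg1 : χ -1ℤ ≡ 1E
  χ-neg1 = μ₃-involutive (χ-μ₃ (λ l∣-1 → prime-∤1 l-prime (∣m⇒∣-m l∣-1))) (trans (sym (χ-* -1ℤ -1ℤ)) χ-1)

  χ-even : ∀ a → χ (- a) ≡ χ a
  χ-even a = trans (cong χ (sym (ℤ.-1*i≡-i a))) (trans (χ-* -1ℤ a)
    (trans (cong (_⊗ χ a) χ-neg1) (⊗-identityˡ (χ a))))

  χ-flip : ∀ a b → χ (a - b) ≡ χ (b - a)
  χ-flip a b = trans (sym (χ-even (a - b))) (cong χ (p a b))
    where
    p : ∀ a b → - (a - b) ≡ b - a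
    p = solve-∀

  χ-² : ∀ a → χ a ⊗ χ a ≡ χ̄ a
  χ-² a = case χ-cases a of λ
    { (inj₁ (_ , χ≡0)) → trans (cong₂ _⊗_ χ≡0 χ≡0) (cong conj (sym χ≡0))
    ; (inj₂ (_ , μ)) → sym (μ₃-conj≡² μ) }

  χ-χ̄ : ∀ a → χ a ⊗ χ̄ a ≡ 1E ⊖ δ a
  χ-χ̄ a = case χ-cases a of λ
    { (inj₁ (l∣a , χ≡0)) → trans (cong (λ x → x ⊗ conj x) χ≡0) (cong (1E ⊖_) (sym (δ-∣ l∣a)))
    ; (inj₂ (co , μ)) → trans (μ₃-⊗-conj μ) (cong (1E ⊖_) (sym (δ-∤ (coprime⇒∤ l-prime co)))) }

  -- Scaling the residues by `unit` multiplies the sum S by some u ≠ 1, so (u - 1) S = 0.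
  -- Multiplication by the conjugate of u - 1 turns this factor into its norm 3, which can be
  -- cancelled.
  ∑χ≡0 : ∑ l χ ≡ 0E
  ∑χ≡0 = case μ₃-norm (χ-μ₃ unit-∤) one of λ
    { (inj₁ χu≡1) → contradiction χu≡1 χ-unit
    ; (inj₂ norm≡3) → ι-cancel {+ 3} {∑ l χ} (λ ()) (3S≡0 norm≡3) }
    where
    u = χ unit
    uS≡S : u ⊗ ∑ l χ ≡ ∑ l χ
    uS≡S = begin
      u ⊗ ∑ l χ                ≡⟨ ∑-⊗ l u χ ⟨
      ∑ l (λ i → u ⊗ χ i)      ≡⟨ ∑-cong l (λ i → χ-* unit i) ⟨
      ∑ l (λ i → χ (unit * i)) ≡⟨ ∑-scale χ-≋ (prime-∤⇒coprime l-prime unit unit-∤) ⟩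
      ∑ l χ                    ∎
    3S≡0 : norm (u ⊖ 1E) ≡ + 3 → ι (+ 3) ⊗ ∑ l χ ≡ 0E
    3S≡0 norm≡3 = begin
      ι (+ 3) ⊗ ∑ l χ                          ≡⟨ cong (λ n → ι n ⊗ ∑ l χ) norm≡3 ⟨
      ι (norm (u ⊖ 1E)) ⊗ ∑ l χ                ≡⟨ cong (_⊗ ∑ l χ) (⊗-conj (u ⊖ 1E)) ⟨
      (u ⊖ 1E) ⊗ conj (u ⊖ 1E) ⊗ ∑ l χ         ≡⟨ p u (conj (u ⊖ 1E)) (∑ l χ) ⟩
      conj (u ⊖ 1E) ⊗ (u ⊗ ∑ l χ ⊖ ∑ l χ)      ≡⟨ cong (λ x → conj (u ⊖ 1E) ⊗ (x ⊖ ∑ l χ)) uS≡S ⟩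
      conj (u ⊖ 1E) ⊗ (∑ l χ ⊖ ∑ l χ)          ≡⟨ q (conj (u ⊖ 1E)) (∑ l χ) ⟩
      0E                                       ∎
      where
      p : ∀ u c s → (u ⊖ 1E) ⊗ c ⊗ s ≡ c ⊗ (u ⊗ s ⊖ s)
      p = RingSolver.solve-∀ E-solver
      q : ∀ c s → c ⊗ (s ⊖ s) ≡ 0E
      q = RingSolver.solve-∀ E-solver

  ∑χ̄≡0 : ∑ l χ̄ ≡ 0E
  ∑χ̄≡0 = trans (sym (conj-∑ l χ)) (cong conj ∑χ≡0)

  -- The substitution i ↦ z i reduces the value of the convolution at a unit z to its value at 1, as
  -- is usual for Jacobi sums.
  Γ-unit : ∀ {ψ} → Periodic ψ → (∀ a b → ψ (a * b) ≡ ψ a ⊗ ψ b) → ∀ {z} → Coprime (+ l) z →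
    Γ l χ ψ z ≡ χ z ⊗ ψ z ⊗ Γ l χ ψ 1ℤ
  Γ-unit {ψ} ψ-≋ ψ-* {z} co = begin
    ∑ l (λ i → χ i ⊗ ψ (z - i))                      ≡⟨ ∑-scale {λ i → χ i ⊗ ψ (z - i)} periodic co ⟨
    ∑ l (λ i → χ (z * i) ⊗ ψ (z - z * i))            ≡⟨ ∑-cong l factor ⟩
    ∑ l (λ i → χ z ⊗ ψ z ⊗ (χ i ⊗ ψ (1ℤ - i)))       ≡⟨ ∑-⊗ l (χ z ⊗ ψ z) _ ⟩
    χ z ⊗ ψ z ⊗ Γ l χ ψ 1ℤ                           ∎
    where
    periodic : Periodic (λ i → χ i ⊗ ψ (z - i))
    periodic a≋b = cong₂ _⊗_ (χ-≋ a≋b) (ψ-≋ (LR.+-congˡ {z} (LR.-‿cong a≋b)))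
    p : ∀ z i → z - z * i ≡ z * (1ℤ - i)
    p = solve-∀
    q : ∀ a b c d → a ⊗ b ⊗ (c ⊗ d) ≡ a ⊗ c ⊗ (b ⊗ d)
    q = RingSolver.solve-∀ E-solver
    factor : ∀ i → χ (z * i) ⊗ ψ (z - z * i) ≡ χ z ⊗ ψ z ⊗ (χ i ⊗ ψ (1ℤ - i))
    factor i = trans (cong₂ _⊗_ (χ-* z i) (trans (cong ψ (p z i)) (ψ-* z (1ℤ - i)))) (q (χ z) (χ i) (ψ z) (ψ (1ℤ - i)))

  Γ-zero : ∀ {ψ} → Periodic ψ → (∀ a → ψ (- a) ≡ ψ a) → ∀ {z} → + l ∣ z → Γ l χ ψ z ≡ ∑ l (λ i → χ i ⊗ ψ i)
  Γ-zero {ψ} ψ-≋ ψ-even {z} l∣z = ∑-cong l λ i → cong (χ i ⊗_) (trans (ψ-≋ (z-i≋-i i)) (ψ-even i))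
    where
    z-i≋-i : ∀ i → z - i ≋ - i
    z-i≋-i i = L.≋-trans (LR.+-congʳ (∣⇒≋0 l∣z)) (L.≋-reflexive (ℤ.+-identityˡ (- i)))

  J : E
  J = Γ l χ χ 1ℤ

  -- At multiples of l the character is even and the sum becomes Σ χ² = Σ χ̄ = 0, in agreement with
  -- χ̄ z = 0; one formula thus covers all z.
  Γχχ : ∀ z → Γ l χ χ z ≡ J ⊗ χ̄ z
  Γχχ z = case χ-cases z of λ
    { (inj₁ (l∣z , χ≡0)) → trans (Γ-zero χ-≋ χ-even l∣z) (trans (∑-cong l χ-²) (trans ∑χ̄≡0
        (sym (trans (cong (λ x → J ⊗ conj x) χ≡0) (E+.zeroʳ J)))))
    ; (inj₂ (co , _)) → trans (Γ-unit χ-≋ χ-* co) (trans (cong (_⊗ J) (χ-² z)) (⊗-comm (χ̄ z) J)) }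

  ∑χχ̄ : ∑ l (λ i → χ i ⊗ χ̄ i) ≡ ι (+ l) ⊖ 1E
  ∑χχ̄ = begin
    ∑ l (λ i → χ i ⊗ χ̄ i)                ≡⟨ ∑-cong l (λ i → trans (χ-χ̄ i) (p (δ i))) ⟩
    ∑ l (λ i → 1E ⊕ ⊝ 1E ⊗ δ i)          ≡⟨ ∑-⊕ l (λ _ → 1E) (λ i → ⊝ 1E ⊗ δ i) ⟩
    ∑ l (λ _ → 1E) ⊕ ∑ l (λ i → ⊝ 1E ⊗ δ i)   ≡⟨ cong₂ _⊕_ (∑-const l 1E) (∑-⊗ l (⊝ 1E) δ) ⟩
    ι (+ l) ⊗ 1E ⊕ ⊝ 1E ⊗ ∑ l δ          ≡⟨ cong (λ s → ι (+ l) ⊗ 1E ⊕ ⊝ 1E ⊗ s) ∑δ≡1 ⟩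
    ι (+ l) ⊗ 1E ⊕ ⊝ 1E ⊗ 1E             ≡⟨ q (ι (+ l)) ⟩
    ι (+ l) ⊖ 1E                         ∎
    where
    p : ∀ x → 1E ⊖ x ≡ 1E ⊕ ⊝ 1E ⊗ x
    p = RingSolver.solve-∀ E-solver
    q : ∀ x → x ⊗ 1E ⊕ ⊝ 1E ⊗ 1E ≡ x ⊖ 1E
    q = RingSolver.solve-∀ E-solver

  K : E
  K = Γ l χ χ̄ 1ℤ

  -- Since χ χ̄ is 1 on units, the convolution has the constant value K there; at multiples of l it
  -- is Σ χ χ̄ = l - 1.
  Γχχ̄-K : ∀ z → Γ l χ χ̄ z ≡ K ⊕ (ι (+ l) ⊖ 1E ⊖ K) ⊗ δ z
  Γχχ̄-K z = case χ-cases z of λ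
    { (inj₁ (l∣z , _)) → trans (Γ-zero χ̄-≋ (cong conj ∘ χ-even) l∣z) (trans ∑χχ̄ (trans (p (ι (+ l)) K)
        (cong (λ d → K ⊕ (ι (+ l) ⊖ 1E ⊖ K) ⊗ d) (sym (δ-∣ l∣z)))))
    ; (inj₂ (co , μ)) → trans (Γ-unit χ̄-≋ χ̄-* co) (trans (cong (_⊗ K) (μ₃-⊗-conj μ)) (trans (q (ι (+ l)) K)
        (cong (λ d → K ⊕ (ι (+ l) ⊖ 1E ⊖ K) ⊗ d) (sym (δ-∤ (coprime⇒∤ l-prime co)))))) }
    where
    p : ∀ l k → l ⊖ 1E ≡ k ⊕ (l ⊖ 1E ⊖ k) ⊗ 1E
    p = RingSolver.solve-∀ E-solver
    q : ∀ l k → 1E ⊗ k ≡ k ⊕ (l ⊖ 1E ⊖ k) ⊗ 0E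
    q = RingSolver.solve-∀ E-solver

  -- Both sides of the previous identity are summed over z; the left-hand side gives (Σ χ)(Σ χ̄) = 0.
  K≡-1 : K ≡ ⊝ 1E
  K≡-1 = trans (p K) (cong (_⊖ 1E) (ι-cancel {+ l - 1ℤ} l-1≢0 (begin
    ι (+ l - 1ℤ) ⊗ (1E ⊕ K)                                ≡⟨ q (ι (+ l)) K ⟩
    ι (+ l) ⊗ K ⊕ (ι (+ l) ⊖ 1E ⊖ K) ⊗ 1E                  ≡⟨ cong₂ _⊕_ (∑-const l K) (trans (∑-⊗ l (ι (+ l) ⊖ 1E ⊖ K) δ) (cong ((ι (+ l) ⊖ 1E ⊖ K) ⊗_) ∑δ≡1)) ⟨
    ∑ l (λ _ → K) ⊕ ∑ l (λ z → (ι (+ l) ⊖ 1E ⊖ K) ⊗ δ z)   ≡⟨ ∑-⊕ l _ _ ⟨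
    ∑ l (λ z → K ⊕ (ι (+ l) ⊖ 1E ⊖ K) ⊗ δ z)               ≡⟨ ∑-cong l Γχχ̄-K ⟨
    ∑ l (λ z → ∑ l λ i → χ i ⊗ χ̄ (z - i))                  ≡⟨ ∑-swap l l _ ⟩
    ∑ l (λ i → ∑ l λ z → χ i ⊗ χ̄ (z - i))                  ≡⟨ ∑-cong l (λ i → ∑-cong l λ z → cong (λ x → χ i ⊗ conj x) (χ-flip z i)) ⟩
    ∑ l (λ i → ∑ l λ z → χ i ⊗ χ̄ (i - z))                  ≡⟨ ∑-cong l (λ i → trans (∑-⊗ l (χ i) _) (trans (cong (χ i ⊗_) (trans (∑-translate χ̄-≋ i) ∑χ̄≡0)) (E+.zeroʳ (χ i)))) ⟩
    ∑ l (λ _ → 0E)                                         ≡⟨ trans (∑-const l 0E) (E+.zeroʳ (ι (+ l))) ⟩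
    0E ∎)))
    where
    p : ∀ k → k ≡ 1E ⊕ k ⊖ 1E
    p = RingSolver.solve-∀ E-solver
    q : ∀ l k → (l ⊖ 1E) ⊗ (1E ⊕ k) ≡ l ⊗ k ⊕ (l ⊖ 1E ⊖ k) ⊗ 1E
    q = RingSolver.solve-∀ E-solver
    l-1≢0 : + l - 1ℤ ≢ 0ℤ
    l-1≢0 eq = ¬prime[1] (subst Prime (ℤ.+-injective (ℤ.i-j≡0⇒i≡j (+ l) 1ℤ eq)) l-prime)

  Γχχ̄ : ∀ z → Γ l χ χ̄ z ≡ ι (+ l) ⊗ δ z ⊖ 1E
  Γχχ̄ z = trans (Γχχ̄-K z) (trans (cong (λ k → k ⊕ (ι (+ l) ⊖ 1E ⊖ k) ⊗ δ z) K≡-1) (p (ι (+ l)) (δ z)))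
    where
    p : ∀ l d → ⊝ 1E ⊕ (l ⊖ 1E ⊖ ⊝ 1E) ⊗ d ≡ l ⊗ d ⊖ 1E
    p = RingSolver.solve-∀ E-solver

  Γ[lδ-1] : ∀ {ψ} → Periodic ψ → ∑ l ψ ≡ 0E → ∀ z → Γ l ψ (λ y → ι (+ l) ⊗ δ y ⊖ 1E) z ≡ ι (+ l) ⊗ ψ z
  Γ[lδ-1] {ψ} ψ-≋ ∑ψ≡0 z = begin
    ∑ l (λ i → ψ i ⊗ (ι (+ l) ⊗ δ (z - i) ⊖ 1E))        ≡⟨ ∑-cong l (λ i → p (ψ i) (ι (+ l)) (δ (z - i))) ⟩
    ∑ l (λ i → ι (+ l) ⊗ (ψ i ⊗ δ (z - i)) ⊕ ⊝ 1E ⊗ ψ i)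
      ≡⟨ ∑-⊕ l (λ i → ι (+ l) ⊗ (ψ i ⊗ δ (z - i))) (λ i → ⊝ 1E ⊗ ψ i) ⟩
    ∑ l (λ i → ι (+ l) ⊗ (ψ i ⊗ δ (z - i))) ⊕ ∑ l (λ i → ⊝ 1E ⊗ ψ i)
      ≡⟨ cong₂ _⊕_ (∑-⊗ l (ι (+ l)) _) (∑-⊗ l (⊝ 1E) ψ) ⟩
    ι (+ l) ⊗ Γ l ψ δ z ⊕ ⊝ 1E ⊗ ∑ l ψ                  ≡⟨ cong₂ (λ x y → ι (+ l) ⊗ x ⊕ ⊝ 1E ⊗ y) (Γ-δ ψ-≋ z) ∑ψ≡0 ⟩
    ι (+ l) ⊗ ψ z ⊕ ⊝ 1E ⊗ 0E                           ≡⟨ q (ι (+ l) ⊗ ψ z) ⟩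
    ι (+ l) ⊗ ψ z                                       ∎
    where
    p : ∀ x l d → x ⊗ (l ⊗ d ⊖ 1E) ≡ l ⊗ (x ⊗ d) ⊕ ⊝ 1E ⊗ x
    p = RingSolver.solve-∀ E-solver
    q : ∀ x → x ⊕ ⊝ 1E ⊗ 0E ≡ x
    q = RingSolver.solve-∀ E-solver

  -- The convolution χ ∗ χ̄ ∗ χ̄ is evaluated in two orders: χ̄ ∗ χ̄ = J̄ χ leads to J J̄ χ̄,
  -- whereas χ ∗ χ̄ = l δ - 1 leads to l χ̄.
  J⊗conjJ : J ⊗ conj J ≡ ι (+ l)
  J⊗conjJ = begin
    J ⊗ conj J                       ≡⟨ p J (conj J) ⟩
    conj J ⊗ (J ⊗ 1E)                ≡⟨ cong (λ x → conj J ⊗ (J ⊗ conj x)) χ-1 ⟨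
    conj J ⊗ (J ⊗ χ̄ 1ℤ)              ≡⟨ cong (conj J ⊗_) (Γχχ 1ℤ) ⟨
    conj J ⊗ Γ l χ χ 1ℤ              ≡⟨ Γ-scale l χ (conj J) χ 1ℤ ⟨
    Γ l χ (λ z → conj J ⊗ χ z) 1ℤ    ≡⟨ Γ-cong l χ Γχ̄χ̄ 1ℤ ⟨
    Γ l χ (Γ l χ̄ χ̄) 1ℤ               ≡⟨ Γ-comm l χ χ̄ χ̄ 1ℤ ⟩
    Γ l χ̄ (Γ l χ χ̄) 1ℤ               ≡⟨ Γ-cong l χ̄ Γχχ̄ 1ℤ ⟩
    Γ l χ̄ (λ z → ι (+ l) ⊗ δ z ⊖ 1E) 1ℤ  ≡⟨ Γ[lδ-1] χ̄-≋ ∑χ̄≡0 1ℤ ⟩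
    ι (+ l) ⊗ χ̄ 1ℤ                   ≡⟨ cong (λ x → ι (+ l) ⊗ conj x) χ-1 ⟩
    ι (+ l) ⊗ 1E                     ≡⟨ E+.*-identityʳ (ι (+ l)) ⟩
    ι (+ l)                          ∎
    where
    p : ∀ x y → x ⊗ y ≡ y ⊗ (x ⊗ 1E)
    p = RingSolver.solve-∀ E-solver
    Γχ̄χ̄ : ∀ z → Γ l χ̄ χ̄ z ≡ conj J ⊗ χ z
    Γχ̄χ̄ z = begin
      ∑ l (λ i → conj (χ i) ⊗ conj (χ (z - i)))   ≡⟨ ∑-cong l (λ i → conj-⊗ (χ i) (χ (z - i))) ⟨
      ∑ l (λ i → conj (χ i ⊗ χ (z - i)))          ≡⟨ conj-∑ l _ ⟨
      conj (Γ l χ χ z)                            ≡⟨ cong conj (Γχχ z) ⟩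
      conj (J ⊗ conj (χ z))                       ≡⟨ trans (conj-⊗ J (χ̄ z)) (cong (conj J ⊗_) (conj-involutive (χ z))) ⟩
      conj J ⊗ χ z                                ∎

  norm-J : norm J ≡ + l
  norm-J = ι-injective (trans (sym (⊗-conj J)) J⊗conjJ)

  G : ℕ → ℤ → E
  G = fold δ (Γ l χ)

  -- Each round of three convolutions contributes l J. Writing l as J J̄ makes this `κ J`, an
  -- expression in J alone and multiplicative in it, so that the resulting law makes sense for
  -- composite β.
  G-3k+1 : ∀ k z → G (1 ℕ.+ k ℕ.* 3) z ≡ κ J ^ᴱ k ⊗ χ z
  G-3k+2 : ∀ k z → G (2 ℕ.+ k ℕ.* 3) z ≡ κ J ^ᴱ k ⊗ J ⊗ χ̄ z
  G-3k+3 : ∀ k z → G (3 ℕ.+ k ℕ.* 3) z ≡ κ J ^ᴱ k ⊗ J ⊗ (ι (+ l) ⊗ δ z ⊖ 1E)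
  G-3k+1 zero    z = trans (Γ-δ χ-≋ z) (sym (⊗-identityˡ (χ z)))
  G-3k+1 (suc k) z = begin
    Γ l χ (G (3 ℕ.+ k ℕ.* 3)) z                                ≡⟨ Γ-cong l χ (G-3k+3 k) z ⟩
    Γ l χ (λ y → κ J ^ᴱ k ⊗ J ⊗ (ι (+ l) ⊗ δ y ⊖ 1E)) z          ≡⟨ Γ-scale l χ (κ J ^ᴱ k ⊗ J) (λ y → ι (+ l) ⊗ δ y ⊖ 1E) z ⟩
    κ J ^ᴱ k ⊗ J ⊗ Γ l χ (λ y → ι (+ l) ⊗ δ y ⊖ 1E) z            ≡⟨ cong (κ J ^ᴱ k ⊗ J ⊗_) (Γ[lδ-1] χ-≋ ∑χ≡0 z) ⟩
    κ J ^ᴱ k ⊗ J ⊗ (ι (+ l) ⊗ χ z)                               ≡⟨ cong (λ x → κ J ^ᴱ k ⊗ J ⊗ (x ⊗ χ z)) J⊗conjJ ⟨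
    κ J ^ᴱ k ⊗ J ⊗ (J ⊗ conj J ⊗ χ z)                            ≡⟨ p (κ J ^ᴱ k) J (conj J) (χ z) ⟩
    J ⊗ J ⊗ conj J ⊗ κ J ^ᴱ k ⊗ χ z                              ∎
    where
    p : ∀ c j k x → c ⊗ j ⊗ (j ⊗ k ⊗ x) ≡ j ⊗ j ⊗ k ⊗ c ⊗ x
    p = RingSolver.solve-∀ E-solver
  G-3k+2 k z = begin
    Γ l χ (G (1 ℕ.+ k ℕ.* 3)) z         ≡⟨ Γ-cong l χ (G-3k+1 k) z ⟩
    Γ l χ (λ y → κ J ^ᴱ k ⊗ χ y) z        ≡⟨ Γ-scale l χ (κ J ^ᴱ k) χ z ⟩
    κ J ^ᴱ k ⊗ Γ l χ χ z                  ≡⟨ cong (κ J ^ᴱ k ⊗_) (Γχχ z) ⟩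
    κ J ^ᴱ k ⊗ (J ⊗ χ̄ z)                  ≡⟨ ⊗-assoc (κ J ^ᴱ k) J (χ̄ z) ⟨
    κ J ^ᴱ k ⊗ J ⊗ χ̄ z                    ∎
  G-3k+3 k z = begin
    Γ l χ (G (2 ℕ.+ k ℕ.* 3)) z                   ≡⟨ Γ-cong l χ (G-3k+2 k) z ⟩
    Γ l χ (λ y → κ J ^ᴱ k ⊗ J ⊗ χ̄ y) z              ≡⟨ Γ-scale l χ (κ J ^ᴱ k ⊗ J) χ̄ z ⟩
    κ J ^ᴱ k ⊗ J ⊗ Γ l χ χ̄ z                        ≡⟨ cong (κ J ^ᴱ k ⊗ J ⊗_) (Γχχ̄ z) ⟩
    κ J ^ᴱ k ⊗ J ⊗ (ι (+ l) ⊗ δ z ⊖ 1E)             ∎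

  module _ {q} (q-prime : Prime q) (co : Coprime (+ l) (+ q)) where
    private
      module Q = E/ (+ q)

    -- By Frobenius the iterate is Σ χ(i)^q δ(z - q i). Evaluating at z = q concentrates the sum at
    -- i = 1, where it is 1; in the exact formulas for G the same argument produces χ(q) or its
    -- conjugate.
    G-frobenius : Q._≋_ (G q (+ q)) 1E
    G-frobenius = Q.≋-trans (Q.≋-reflexive (fold-Γ q (+ q)))
      (Q.≋-trans (convolve-frobeniusᴱ {l} (λ i → χ (+ toℕ i)) δ (+ q)) (Q.≋-reflexive (begin
        sumᴱ {l} (λ i → χ (+ toℕ i) ^ᴱ q ⊗ δ (+ q - + q * + toℕ i))  ≡⟨ ∑-def l (λ i → χ i ^ᴱ q ⊗ δ (+ q - + q * i)) ⟨
        ∑ l (λ i → χ i ^ᴱ q ⊗ δ (+ q - + q * i))   ≡⟨ ∑-cong l (λ i → cong (χ i ^ᴱ q ⊗_) (δ-cancel i)) ⟩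
        Γ l (λ i → χ i ^ᴱ q) δ 1ℤ                  ≡⟨ Γ-δ (λ a≋b → cong (_^ᴱ q) (χ-≋ a≋b)) 1ℤ ⟩
        χ 1ℤ ^ᴱ q                                  ≡⟨ cong (_^ᴱ q) χ-1 ⟩
        1E ^ᴱ q                                    ≡⟨ 1^ q ⟩
        1E                                         ∎)))
      where
      open Frobeniusᴱ q-prime
      fold-Γ : ∀ n z → G n z ≡ fold δ (convolveᴱ {l} λ i → χ (+ toℕ i)) n z
      fold-Γ zero    z = refl
      fold-Γ (suc n) z = trans (Γ-cong l χ (fold-Γ n) z) (∑-def l _)
      p : ∀ q i → q - q * i ≡ q * (1ℤ - i)
      p = solve-∀
      δ-cancel : ∀ i → δ (+ q - + q * i) ≡ δ (1ℤ - i)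
      δ-cancel i = trans (cong δ (p (+ q) i)) (go (+ l ∣? (1ℤ - i)))
        where
        go : Dec (+ l ∣ 1ℤ - i) → δ (+ q * (1ℤ - i)) ≡ δ (1ℤ - i)
        go (yes l∣) = trans (δ-∣ (∣n⇒∣m*n (+ q) l∣)) (sym (δ-∣ l∣))
        go (no l∤)  = trans (δ-∤ (l∤ ∘ coprime-∣ co (1ℤ - i))) (sym (δ-∤ l∤))

  -- The Frobenius argument at the prime 3: three convolutions of δ give J (l δ - 1), whose value at
  -- 3 is -J because l does not divide 3.
  J-primary : E/._≋_ (+ 3) J (⊝ 1E)
  J-primary = Q.≋-trans (Q.≋-reflexive p) (CommutativeRing.-‿cong Q.ring (Q.≋-trans
    (Q.≋-reflexive (sym (trans (G-3k+3 0 (+ 3)) (cong (λ d → 1E ⊗ J ⊗ (ι (+ l) ⊗ d ⊖ 1E)) (δ-∤ l∤3)))))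
    (G-frobenius prime[3] (prime-∤⇒coprime l-prime (+ 3) l∤3))))
    where
    module Q = E/ (+ 3)
    l∤3 : ¬ + l ∣ + 3
    l∤3 l∣3 = l≢3 (prime-∣3 l-prime l∣3)
    lemma : ∀ j l → j ≡ ⊝ (1E ⊗ j ⊗ (l ⊗ 0E ⊖ 1E))
    lemma = RingSolver.solve-∀ E-solver
    p = lemma J (ι (+ l))

-- Cubic residue symbols of rational integers

κ-⊗ : ∀ β γ → κ (β ⊗ γ) ≡ κ β ⊗ κ γ
κ-⊗ β γ = trans (cong (β ⊗ γ ⊗ (β ⊗ γ) ⊗_) (conj-⊗ β γ)) (p β γ (conj β) (conj γ))
  where
  p : ∀ β γ β′ γ′ → β ⊗ γ ⊗ (β ⊗ γ) ⊗ (β′ ⊗ γ′) ≡ β ⊗ β ⊗ β′ ⊗ (γ ⊗ γ ⊗ γ′)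
  p = RingSolver.solve-∀ E-solver

κ-conj : ∀ β → κ (conj β) ≡ conj (κ β)
κ-conj β = sym (trans (conj-⊗ (β ⊗ β) (conj β)) (cong (_⊗ conj (conj β)) (conj-⊗ β β)))

conj-κ^ : ∀ β k → conj (κ β ^ᴱ k) ≡ κ (conj β) ^ᴱ k
conj-κ^ β k = trans (conj-^ (κ β) k) (cong (_^ᴱ k) (sym (κ-conj β)))

-- χ a is the cubic residue symbol (a / β); the laws split and inert are the reciprocity law between
-- β and a rational prime q, according to the behaviour of q in the Eisenstein integers.
record Symbol (β : E) : Set where
  field
    χ     : ℤ → E
    χ-≋   : ∀ {a b} → ℤ/._≋_ (norm β) a b → χ a ≡ χ b
    χ-*   : ∀ a b → χ (a * b) ≡ χ a ⊗ χ b
    χ-μ₃  : ∀ {a} → Coprime (norm β) a → μ₃ (χ a)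
    split : ∀ {q} k → Prime q → q ≡ 1 ℕ.+ 3 ℕ.* k → Coprime (norm β) (+ q) →
            E/._≋_ (+ q) (κ β ^ᴱ k ⊗ χ (+ q)) 1E
    inert : ∀ {q} k → Prime q → q ≡ 2 ℕ.+ 3 ℕ.* k → Coprime (norm β) (+ q) →
            E/._≋_ (+ q) (κ β ^ᴱ k ⊗ β ⊗ conj (χ (+ q))) 1E

  χ-1 : χ 1ℤ ≡ 1E
  χ-1 = μ₃-idempotent (χ-μ₃ (bezout 0ℤ 1ℤ (cong (_+ 1ℤ) (ℤ.*-zeroʳ (norm β))))) (χ-* 1ℤ 1ℤ)

  χ-neg1 : χ -1ℤ ≡ 1E
  χ-neg1 = μ₃-involutive (χ-μ₃ (bezout 0ℤ -1ℤ (cong (_+ 1ℤ) (ℤ.*-zeroʳ (norm β))))) (trans (sym (χ-* -1ℤ -1ℤ)) χ-1)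

  χ-neg : ∀ a → χ (- a) ≡ χ a
  χ-neg a = trans (cong χ (sym (ℤ.-1*i≡-i a))) (trans (χ-* -1ℤ a)
    (trans (cong (_⊗ χ a) χ-neg1) (⊗-identityˡ (χ a))))

≋-factorˡ : ∀ {m n a b} → ℤ/._≋_ (m * n) a b → ℤ/._≋_ m a b
≋-factorˡ {m} {n} {a} {b} (ℤ/.by c eq) = ℤ/.by (n * c) (trans eq (cong (_+_ b) (ℤ.*-assoc m n c)))

≋-factorʳ : ∀ {m n a b} → ℤ/._≋_ (m * n) a b → ℤ/._≋_ n a b
≋-factorʳ {m} {n} {a} {b} a≋b = ≋-factorˡ (subst (λ k → ℤ/._≋_ k a b) (ℤ.*-comm m n) a≋b)

⊗-symbol : ∀ {β γ} → Symbol β → Symbol γ → Symbol (β ⊗ γ)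
⊗-symbol {β} {γ} S T = record
  { χ = λ a → S.χ a ⊗ T.χ a
  ; χ-≋ = λ {a} {b} a≋b → let a≋b′ = subst (λ n → ℤ/._≋_ n a b) (norm-⊗ β γ) a≋b in
      cong₂ _⊗_ (S.χ-≋ (≋-factorˡ a≋b′)) (T.χ-≋ (≋-factorʳ {norm β} a≋b′))
  ; χ-* = λ a b → trans (cong₂ _⊗_ (S.χ-* a b) (T.χ-* a b)) (p (S.χ a) (S.χ b) (T.χ a) (T.χ b))
  ; χ-μ₃ = λ co → μ₃-⊗ (S.χ-μ₃ (coˡ co)) (T.χ-μ₃ (coʳ co))
  ; split = λ {q} k q-prime q≡ co → let module Q = ModE (+ q) in Q.≋-trans
      (Q.≋-reflexive (trans (cong (_⊗ (S.χ (+ q) ⊗ T.χ (+ q))) (κ^ k))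
        (p (κ β ^ᴱ k) (κ γ ^ᴱ k) (S.χ (+ q)) (T.χ (+ q)))))
      (Q.≋-* (S.split k q-prime q≡ (coˡ co)) (T.split k q-prime q≡ (coʳ co)))
  ; inert = λ {q} k q-prime q≡ co → let module Q = ModE (+ q) in Q.≋-trans
      (Q.≋-reflexive (trans (cong₂ (λ x y → x ⊗ (β ⊗ γ) ⊗ y) (κ^ k) (conj-⊗ (S.χ (+ q)) (T.χ (+ q))))
        (r (κ β ^ᴱ k) (κ γ ^ᴱ k) β γ (conj (S.χ (+ q))) (conj (T.χ (+ q))))))
      (Q.≋-* (S.inert k q-prime q≡ (coˡ co)) (T.inert k q-prime q≡ (coʳ co))) }
  where
  module S = Symbol S
  module T = Symbol T
  p : ∀ a b c d → a ⊗ b ⊗ (c ⊗ d) ≡ a ⊗ c ⊗ (b ⊗ d)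
  p = RingSolver.solve-∀ E-solver
  r : ∀ a b c d e f → a ⊗ b ⊗ (c ⊗ d) ⊗ (e ⊗ f) ≡ a ⊗ c ⊗ e ⊗ (b ⊗ d ⊗ f)
  r = RingSolver.solve-∀ E-solver
  κ^ : ∀ k → κ (β ⊗ γ) ^ᴱ k ≡ κ β ^ᴱ k ⊗ κ γ ^ᴱ k
  κ^ k = trans (cong (_^ᴱ k) (κ-⊗ β γ)) (E^.^-distrib-* (κ β) (κ γ) k)
  coˡ : ∀ {a} → Coprime (norm (β ⊗ γ)) a → Coprime (norm β) a
  coˡ {a} co = coprime-sym (coprime-factorˡ (norm β) (norm γ) (subst (Coprime a) (norm-⊗ β γ) (coprime-sym co)))
  coʳ : ∀ {a} → Coprime (norm (β ⊗ γ)) a → Coprime (norm γ) a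
  coʳ {a} co = coprime-sym (coprime-factorʳ (norm β) (norm γ) (subst (Coprime a) (norm-⊗ β γ) (coprime-sym co)))

conj-symbol : ∀ {β} → Symbol β → Symbol (conj β)
conj-symbol {β} S = record
  { χ = conj ∘ χ
  ; χ-≋ = λ {a} {b} a≋b → cong conj (χ-≋ (subst (λ n → ℤ/._≋_ n a b) (norm-conj β) a≋b))
  ; χ-* = λ a b → trans (cong conj (χ-* a b)) (conj-⊗ (χ a) (χ b))
  ; χ-μ₃ = λ co → μ₃-conj (χ-μ₃ (subst (λ n → Coprime n _) (norm-conj β) co))
  ; split = λ {q} k q-prime q≡ co → let module Q = ModE (+ q) in Q.≋-trans
      (Q.≋-reflexive (sym (trans (conj-⊗ (κ β ^ᴱ k) (χ (+ q))) (cong (_⊗ conj (χ (+ q))) (conj-κ^ β k)))))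
      (Q.conj-≋ (split k q-prime q≡ (subst (λ n → Coprime n _) (norm-conj β) co)))
  ; inert = λ {q} k q-prime q≡ co → let module Q = ModE (+ q) in Q.≋-trans
      (Q.≋-reflexive (sym (trans (conj-⊗ (κ β ^ᴱ k ⊗ β) (conj (χ (+ q)))) (cong (_⊗ conj (conj (χ (+ q))))
        (trans (conj-⊗ (κ β ^ᴱ k) β) (cong (_⊗ conj β) (conj-κ^ β k)))))))
      (Q.conj-≋ (inert k q-prime q≡ (subst (λ n → Coprime n _) (norm-conj β) co))) }
  where open Symbol S

-- Modulo q, the inverse of β is β̄ times the inverse of the norm.
≋-cancelʳ : ∀ {q β} → Coprime q (norm β) → ∀ {x y} → E/._≋_ q (x ⊗ β) (y ⊗ β) → E/._≋_ q x y
≋-cancelʳ {q} {β} (bezout u v eq) {x} {y} xβ≋yβ = begin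
  x                                   ≡⟨ E+.*-identityʳ x ⟨
  x ⊗ 1E                              ≈⟨ ≋-*ˡ β-inverse ⟨
  x ⊗ (β ⊗ (conj β ⊗ ι v))            ≡⟨ ⊗-assoc x β _ ⟨
  x ⊗ β ⊗ (conj β ⊗ ι v)              ≈⟨ ≋-*ʳ xβ≋yβ ⟩
  y ⊗ β ⊗ (conj β ⊗ ι v)              ≡⟨ ⊗-assoc y β _ ⟩
  y ⊗ (β ⊗ (conj β ⊗ ι v))            ≈⟨ ≋-*ˡ β-inverse ⟩
  y ⊗ 1E                              ≡⟨ E+.*-identityʳ y ⟩
  y                                   ∎
  where
  open ModE q
  p : ∀ q u N v → N * v ≡ q * u + N * v + q * (- u)
  p = solve-∀
  β-inverse : β ⊗ (conj β ⊗ ι v) ≋ 1E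
  β-inverse = begin
    β ⊗ (conj β ⊗ ι v)      ≡⟨ ⊗-assoc β (conj β) (ι v) ⟨
    β ⊗ conj β ⊗ ι v        ≡⟨ cong (_⊗ ι v) (⊗-conj β) ⟩
    ι (norm β) ⊗ ι v        ≡⟨ ι-* (norm β) v ⟨
    ι (norm β * v)          ≈⟨ ι-≋ (ℤ/.by (- u) (trans (p q u (norm β) v) (cong (_+ q * (- u)) eq))) ⟩
    1E                      ∎

norm-ι : ∀ c → norm (ι c) ≡ c * c
norm-ι = p
  where
  p : ∀ c → c * c - c * 0ℤ + 0ℤ * 0ℤ ≡ c * c
  p = solve-∀

^-3* : ∀ x k → (x ⊗ x ⊗ x) ^ᴱ k ≡ x ^ᴱ (3 ℕ.* k)
^-3* x k = trans (cong (_^ᴱ k) (p x)) (E^.^-assocʳ x 3 k)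
  where
  p : ∀ x → x ⊗ x ⊗ x ≡ x ⊗ (x ⊗ (x ⊗ 1E))
  p = RingSolver.solve-∀ E-solver

-- Rational integers are cubic residues modulo a coprime rational c, so the trivial symbol is the
-- right one. As κ(c) = c³, both laws amount to c^q ≡ c after cancelling a factor c.
ι-symbol : ∀ c → Symbol (ι c)
ι-symbol c = record
  { χ = λ _ → 1E
  ; χ-≋ = λ _ → refl
  ; χ-* = λ _ _ → refl
  ; χ-μ₃ = λ _ → one
  ; split = λ {q} k q-prime q≡ co → let open ModE (+ q) in
      ≋-cancelʳ {+ q} {ι c} (coprime-sym co) (begin
        κ (ι c) ^ᴱ k ⊗ 1E ⊗ ι c          ≡⟨ p (κ (ι c) ^ᴱ k) (ι c) ⟩
        ι c ⊗ κ (ι c) ^ᴱ k               ≡⟨ cong (ι c ⊗_) (κ^ k) ⟩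
        ι c ^ᴱ suc (3 ℕ.* k)             ≡⟨ cong (ι c ^ᴱ_) q≡ ⟨
        ι c ^ᴱ q                         ≈⟨ fermat q-prime c ⟩
        ι c                              ≡⟨ ⊗-identityˡ (ι c) ⟨
        1E ⊗ ι c                         ∎)
  ; inert = λ {q} k q-prime q≡ co → let open ModE (+ q) in
      ≋-cancelʳ {+ q} {ι c} (coprime-sym co) (begin
        κ (ι c) ^ᴱ k ⊗ ι c ⊗ conj 1E ⊗ ι c  ≡⟨ r (κ (ι c) ^ᴱ k) (ι c) ⟩
        ι c ⊗ (ι c ⊗ κ (ι c) ^ᴱ k)       ≡⟨ cong (λ x → ι c ⊗ (ι c ⊗ x)) (κ^ k) ⟩
        ι c ^ᴱ (2 ℕ.+ (3 ℕ.* k))         ≡⟨ cong (ι c ^ᴱ_) q≡ ⟨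
        ι c ^ᴱ q                         ≈⟨ fermat q-prime c ⟩
        ι c                              ≡⟨ ⊗-identityˡ (ι c) ⟨
        1E ⊗ ι c                         ∎) }
  where
  p : ∀ x c → x ⊗ 1E ⊗ c ≡ c ⊗ x
  p = RingSolver.solve-∀ E-solver
  r : ∀ x c → x ⊗ c ⊗ 1E ⊗ c ≡ c ⊗ (c ⊗ x)
  r = RingSolver.solve-∀ E-solver
  κ^ : ∀ k → κ (ι c) ^ᴱ k ≡ ι c ^ᴱ (3 ℕ.* k)
  κ^ k = trans (cong (λ x → (ι c ⊗ ι c ⊗ x) ^ᴱ k) (conj-ι c)) (^-3* (ι c) k)

-- The q-th iterate at q is known twice: exactly, from the cycle of three convolutions, and modulo
-- q, from Frobenius. The residue of q modulo 3 decides which of the two laws results.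
J-symbol : ∀ {l} (l-prime : Prime l) (l≢3 : l ≢ 3) (X : CubicCharacter l) → Symbol (Gauss.J l-prime l≢3 X)
J-symbol {l} l-prime l≢3 X = record
  { χ = χ
  ; χ-≋ = λ {a} {b} a≋b → χ-≋ (subst (λ n → ℤ/._≋_ n a b) norm-J a≋b)
  ; χ-* = χ-*
  ; χ-μ₃ = λ co → χ-μ₃ (coprime⇒∤ l-prime (subst (λ n → Coprime n _) norm-J co))
  ; split = λ {q} k q-prime q≡ co → let open E/ (+ q) in ≋-trans
      (≋-reflexive (sym (trans (cong (λ m → G m (+ q)) (trans q≡ (cong suc (ℕ.*-comm 3 k)))) (G-3k+1 k (+ q)))))
      (G-frobenius q-prime (subst (λ n → Coprime n _) norm-J co))
  ; inert = λ {q} k q-prime q≡ co → let open E/ (+ q) in ≋-trans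
      (≋-reflexive (sym (trans (cong (λ m → G m (+ q)) (trans q≡ (cong (2 ℕ.+_) (ℕ.*-comm 3 k)))) (G-3k+2 k (+ q)))))
      (G-frobenius q-prime (subst (λ n → Coprime n _) norm-J co)) }
  where
  open CubicCharacter X
  open Gauss l-prime l≢3 X 

-- Values of a symbol at divisors of β² - wⁱ β̄²

data Mod3ℤ (a : ℤ) : Set where
  3c   : ∀ c → a ≡ + 3 * c → Mod3ℤ a
  3c+1 : ∀ c → a ≡ 1ℤ + + 3 * c → Mod3ℤ a
  3c+2 : ∀ c → a ≡ + 2 + + 3 * c → Mod3ℤ a

mod3ℤ : ∀ a → Mod3ℤ a
mod3ℤ a = go (a ℤDivMod.%ℕ 3) (ℤDivMod.n%ℕd<d a 3) (trans (ℤDivMod.a≡a%ℕn+[a/ℕn]*n a 3)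
  (cong (_+_ (+ (a ℤDivMod.%ℕ 3))) (ℤ.*-comm (a ℤDivMod./ℕ 3) (+ 3))))
  where
  c = a ℤDivMod./ℕ 3
  go : ∀ r → r ℕ.< 3 → a ≡ + r + + 3 * c → Mod3ℤ a
  go 0 _ eq = 3c c (trans eq (ℤ.+-identityˡ (+ 3 * c)))
  go 1 _ eq = 3c+1 c eq
  go 2 _ eq = 3c+2 c eq
  go (suc (suc (suc _))) (ℕ.s≤s (ℕ.s≤s (ℕ.s≤s ())))

-- The quotient s = (a² - 1)/3 governs all exponents of symbols below: it is unchanged under a ↦ -a,
-- is additive under products modulo 3 (`square-*`), and modulo 3 depends only on ±a modulo 9.
3∤⇒square : ∀ {a} → ¬ + 3 ∣ a → ∃[ s ] a * a ≡ 1ℤ + + 3 * s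
3∤⇒square {a} 3∤a with mod3ℤ a
... | 3c c eq   = contradiction (divides c (trans eq (ℤ.*-comm (+ 3) c))) 3∤a
... | 3c+1 c eq = + 3 * c * c + + 2 * c , trans (cong₂ _*_ eq eq) (p c)
  where
  p : ∀ c → (1ℤ + + 3 * c) * (1ℤ + + 3 * c) ≡ 1ℤ + + 3 * (+ 3 * c * c + + 2 * c)
  p = solve-∀
... | 3c+2 c eq = + 3 * c * c + + 4 * c + 1ℤ , trans (cong₂ _*_ eq eq) (p c)
  where
  p : ∀ c → (+ 2 + + 3 * c) * (+ 2 + + 3 * c) ≡ 1ℤ + + 3 * (+ 3 * c * c + + 4 * c + 1ℤ)
  p = solve-∀

1+3*-injective : ∀ {a b} → 1ℤ + + 3 * a ≡ 1ℤ + + 3 * b → a ≡ b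
1+3*-injective {a} {b} eq = ℤ.*-cancelˡ-≡ (+ 3) a b (trans (sym (p (+ 3 * a))) (trans (cong (_- 1ℤ) eq) (p (+ 3 * b))))
  where
  p : ∀ x → 1ℤ + x - 1ℤ ≡ x
  p = solve-∀

square-* : ∀ {a b s t} → a * a ≡ 1ℤ + + 3 * s → b * b ≡ 1ℤ + + 3 * t →
  a * b * (a * b) ≡ 1ℤ + + 3 * (s + t + + 3 * (s * t))
square-* {a} {b} {s} {t} a² b² = trans (p a b) (trans (cong₂ _*_ a² b²) (q s t))
  where
  p : ∀ a b → a * b * (a * b) ≡ a * a * (b * b)
  p = solve-∀
  q : ∀ s t → (1ℤ + + 3 * s) * (1ℤ + + 3 * t) ≡ 1ℤ + + 3 * (s + t + + 3 * (s * t))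
  q = solve-∀

-- If a prime q divides β² − wⁱ β̄², then the reciprocity law determines (q / β) outright: the powers of
-- β in it are computed by the Frobenius map.
module SymbolValue {β : E} (S : Symbol β) (i : ℤ) where
  open Symbol S

  -- Squaring removes the conjugates: wⁱ κ(β)² = β⁴ · wⁱ β̄² ≡ β⁶, and powers of β alone are
  -- accessible to Frobenius.
  κ^2k : ∀ {q} k → E/._≋_ q (β ⊗ β) (W i ⊗ (conj β ⊗ conj β)) →
    E/._≋_ q (W i ^ᴱ k ⊗ (κ β ^ᴱ k ⊗ κ β ^ᴱ k)) (β ^ᴱ (3 ℕ.* k) ⊗ β ^ᴱ (3 ℕ.* k))
  κ^2k {q} k β²≋ = begin
    W i ^ᴱ k ⊗ (κ β ^ᴱ k ⊗ κ β ^ᴱ k)      ≡⟨ cong (W i ^ᴱ k ⊗_) (E^.^-distrib-* (κ β) (κ β) k) ⟨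
    W i ^ᴱ k ⊗ (κ β ⊗ κ β) ^ᴱ k           ≡⟨ E^.^-distrib-* (W i) (κ β ⊗ κ β) k ⟨
    (W i ⊗ (κ β ⊗ κ β)) ^ᴱ k              ≈⟨ ^-≋ k κ² ⟩
    ((β ⊗ β ⊗ β) ⊗ (β ⊗ β ⊗ β)) ^ᴱ k      ≡⟨ E^.^-distrib-* (β ⊗ β ⊗ β) (β ⊗ β ⊗ β) k ⟩
    (β ⊗ β ⊗ β) ^ᴱ k ⊗ (β ⊗ β ⊗ β) ^ᴱ k   ≡⟨ cong₂ _⊗_ (^-3* β k) (^-3* β k) ⟩
    β ^ᴱ (3 ℕ.* k) ⊗ β ^ᴱ (3 ℕ.* k)       ∎
    where
    open ModE q
    κ² : W i ⊗ (κ β ⊗ κ β) ≋ (β ⊗ β ⊗ β) ⊗ (β ⊗ β ⊗ β)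
    κ² = begin
      W i ⊗ (κ β ⊗ κ β)                               ≡⟨ p (W i) β (conj β) ⟩
      β ⊗ β ⊗ β ⊗ β ⊗ (W i ⊗ (conj β ⊗ conj β))       ≈⟨ ≋-*ˡ β²≋ ⟨
      β ⊗ β ⊗ β ⊗ β ⊗ (β ⊗ β)                         ≡⟨ r β ⟩
      (β ⊗ β ⊗ β) ⊗ (β ⊗ β ⊗ β)                       ∎
      where
      p : ∀ u b c → u ⊗ (b ⊗ b ⊗ c ⊗ (b ⊗ b ⊗ c)) ≡ b ⊗ b ⊗ b ⊗ b ⊗ (u ⊗ (c ⊗ c))
      p = RingSolver.solve-∀ E-solver
      r : ∀ b → b ⊗ b ⊗ b ⊗ b ⊗ (b ⊗ b) ≡ (b ⊗ b ⊗ b) ⊗ (b ⊗ b ⊗ b)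
      r = RingSolver.solve-∀ E-solver

  -- The square of the reciprocity law gives χ(q) = w^(-ik) for q = 3k + 1 and w^(i(k+1)) for q = 3k
  -- + 2. The exponent i (q² - 1)/3 agrees with both modulo 3 and, unlike k, behaves well under
  -- products.
  prime-value : ∀ {q} → Prime q → ¬ + 3 ∣ + q → Coprime (norm β) (+ q) →
    E/._≋_ (+ q) (β ⊗ β) (W i ⊗ (conj β ⊗ conj β)) → ∃[ s ] (+ q * + q ≡ 1ℤ + + 3 * s × χ (+ q) ≡ W (i * s))
  prime-value {q} q-prime 3∤q co β²≋ with mod3 q
  ... | 3k k q≡ = contradiction (divides (+ k) (trans (cong +_ q≡) (trans (ℤ.pos-* 3 k) (ℤ.*-comm (+ 3) (+ k))))) 3∤q
  ... | 3k+1 k q≡ = + 3 * + k * + k + + 2 * + k , trans (cong (λ n → + n * + n) q≡)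
      (trans (cong (λ n → (1ℤ + n) * (1ℤ + n)) (ℤ.pos-* 3 k)) (square (+ k))) , value
    where
    open ModE (+ q)
    square : ∀ c → (1ℤ + + 3 * c) * (1ℤ + + 3 * c) ≡ 1ℤ + + 3 * (+ 3 * c * c + + 2 * c)
    square = solve-∀
    x = χ (+ q)
    q≢3 : q ≢ 3
    q≢3 refl = 3∤q (divides 1ℤ refl)
    β^3k : β ^ᴱ (3 ℕ.* k) ≋ 1E
    β^3k = ≋-cancelʳ {+ q} {β} (coprime-sym co) (begin
      β ^ᴱ (3 ℕ.* k) ⊗ β     ≡⟨ ⊗-comm (β ^ᴱ (3 ℕ.* k)) β ⟩
      β ^ᴱ suc (3 ℕ.* k)     ≡⟨ cong (β ^ᴱ_) q≡ ⟨
      β ^ᴱ q                 ≈⟨ ^q-split q-prime {k} q≡ β ⟩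
      β                      ≡⟨ ⊗-identityˡ β ⟨
      1E ⊗ β                 ∎)
    conj-value : W (+ k * i) ≡ conj x
    conj-value = μ₃-≋ q-prime (W-μ₃ (+ k * i)) (μ₃-conj (χ-μ₃ co)) (begin
      W (+ k * i)                                                ≡⟨ W-* i k ⟩
      W i ^ᴱ k                                                   ≡⟨ p (W i ^ᴱ k) ⟩
      W i ^ᴱ k ⊗ (1E ⊗ 1E)                                       ≈⟨ ≋-*ˡ (≋-* (split k q-prime q≡ co) (split k q-prime q≡ co)) ⟨
      W i ^ᴱ k ⊗ (κ β ^ᴱ k ⊗ x ⊗ (κ β ^ᴱ k ⊗ x))                 ≡⟨ r (W i ^ᴱ k) (κ β ^ᴱ k) x ⟩
      W i ^ᴱ k ⊗ (κ β ^ᴱ k ⊗ κ β ^ᴱ k) ⊗ (x ⊗ x)                 ≈⟨ ≋-*ʳ (≋-trans (κ^2k k β²≋) (≋-* β^3k β^3k)) ⟩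
      1E ⊗ (x ⊗ x)                                               ≡⟨ ⊗-identityˡ (x ⊗ x) ⟩
      x ⊗ x                                                      ≡⟨ μ₃-conj≡² (χ-μ₃ co) ⟨
      conj x                                                     ∎) q≢3
      where
      p : ∀ u → u ≡ u ⊗ (1E ⊗ 1E)
      p = RingSolver.solve-∀ E-solver
      r : ∀ u c x → u ⊗ (c ⊗ x ⊗ (c ⊗ x)) ≡ u ⊗ (c ⊗ c) ⊗ (x ⊗ x)
      r = RingSolver.solve-∀ E-solver
    exponent : ∀ k i → - (k * i) ≡ i * (+ 3 * k * k + + 2 * k) + + 3 * (- (i * k * k + i * k))
    exponent = solve-∀
    value : x ≡ W (i * (+ 3 * + k * + k + + 2 * + k))
    value = trans (sym (conj-involutive x)) (trans (cong conj (sym conj-value)) (trans (sym (W-neg (+ k * i)))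
      (W-≋ {i = - (+ k * i)} {j = i * (+ 3 * + k * + k + + 2 * + k)} (ℤ/.by (- (i * + k * + k + i * + k)) (exponent (+ k) i)))))
  ... | 3k+2 k q≡ = + 3 * + k * + k + + 4 * + k + 1ℤ , trans (cong (λ n → + n * + n) q≡)
      (trans (cong (λ n → (+ 2 + n) * (+ 2 + n)) (ℤ.pos-* 3 k)) (square (+ k))) , value
    where
    open ModE (+ q)
    square : ∀ c → (+ 2 + + 3 * c) * (+ 2 + + 3 * c) ≡ 1ℤ + + 3 * (+ 3 * c * c + + 4 * c + 1ℤ)
    square = solve-∀
    x = χ (+ q)
    B = β ^ᴱ (3 ℕ.* k)
    q≢3 : q ≢ 3
    q≢3 refl = 3∤q (divides 1ℤ refl)
    βB : β ⊗ (β ⊗ B) ≋ conj β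
    βB = ≋-trans (≋-reflexive (cong (β ^ᴱ_) (sym q≡))) (^q-inert q-prime {k} q≡ β)
    WβB : W i ⊗ (β ⊗ B ⊗ (β ⊗ B)) ≋ 1E
    WβB = ≋-cancelʳ {+ q} {β} (coprime-sym co) (≋-cancelʳ {+ q} {β} (coprime-sym co) (begin
      W i ⊗ (β ⊗ B ⊗ (β ⊗ B)) ⊗ β ⊗ β               ≡⟨ p (W i) β B ⟩
      W i ⊗ (β ⊗ (β ⊗ B) ⊗ (β ⊗ (β ⊗ B)))           ≈⟨ ≋-*ˡ (≋-* βB βB) ⟩
      W i ⊗ (conj β ⊗ conj β)                       ≈⟨ β²≋ ⟨
      β ⊗ β                                         ≡⟨ cong (_⊗ β) (⊗-identityˡ β) ⟨
      1E ⊗ β ⊗ β                                    ∎))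
      where
      p : ∀ u b c → u ⊗ (b ⊗ c ⊗ (b ⊗ c)) ⊗ b ⊗ b ≡ u ⊗ (b ⊗ (b ⊗ c) ⊗ (b ⊗ (b ⊗ c)))
      p = RingSolver.solve-∀ E-solver
    W-k : W (+ suc k * i) ≋ x
    W-k = begin
      W (+ suc k * i)                                            ≡⟨ W-* i (suc k) ⟩
      W i ⊗ W i ^ᴱ k                                             ≡⟨ p (W i) (W i ^ᴱ k) ⟩
      W i ⊗ W i ^ᴱ k ⊗ (1E ⊗ 1E)                                 ≈⟨ ≋-*ˡ (≋-* (inert k q-prime q≡ co) (inert k q-prime q≡ co)) ⟨
      W i ⊗ W i ^ᴱ k ⊗ (κ β ^ᴱ k ⊗ β ⊗ conj x ⊗ (κ β ^ᴱ k ⊗ β ⊗ conj x))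
        ≡⟨ r (W i) (W i ^ᴱ k) (κ β ^ᴱ k) β (conj x) ⟩
      W i ⊗ (W i ^ᴱ k ⊗ (κ β ^ᴱ k ⊗ κ β ^ᴱ k)) ⊗ (β ⊗ β) ⊗ (conj x ⊗ conj x)   ≈⟨ ≋-*ʳ (≋-*ʳ (≋-*ˡ (κ^2k k β²≋))) ⟩
      W i ⊗ (B ⊗ B) ⊗ (β ⊗ β) ⊗ (conj x ⊗ conj x)                ≡⟨ t (W i) B β (conj x) ⟩
      W i ⊗ (β ⊗ B ⊗ (β ⊗ B)) ⊗ (conj x ⊗ conj x)                ≈⟨ ≋-*ʳ WβB ⟩
      1E ⊗ (conj x ⊗ conj x)                                     ≡⟨ ⊗-identityˡ _ ⟩
      conj x ⊗ conj x                                            ≡⟨ μ₃-conj≡² (μ₃-conj (χ-μ₃ co)) ⟨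
      conj (conj x)                                              ≡⟨ conj-involutive x ⟩
      x                                                          ∎
      where
      p : ∀ u v → u ⊗ v ≡ u ⊗ v ⊗ (1E ⊗ 1E)
      p = RingSolver.solve-∀ E-solver
      r : ∀ u v c b x → u ⊗ v ⊗ (c ⊗ b ⊗ x ⊗ (c ⊗ b ⊗ x)) ≡ u ⊗ (v ⊗ (c ⊗ c)) ⊗ (b ⊗ b) ⊗ (x ⊗ x)
      r = RingSolver.solve-∀ E-solver
      t : ∀ u c b x → u ⊗ (c ⊗ c) ⊗ (b ⊗ b) ⊗ (x ⊗ x) ≡ u ⊗ (b ⊗ c ⊗ (b ⊗ c)) ⊗ (x ⊗ x)
      t = RingSolver.solve-∀ E-solver
    exponent : ∀ k i → (1ℤ + k) * i ≡ i * (+ 3 * k * k + + 4 * k + 1ℤ) + + 3 * (- (i * k * k + i * k))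
    exponent = solve-∀
    value : x ≡ W (i * (+ 3 * + k * + k + + 4 * + k + 1ℤ))
    value = trans (sym (μ₃-≋ q-prime (W-μ₃ (+ suc k * i)) (χ-μ₃ co) W-k q≢3))
      (W-≋ {i = + suc k * i} {j = i * (+ 3 * + k * + k + + 4 * + k + 1ℤ)} (ℤ/.by (- (i * + k * + k + i * + k)) (exponent (+ k) i)))

  ≋E-factorˡ : ∀ {m n x y} → E/._≋_ (m * n) x y → E/._≋_ m x y
  ≋E-factorˡ {m} {n} {x} {y} (E/.by c eq) = E/.by (ι n ⊗ c)
    (trans eq (cong (y ⊕_) (trans (cong (_⊗ c) (ι-* m n)) (⊗-assoc (ι m) (ι n) c))))

  product-value : ∀ qs → All Prime qs → ¬ + 3 ∣ + product qs → Coprime (norm β) (+ product qs) →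
    E/._≋_ (+ product qs) (β ⊗ β) (W i ⊗ (conj β ⊗ conj β)) →
    ∃[ s ] (+ product qs * + product qs ≡ 1ℤ + + 3 * s × χ (+ product qs) ≡ W (i * s))
  product-value [] _ _ _ _ = 0ℤ , refl , trans χ-1 (cong W (sym (ℤ.*-zeroʳ i)))
  product-value (q ∷ qs) (q-prime ∷ qs-prime) 3∤ co β²≋
    with s , square , value ← prime-value q-prime
           (λ 3∣q → 3∤ (subst (+ 3 ∣_) (sym (ℤ.pos-* q (product qs))) (∣m⇒∣m*n (+ product qs) 3∣q)))
           (coprime-factorˡ (+ q) (+ product qs) (subst (Coprime (norm β)) (ℤ.pos-* q (product qs)) co))
           (≋E-factorˡ {+ q} {+ product qs} (subst (λ n → E/._≋_ n (β ⊗ β) (W i ⊗ (conj β ⊗ conj β))) (ℤ.pos-* q (product qs)) β²≋))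
    with t , square′ , value′ ← product-value qs qs-prime
           (λ 3∣P → 3∤ (subst (+ 3 ∣_) (sym (ℤ.pos-* q (product qs))) (∣n⇒∣m*n (+ q) 3∣P)))
           (coprime-factorʳ (+ q) (+ product qs) (subst (Coprime (norm β)) (ℤ.pos-* q (product qs)) co))
           (≋E-factorˡ {+ product qs} {+ q} (subst (λ n → E/._≋_ n (β ⊗ β) (W i ⊗ (conj β ⊗ conj β)))
             (trans (ℤ.pos-* q (product qs)) (ℤ.*-comm (+ q) (+ product qs))) β²≋))
    = s + t + + 3 * (s * t)
    , trans (cong (λ n → n * n) (ℤ.pos-* q (product qs))) (square-* {+ q} {+ product qs} {s} {t} square square′)
    , trans (cong χ (ℤ.pos-* q (product qs))) (trans (χ-* (+ q) (+ product qs)) (trans (cong₂ _⊗_ value value′)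
        (trans (sym (W-+ (i * s) (i * t))) (W-≋ {i = i * s + i * t} {j = i * (s + t + + 3 * (s * t))} (ℤ/.by (- (i * s * t)) (u i s t))))))
    where
    u : ∀ i s t → i * s + i * t ≡ i * (s + t + + 3 * (s * t)) + + 3 * (- (i * s * t))
    u = solve-∀

  value : ∀ a s → a * a ≡ 1ℤ + + 3 * s → ¬ + 3 ∣ a → Coprime (norm β) a →
    E/._≋_ a (β ⊗ β) (W i ⊗ (conj β ⊗ conj β)) → χ a ≡ W (i * s)
  value a s square 3∤a co β²≋ = go a s square 3∤a co β²≋
    where
    factored : ∀ {n} → PrimeFactorisation n → ∀ s → + n * + n ≡ 1ℤ + + 3 * s → ¬ + 3 ∣ + n →
      Coprime (norm β) (+ n) → E/._≋_ (+ n) (β ⊗ β) (W i ⊗ (conj β ⊗ conj β)) → χ (+ n) ≡ W (i * s)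
    factored record { factors = qs ; isFactorisation = refl ; factorsPrime = primes } s square 3∤ co β²≋
      with t , square′ , eq ← product-value qs primes 3∤ co β²≋
      = trans eq (cong (λ s → W (i * s)) (1+3*-injective (trans (sym square′) square)))
    positive : ∀ n s → + n * + n ≡ 1ℤ + + 3 * s → ¬ + 3 ∣ + n → Coprime (norm β) (+ n) →
      E/._≋_ (+ n) (β ⊗ β) (W i ⊗ (conj β ⊗ conj β)) → χ (+ n) ≡ W (i * s)
    positive zero    _ _ 3∤0 _ _ = contradiction (divides 0ℤ refl) 3∤0
    positive (suc n) = factored (factorise (suc n))
    go : ∀ a s → a * a ≡ 1ℤ + + 3 * s → ¬ + 3 ∣ a → Coprime (norm β) a →
      E/._≋_ a (β ⊗ β) (W i ⊗ (conj β ⊗ conj β)) → χ a ≡ W (i * s)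
    go (+ n) s = positive n s
    go -[1+ n ] s square 3∤a (bezout x y eq) (E/.by c eq′) = trans (sym (χ-neg -[1+ n ])) (positive (suc n) s square
      (λ 3∣n → 3∤a (∣m⇒∣-m 3∣n)) (bezout x (- y) (trans (cong (_+_ (norm β * x)) (p (+ suc n) y)) eq))
      (E/.by (⊝ c) (trans eq′ (cong (W i ⊗ (conj β ⊗ conj β) ⊕_) (r (ι (+ suc n)) c)))))
      where
      p : ∀ n y → n * (- y) ≡ - n * y
      p = solve-∀
      r : ∀ n c → ⊝ n ⊗ c ≡ n ⊗ ⊝ c
      r = RingSolver.solve-∀ E-solver

-- Existence of symbols for primary β, with the supplementary law (3 / a + 3bw) = w^(ab)

record PrimarySymbol (β : E) (e : ℤ) : Set where
  constructor _,_
  field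
    symbol : Symbol β
    χ-3    : Symbol.χ symbol (+ 3) ≡ W e

prime-∤-both : ∀ {l} → Prime l → ∀ a b → norm ⟨ a , b ⟩ ≡ + l → + l ∣ a → ¬ + l ∣ b
prime-∤-both {l} l-prime a b norm≡l (divides c a≡) (divides d b≡) = prime-∤1 l-prime (divides (c * c - c * d + d * d)
  (ℤ.*-cancelʳ-≡ 1ℤ ((c * c - c * d + d * d) * + l) (+ l) {{prime⇒nonZero l-prime}}
    (trans (ℤ.*-identityˡ (+ l)) (trans (sym norm≡l) (trans (cong₂ (λ a b → a * a - a * b + b * b) a≡ b≡) (p c d (+ l)))))))
  where
  p : ∀ c d l → c * l * (c * l) - c * l * (d * l) + d * l * (d * l) ≡ (c * c - c * d + d * d) * l * l
  p = solve-∀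

3∤-+3* : ∀ {u} → ¬ + 3 ∣ u → ∀ v → ¬ + 3 ∣ u + + 3 * v
3∤-+3* {u} 3∤u v (divides c eq) = 3∤u (divides (c - v) (trans (p u v) (trans (cong (_- + 3 * v) eq) (q c v))))
  where
  p : ∀ u v → u ≡ u + + 3 * v - + 3 * v
  p = solve-∀
  q : ∀ c v → c * + 3 - + 3 * v ≡ (c - v) * + 3
  q = solve-∀

-- Put A = u + 3v and B = u - 3v. Then β² - w² β̄² = A B (1 - w²), so the symbols of A and B are
-- known from the case i = 2. Moreover A² = -3 B² + 4 N(β), whence (3 / β) is the quotient of the
-- squares of these two symbols; its exponent comes from A² - B² = 12 u v.
supplementary : ∀ {l} → Prime l → l ≢ 3 → ∀ u v → ¬ + 3 ∣ u → norm ⟨ u , + 3 * v ⟩ ≡ + l →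
  (S : Symbol ⟨ u , + 3 * v ⟩) → Symbol.χ S (+ 3) ≡ W (u * v)
supplementary {l} l-prime l≢3 u v 3∤u norm≡l S
  with s , A² ← 3∤⇒square (3∤-+3* 3∤u v)
  with t , B² ← 3∤⇒square (3∤-+3* 3∤u (- v)) = begin
    χ (+ 3)                                          ≡⟨ E+.*-identityʳ (χ (+ 3)) ⟨
    χ (+ 3) ⊗ 1E                                     ≡⟨ cong (χ (+ 3) ⊗_) (W-⊗-neg (+ 4 * t)) ⟨
    χ (+ 3) ⊗ (W (+ 4 * t) ⊗ W (- (+ 4 * t)))        ≡⟨ ⊗-assoc (χ (+ 3)) (W (+ 4 * t)) _ ⟨
    χ (+ 3) ⊗ W (+ 4 * t) ⊗ W (- (+ 4 * t))          ≡⟨ cong (_⊗ W (- (+ 4 * t))) (relation s t A² B²) ⟩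
    W (+ 4 * s) ⊗ W (- (+ 4 * t))                    ≡⟨ W-+ (+ 4 * s) (- (+ 4 * t)) ⟨
    W (+ 4 * s - + 4 * t)                            ≡⟨ W-≋ {+ 4 * s - + 4 * t} {u * v} (ℤ/.by (+ 5 * (u * v)) (exponent s t A² B²)) ⟩
    W (u * v)                                        ∎
  where
  open ≡-Reasoning
  open Symbol S
  A B : ℤ
  A = u + + 3 * v
  B = u + + 3 * (- v)
  norm-B : ∀ u v → u * (+ 3 * v) ≡ u * u - u * (+ 3 * v) + + 3 * v * (+ 3 * v) - (u + + 3 * (- v)) * (u + + 3 * (- v))
  norm-B = solve-∀
  l∣norm : + l ∣ norm ⟨ u , + 3 * v ⟩
  l∣norm = divides 1ℤ (trans norm≡l (sym (ℤ.*-identityˡ (+ l))))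
  minus : ∀ {a b c} → + l ∣ a → + l ∣ b → a - b ≡ c → + l ∣ c
  minus l∣a l∣b eq = subst (+ l ∣_) eq (∣m∣n⇒∣m-n l∣a l∣b)
  plus : ∀ {a b c} → + l ∣ a → + l ∣ b → a + b ≡ c → + l ∣ c
  plus l∣a l∣b eq = subst (+ l ∣_) eq (∣m∣n⇒∣m+n l∣a l∣b)
  u∤⇒⊥ : + l ∣ u → ¬ + l ∣ + 3 * v
  u∤⇒⊥ = prime-∤-both l-prime u (+ 3 * v) norm≡l
  l∤A : ¬ + l ∣ A
  l∤A l∣A = case prime-∣* l-prime (+ 3) (u * (+ 3 * v)) (minus (∣m⇒∣m*n A l∣A) l∣norm (q u (+ 3 * v))) of λ
    { (inj₁ l∣3) → l≢3 (prime-∣3 l-prime l∣3)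
    ; (inj₂ l∣ub) → case prime-∣* l-prime u (+ 3 * v) l∣ub of λ
      { (inj₁ l∣u) → u∤⇒⊥ l∣u (minus l∣A l∣u (r u (+ 3 * v)))
      ; (inj₂ l∣b) → u∤⇒⊥ (minus l∣A l∣b (r′ u (+ 3 * v))) l∣b } }
    where
    q : ∀ u b → (u + b) * (u + b) - (u * u - u * b + b * b) ≡ + 3 * (u * b)
    q = solve-∀
    r : ∀ u b → u + b - u ≡ b
    r = solve-∀
    r′ : ∀ u b → u + b - b ≡ u
    r′ = solve-∀
  l∤B : ¬ + l ∣ B
  l∤B l∣B = case prime-∣* l-prime u (+ 3 * v) (minus l∣norm (∣m⇒∣m*n B l∣B) (sym (norm-B u v))) of λ
    { (inj₁ l∣u) → u∤⇒⊥ l∣u (minus l∣u l∣B (r u v))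
    ; (inj₂ l∣b) → u∤⇒⊥ (plus l∣B l∣b (r′ u v)) l∣b }
    where
    r : ∀ u v → u - (u + + 3 * (- v)) ≡ + 3 * v
    r = solve-∀
    r′ : ∀ u v → u + + 3 * (- v) + + 3 * v ≡ u
    r′ = solve-∀
  co : ∀ {a} → ¬ + l ∣ a → Coprime (norm ⟨ u , + 3 * v ⟩) a
  co {a} l∤a = subst (λ n → Coprime n a) (sym norm≡l) (prime-∤⇒coprime l-prime a l∤a)
  β² : ∀ x y → (x ⊕ w ⊗ y) ⊗ (x ⊕ w ⊗ y)
    ≡ W (+ 2) ⊗ ((x ⊕ w ⊗ w ⊗ y) ⊗ (x ⊕ w ⊗ w ⊗ y)) ⊕ (x ⊕ y) ⊗ (x ⊖ y) ⊗ (1E ⊖ w ⊗ w)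
  β² = RingSolver.solve-∀ E-solver
  β≡ = ⟨⟩-ι u (+ 3 * v)
  β̄≡ = conj-⟨⟩ u (+ 3 * v)
  c = 1E ⊖ w ⊗ w
  ιB : ι B ≡ ι u ⊖ ι (+ 3 * v)
  ιB = cong ι (p u v)
    where
    p : ∀ u v → u + + 3 * (- v) ≡ u + - (+ 3 * v)
    p = solve-∀
  expand : ⟨ u , + 3 * v ⟩ ⊗ ⟨ u , + 3 * v ⟩
    ≡ W (+ 2) ⊗ (conj ⟨ u , + 3 * v ⟩ ⊗ conj ⟨ u , + 3 * v ⟩) ⊕ ι A ⊗ ι B ⊗ c
  expand = trans (cong₂ _⊗_ β≡ β≡) (trans (β² (ι u) (ι (+ 3 * v)))
    (cong₂ (λ x y → W (+ 2) ⊗ (x ⊗ x) ⊕ ι A ⊗ y ⊗ c) (sym β̄≡) (sym ιB)))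
  open SymbolValue S (+ 2) using (value)
  χA : ∀ s → A * A ≡ 1ℤ + + 3 * s → χ A ≡ W (+ 2 * s)
  χA s A² = value A s A² (3∤-+3* 3∤u v) (co l∤A)
    (E/.by (ι B ⊗ c) (trans expand (cong (W (+ 2) ⊗ (conj ⟨ u , + 3 * v ⟩ ⊗ conj ⟨ u , + 3 * v ⟩) ⊕_) (⊗-assoc (ι A) (ι B) c))))
  χB : ∀ t → B * B ≡ 1ℤ + + 3 * t → χ B ≡ W (+ 2 * t)
  χB t B² = value B t B² (3∤-+3* 3∤u (- v)) (co l∤B)
    (E/.by (ι A ⊗ c) (trans expand (cong (W (+ 2) ⊗ (conj ⟨ u , + 3 * v ⟩ ⊗ conj ⟨ u , + 3 * v ⟩) ⊕_) (p (ι A) (ι B) c))))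
    where
    p : ∀ a b c → a ⊗ b ⊗ c ≡ b ⊗ (a ⊗ c)
    p = RingSolver.solve-∀ E-solver
  A²≋-3B² : ℤ/._≋_ (norm ⟨ u , + 3 * v ⟩) (A * A) (- (+ 3 * (B * B)))
  A²≋-3B² = ℤ/.by (+ 4) (p u v)
    where
    p : ∀ u v → (u + + 3 * v) * (u + + 3 * v) ≡ - (+ 3 * ((u + + 3 * (- v)) * (u + + 3 * (- v))))
      + (u * u - u * (+ 3 * v) + + 3 * v * (+ 3 * v)) * + 4
    p = solve-∀
  double : ∀ s → W (+ 4 * s) ≡ W (+ 2 * s) ⊗ W (+ 2 * s)
  double s = trans (cong W (p s)) (W-+ (+ 2 * s) (+ 2 * s))
    where
    p : ∀ s → + 4 * s ≡ + 2 * s + + 2 * s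
    p = solve-∀
  relation : ∀ s t → A * A ≡ 1ℤ + + 3 * s → B * B ≡ 1ℤ + + 3 * t → χ (+ 3) ⊗ W (+ 4 * t) ≡ W (+ 4 * s)
  relation s t A² B² = begin
    χ (+ 3) ⊗ W (+ 4 * t)                    ≡⟨ cong (χ (+ 3) ⊗_) (trans (double t) (cong₂ _⊗_ (sym (χB t B²)) (sym (χB t B²)))) ⟩
    χ (+ 3) ⊗ (χ B ⊗ χ B)                    ≡⟨ cong (χ (+ 3) ⊗_) (χ-* B B) ⟨
    χ (+ 3) ⊗ χ (B * B)                      ≡⟨ χ-* (+ 3) (B * B) ⟨
    χ (+ 3 * (B * B))                        ≡⟨ χ-neg (+ 3 * (B * B)) ⟨
    χ (- (+ 3 * (B * B)))                    ≡⟨ χ-≋ A²≋-3B² ⟨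
    χ (A * A)                                ≡⟨ χ-* A A ⟩
    χ A ⊗ χ A                                ≡⟨ cong₂ _⊗_ (χA s A²) (χA s A²) ⟩
    W (+ 2 * s) ⊗ W (+ 2 * s)                ≡⟨ double s ⟨
    W (+ 4 * s)                              ∎
  exponent : ∀ s t → A * A ≡ 1ℤ + + 3 * s → B * B ≡ 1ℤ + + 3 * t →
    + 4 * s - + 4 * t ≡ u * v + + 3 * (+ 5 * (u * v))
  exponent s t A² B² = trans (cong (λ s → + 4 * s - + 4 * t) (1+3*-injective {s} {t + + 4 * (u * v)}
    (trans (sym A²) (trans (p u v) (trans (cong (_+ + 3 * (+ 4 * (u * v))) B²) (q t (u * v))))))) (r t (u * v))
    where
    p : ∀ u v → (u + + 3 * v) * (u + + 3 * v) ≡ (u + + 3 * (- v)) * (u + + 3 * (- v)) + + 3 * (+ 4 * (u * v))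
    p = solve-∀
    q : ∀ t x → 1ℤ + + 3 * t + + 3 * (+ 4 * x) ≡ 1ℤ + + 3 * (t + + 4 * x)
    q = solve-∀
    r : ∀ t x → + 4 * (t + + 4 * x) - + 4 * t ≡ x + + 3 * (+ 5 * x)
    r = solve-∀

-- Descent on the norm

re-im-norm : ∀ {l} → Prime l → ∀ x → + l ∣ im x → + l ∣ norm x → + l ∣ re x
re-im-norm {l} l-prime ⟨ a , b ⟩ l∣b l∣norm = case prime-∣* l-prime a a l∣a² of λ
  { (inj₁ l∣a) → l∣a
  ; (inj₂ l∣a) → l∣a }
  where
  p : ∀ a b → a * a - a * b + b * b - b * (b - a) ≡ a * a
  p = solve-∀
  l∣a² : + l ∣ a * a
  l∣a² = subst (+ l ∣_) (p a b) (∣m∣n⇒∣m-n l∣norm (∣m⇒∣m*n (b - a) l∣b))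

ι-∣ : ∀ {l} x → + l ∣ re x → + l ∣ im x → ∃[ y ] x ≡ ι (+ l) ⊗ y
ι-∣ {l} ⟨ a , b ⟩ (divides c eq) (divides d eq′) = ⟨ c , d ⟩ , cong₂ ⟨_,_⟩ (trans eq (p c d (+ l))) (trans eq′ (q c d (+ l)))
  where
  p : ∀ c d l → c * l ≡ l * c - 0ℤ * d
  p = solve-∀
  q : ∀ c d l → d * l ≡ l * d + 0ℤ * c - 0ℤ * d
  q = solve-∀

⊗-cancel-norm : ∀ {l} → + l ≢ 0ℤ → ∀ {β γ π} → norm π ≡ + l → β ⊗ conj π ≡ ι (+ l) ⊗ γ → β ≡ γ ⊗ π
⊗-cancel-norm {l} l≢0 {β} {γ} {π} norm≡l eq = trans (r β (γ ⊗ π)) (trans (cong (_⊕ γ ⊗ π) (ι-cancel {+ l} l≢0 (begin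
  ι (+ l) ⊗ (β ⊖ γ ⊗ π)                     ≡⟨ p (ι (+ l)) β γ π ⟩
  β ⊗ ι (+ l) ⊖ ι (+ l) ⊗ γ ⊗ π             ≡⟨ cong (λ x → β ⊗ x ⊖ ι (+ l) ⊗ γ ⊗ π) (trans (⊗-conj π) (cong ι norm≡l)) ⟨
  β ⊗ (π ⊗ conj π) ⊖ ι (+ l) ⊗ γ ⊗ π        ≡⟨ cong (λ x → β ⊗ (π ⊗ conj π) ⊖ x ⊗ π) eq ⟨
  β ⊗ (π ⊗ conj π) ⊖ β ⊗ conj π ⊗ π         ≡⟨ q β π (conj π) ⟩
  0E                                        ∎))) (E+.+-identityˡ (γ ⊗ π)))
  where
  open ≡-Reasoning
  p : ∀ l b g π → l ⊗ (b ⊖ g ⊗ π) ≡ b ⊗ l ⊖ l ⊗ g ⊗ π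
  p = RingSolver.solve-∀ E-solver
  q : ∀ b π c → b ⊗ (π ⊗ c) ⊖ b ⊗ c ⊗ π ≡ 0E
  q = RingSolver.solve-∀ E-solver
  r : ∀ b x → b ≡ b ⊖ x ⊕ x
  r = RingSolver.solve-∀ E-solver

⊗-primarySymbol : ∀ {β γ e f} → PrimarySymbol β e → PrimarySymbol γ f → PrimarySymbol (β ⊗ γ) (e + f)
⊗-primarySymbol {e = e} {f} (S , p) (T , q) = ⊗-symbol S T , trans (cong₂ _⊗_ p q) (sym (W-+ e f))

conj-primarySymbol : ∀ {β e} → PrimarySymbol β e → PrimarySymbol (conj β) (- e)
conj-primarySymbol {e = e} (S , p) = conj-symbol S , trans (cong conj p) (sym (W-neg e))

cast-primarySymbol : ∀ {β γ e f} → β ≡ γ → ℤ/._≋_ (+ 3) e f → PrimarySymbol β e → PrimarySymbol γ f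
cast-primarySymbol {e = e} {f} refl e≋f (S , p) = S , trans p (W-≋ {e} {f} e≋f)

-- The primary prime above l ≡ 1 (mod 3) is found as a Jacobi sum.
record PrimeAbove (l : ℕ) : Set where
  field
    u v    : ℤ
    3∤u    : ¬ + 3 ∣ u
    norm≡l : norm ⟨ u , + 3 * v ⟩ ≡ + l
    symbol : PrimarySymbol ⟨ u , + 3 * v ⟩ (u * v)

conj-⟨3*⟩ : ∀ u v → conj ⟨ u , + 3 * v ⟩ ≡ ⟨ u + + 3 * (- v) , + 3 * (- v) ⟩
conj-⟨3*⟩ u v = cong₂ ⟨_,_⟩ (p u v) (q v)
  where
  p : ∀ u v → u - + 3 * v ≡ u + + 3 * (- v)
  p = solve-∀
  q : ∀ v → - (+ 3 * v) ≡ + 3 * (- v)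
  q = solve-∀

conj-primeAbove : ∀ {l} → PrimeAbove l → PrimeAbove l
conj-primeAbove P = record
  { u = u + + 3 * (- v) ; v = - v
  ; 3∤u = 3∤-+3* 3∤u (- v)
  ; norm≡l = trans (cong norm (sym (conj-⟨3*⟩ u v))) (trans (norm-conj ⟨ u , + 3 * v ⟩) norm≡l)
  ; symbol = cast-primarySymbol (conj-⟨3*⟩ u v) (ℤ/.by (- (v * v)) (p u v)) (conj-primarySymbol symbol) }
  where
  open PrimeAbove P
  p : ∀ u v → - (u * v) ≡ (u + + 3 * (- v)) * (- v) + + 3 * (- (v * v))
  p = solve-∀

primeAbove : ∀ {l} k → Prime l → l ≢ 3 → l ≡ 1 ℕ.+ 3 ℕ.* k → ∀ r → + l ∣ r * r + r + 1ℤ → PrimeAbove l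
primeAbove {l} k l-prime l≢3 l≡ r l∣ = go J-primary norm-J (J-symbol l-prime l≢3 X)
  where
  X = Character.cubicCharacter {k = k} l-prime l≡ r l∣
  open Gauss l-prime l≢3 X
  3∤u : ∀ c → ¬ + 3 ∣ -1ℤ + + 3 * c
  3∤u c = 3∤-+3* { -1ℤ} (λ 3∣-1 → prime-∤1 prime[3] (∣m⇒∣-m 3∣-1)) c
  build : ∀ {J} c d → J ≡ ⟨ -1ℤ + + 3 * c , + 3 * d ⟩ → norm J ≡ + l → Symbol J → PrimeAbove l
  build c d refl norm≡l S = record
    { u = -1ℤ + + 3 * c ; v = d ; 3∤u = 3∤u c ; norm≡l = norm≡l
    ; symbol = S , supplementary l-prime l≢3 (-1ℤ + + 3 * c) d (3∤u c) norm≡l S }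
  go : ∀ {J} → E/._≋_ (+ 3) J (⊝ 1E) → norm J ≡ + l → Symbol J → PrimeAbove l
  go (E/.by ⟨ c , d ⟩ eq) = build c d (trans eq (cong₂ ⟨_,_⟩ (p c d) (q c d)))
    where
    p : ∀ c d → -1ℤ + (+ 3 * c - 0ℤ * d) ≡ -1ℤ + + 3 * c
    p = solve-∀
    q : ∀ c d → 0ℤ + (+ 3 * d + 0ℤ * c - 0ℤ * d) ≡ + 3 * d
    q = solve-∀

-- The root is −a/b modulo l.
inverse-root : ∀ {l} → Prime l → ∀ a b → + l ∣ norm ⟨ a , b ⟩ → ¬ + l ∣ b → ∃[ r ] + l ∣ r * r + r + 1ℤ
inverse-root {l} l-prime a b l∣norm l∤b = go (prime-∤⇒coprime l-prime b l∤b)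
  where
  p : ∀ a b x y l → y * y * (a * a - a * b + b * b) + l * (x * (l * x + b * y + b * y - a * y))
    ≡ a * y * (a * y) - a * y * (l * x + b * y) + (l * x + b * y) * (l * x + b * y)
  p = solve-∀
  q : ∀ r → r * r - r * 1ℤ + 1ℤ * 1ℤ ≡ - r * - r + - r + 1ℤ
  q = solve-∀
  go : Coprime (+ l) b → ∃[ r ] + l ∣ r * r + r + 1ℤ
  go (bezout x y eq) = - (a * y) , subst (+ l ∣_)
    (trans (p a b x y (+ l)) (trans (cong (λ e → a * y * (a * y) - a * y * e + e * e) eq) (q (a * y))))
    (∣m∣n⇒∣m+n (∣n⇒∣m*n (y * y) l∣norm) (∣m⇒∣m*n (x * (+ l * x + b * y + b * y - a * y)) (divides 1ℤ (sym (ℤ.*-identityˡ (+ l))))))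

-- For l = 3k + 2, r³ ≡ 1 gives r^l ≡ r², whereas Fermat gives r^l ≡ r. So r ≡ 0 or 1 modulo l, and
-- r² + r + 1 ≡ 0 would make l divide 1 or 3.
root⇒3k+1 : ∀ {l} → Prime l → l ≢ 3 → ∀ r → + l ∣ r * r + r + 1ℤ → ∃[ k ] l ≡ 1 ℕ.+ 3 ℕ.* k
root⇒3k+1 {l} l-prime l≢3 r l∣ = case mod3 l of λ
  { (3k k l≡)   → contradiction (prime-3k k l-prime l≡) l≢3
  ; (3k+1 k l≡) → k , l≡
  ; (3k+2 k l≡) → case prime-∣* l-prime r (r - 1ℤ) (r²-r k l≡) of λ
    { (inj₁ l∣r)   → contradiction (subst (+ l ∣_) (q r) (∣m∣n⇒∣m-n l∣ (∣m⇒∣m*n (r + 1ℤ) l∣r))) (prime-∤1 l-prime)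
    ; (inj₂ l∣r-1) → contradiction (prime-∣3 l-prime (subst (+ l ∣_) (q′ r) (∣m∣n⇒∣m-n l∣ (∣m⇒∣m*n (r + + 2) l∣r-1)))) l≢3 } }
  where
  open ModE (+ l)
  q : ∀ r → r * r + r + 1ℤ - r * (r + 1ℤ) ≡ 1ℤ
  q = solve-∀
  q′ : ∀ r → r * r + r + 1ℤ - (r - 1ℤ) * (r + + 2) ≡ + 3
  q′ = solve-∀
  cube : ∀ r → r * r * r - 1ℤ ≡ (r - 1ℤ) * (r * r + r + 1ℤ)
  cube = solve-∀
  r³ : ι r ⊗ ι r ⊗ ι r ≋ 1E
  r³ = begin
    ι r ⊗ ι r ⊗ ι r     ≡⟨ trans (ι-* (r * r) r) (cong (_⊗ ι r) (ι-* r r)) ⟨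
    ι (r * r * r)       ≈⟨ ι-≋ (∣⇒≋ (subst (+ l ∣_) (sym (cube r)) (∣n⇒∣m*n (r - 1ℤ) l∣))) ⟩
    1E                  ∎
  r²-r : ∀ k → l ≡ 2 ℕ.+ 3 ℕ.* k → + l ∣ r * (r - 1ℤ)
  r²-r k l≡ = subst (+ l ∣_) (factor r) (≋⇒∣ (ι-≋⁻¹ {r * r} {r} (begin
    ι (r * r)                            ≡⟨ ι-* r r ⟩
    ι r ⊗ ι r                            ≡⟨ cong (ι r ⊗_) (E+.*-identityʳ (ι r)) ⟨
    ι r ⊗ (ι r ⊗ 1E)                     ≡⟨ cong (λ x → ι r ⊗ (ι r ⊗ x)) (1^ k) ⟨
    ι r ⊗ (ι r ⊗ 1E ^ᴱ k)                ≈⟨ ≋-*ˡ (≋-*ˡ (^-≋ k r³)) ⟨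
    ι r ⊗ (ι r ⊗ (ι r ⊗ ι r ⊗ ι r) ^ᴱ k) ≡⟨ cong (λ x → ι r ⊗ (ι r ⊗ x)) (^-3* (ι r) k) ⟩
    ι r ^ᴱ (2 ℕ.+ 3 ℕ.* k)               ≡⟨ cong (ι r ^ᴱ_) l≡ ⟨
    ι r ^ᴱ l                             ≈⟨ fermat l-prime r ⟩
    ι r                                  ∎)))
    where
    factor : ∀ r → r * r - r ≡ r * (r - 1ℤ)
    factor = solve-∀

square-∣∣ : ∀ i → i * i ≡ + (ℤ.∣ i ∣ ℕ.* ℤ.∣ i ∣)
square-∣∣ (+ n)    = sym (ℤ.pos-* n n)
square-∣∣ -[1+ n ] = refl

-- Completing the square, 4 N = (2a - 3b)² + 27 b² ≥ 27. The descent needs this in order to find a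
-- prime divisor of the norm.
norm-large : ∀ a b → b ≢ 0ℤ → 1 ℕ.< ℤ.∣ norm ⟨ a , + 3 * b ⟩ ∣
norm-large a b b≢0 = ℕ.≰⇒> λ small → ℕ.<⇒≱ {27} {5} (ℕ.≤-<-trans 27≤4N (ℕ.s≤s (ℕ.*-monoʳ-≤ 4 small))) (ℕ.m≤m+n 5 22)
  where
  x = ℤ.∣ + 2 * a - + 3 * b ∣
  y = ℤ.∣ b ∣
  p : ∀ a b → + 4 * (a * a - a * (+ 3 * b) + + 3 * b * (+ 3 * b)) ≡ (+ 2 * a - + 3 * b) * (+ 2 * a - + 3 * b) + + 27 * (b * b)
  p = solve-∀
  4N : 4 ℕ.* ℤ.∣ norm ⟨ a , + 3 * b ⟩ ∣ ≡ x ℕ.* x ℕ.+ 27 ℕ.* (y ℕ.* y)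
  4N = trans (sym (ℤ.abs-* (+ 4) (norm ⟨ a , + 3 * b ⟩))) (cong ℤ.∣_∣ (trans (p a b)
    (cong₂ _+_ (square-∣∣ (+ 2 * a - + 3 * b)) (trans (cong (+ 27 *_) (square-∣∣ b)) (sym (ℤ.pos-* 27 (y ℕ.* y)))))))
  y≢0 : ℕ.NonZero y
  y≢0 = ℕ.≢-nonZero (b≢0 ∘ ℤ.∣i∣≡0⇒i≡0)
  27≤4N : 27 ℕ.≤ 4 ℕ.* ℤ.∣ norm ⟨ a , + 3 * b ⟩ ∣
  27≤4N = subst (27 ℕ.≤_) (sym 4N) (ℕ.≤-trans (ℕ.m≤m*n 27 (y ℕ.* y) {{ℕ.m*n≢0 y y {{y≢0}} {{y≢0}}}}) (ℕ.m≤n+m (27 ℕ.* (y ℕ.* y)) (x ℕ.* x)))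

prime-divisor : ∀ n → 1 ℕ.< n → ∃[ q ] (Prime q × q ℕ∣.∣ n)
prime-divisor (suc n) 1<n = go (factorise (suc n)) 1<n
  where
  go : ∀ {n} → PrimeFactorisation n → 1 ℕ.< n → ∃[ q ] (Prime q × q ℕ∣.∣ n)
  go record { factors = [] ; isFactorisation = refl } (ℕ.s≤s ())
  go record { factors = q ∷ qs ; isFactorisation = refl ; factorsPrime = q-prime ∷ _ } _ = q , q-prime , ℕ∣.m∣m*n (product qs)

*-∣∣-< : ∀ {m n k} → n ≢ 0ℤ → n ≡ m * k → 1 ℕ.< ℤ.∣ k ∣ → ℤ.∣ m ∣ ℕ.< ℤ.∣ n ∣
*-∣∣-< {m} {n} {k} n≢0 n≡ 1<k = subst (ℤ.∣ m ∣ ℕ.<_) (sym (trans (cong ℤ.∣_∣ n≡) (ℤ.abs-* m k)))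
  (ℕ.m<m*n ℤ.∣ m ∣ ℤ.∣ k ∣ {{ℕ.≢-nonZero (m≢0 ∘ ℤ.∣i∣≡0⇒i≡0)}} 1<k)
  where
  m≢0 : m ≢ 0ℤ
  m≢0 m≡0 = n≢0 (trans n≡ (trans (cong (_* k) m≡0) (ℤ.*-zeroˡ k)))

1<prime : ∀ {l} → Prime l → 1 ℕ.< l
1<prime {l} l-prime = ℕ.nonTrivial⇒n>1 l {{prime⇒nonTrivial l-prime}}

-- The induction hypothesis of the descent on the norm.
Smaller : E → Set
Smaller β = ∀ g h → ¬ + 3 ∣ g → ℤ.∣ norm ⟨ g , + 3 * h ⟩ ∣ ℕ.< ℤ.∣ norm β ∣ → PrimarySymbol ⟨ g , + 3 * h ⟩ (g * h)

-- The norm of β π̄ is divisible by l, and its imaginary part is by assumption; hence so is its real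
-- part, and β = γ π with γ = β π̄ / l. Modulo 3, π is a rational unit, so γ is again primary; and a
-- b ≡ g h + u v because g² ≡ u² ≡ 1.
divide-prime : ∀ {l} → Prime l → (P : PrimeAbove l) → let open PrimeAbove P in
  ∀ a b → ¬ + 3 ∣ a → norm ⟨ a , + 3 * b ⟩ ≢ 0ℤ → Smaller ⟨ a , + 3 * b ⟩ →
  + l ∣ norm ⟨ a , + 3 * b ⟩ → + l ∣ im (⟨ a , + 3 * b ⟩ ⊗ conj ⟨ u , + 3 * v ⟩) →
  PrimarySymbol ⟨ a , + 3 * b ⟩ (a * b)
divide-prime {l} l-prime P a b 3∤a N≢0 smaller l∣N l∣im = quotient (ι-∣ {l} x (re-im-norm l-prime x l∣im l∣norm-x) l∣im)
  where
  open PrimeAbove P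
  β π x : E
  β = ⟨ a , + 3 * b ⟩
  π = ⟨ u , + 3 * v ⟩
  x = β ⊗ conj π
  l∣norm-x : + l ∣ norm x
  l∣norm-x = subst (+ l ∣_) (sym (norm-⊗ β (conj π))) (∣m⇒∣m*n (norm (conj π)) l∣N)
  l≢0 : + l ≢ 0ℤ
  l≢0 l≡0 = ¬prime[0] (subst Prime (ℤ.+-injective l≡0) l-prime)

  finish : ∀ g h → β ≡ ⟨ g , + 3 * h ⟩ ⊗ π → PrimarySymbol β (a * b)
  finish g h β≡ = cast-primarySymbol {e = g * h + u * v} {f = a * b} (sym β≡)
    (L.≋-sym (L.≋-trans (L.≋-reflexive (cong₂ _*_ a≡ b≡)) exponent))
    (⊗-primarySymbol (smaller g h 3∤g (*-∣∣-< {norm ⟨ g , + 3 * h ⟩} {norm β} {+ l} N≢0 N≡ (1<prime l-prime))) symbol)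
    where
    module L = ℤ/ (+ 3)
    N≡ : norm β ≡ norm ⟨ g , + 3 * h ⟩ * + l
    N≡ = trans (cong norm β≡) (trans (norm-⊗ ⟨ g , + 3 * h ⟩ π) (cong (norm ⟨ g , + 3 * h ⟩ *_) norm≡l))
    a≡ : a ≡ g * u - + 3 * h * (+ 3 * v)
    a≡ = cong re β≡
    3b≡ : + 3 * b ≡ g * (+ 3 * v) + + 3 * h * u - + 3 * h * (+ 3 * v)
    3b≡ = cong im β≡
    b≡ : b ≡ g * v + h * u - + 3 * h * v
    b≡ = ℤ.*-cancelˡ-≡ (+ 3) b _ (trans 3b≡ (p g h u v))
      where
      p : ∀ g h u v → g * (+ 3 * v) + + 3 * h * u - + 3 * h * (+ 3 * v) ≡ + 3 * (g * v + h * u - + 3 * h * v)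
      p = solve-∀
    3∤g : ¬ + 3 ∣ g
    3∤g (divides c g≡) = 3∤a (divides (c * u - h * (+ 3 * v)) (trans a≡ (trans (cong (λ g → g * u - + 3 * h * (+ 3 * v)) g≡) (p c h u v))))
      where
      p : ∀ c h u v → c * + 3 * u - + 3 * h * (+ 3 * v) ≡ (c * u - h * (+ 3 * v)) * + 3
      p = solve-∀
    square≋1 : ∀ {n} → ¬ + 3 ∣ n → n * n L.≋ 1ℤ
    square≋1 3∤n with s , eq ← 3∤⇒square 3∤n = L.by s eq
    exponent : (g * u - + 3 * h * (+ 3 * v)) * (g * v + h * u - + 3 * h * v) L.≋ g * h + u * v
    exponent = begin
      (g * u - + 3 * h * (+ 3 * v)) * (g * v + h * u - + 3 * h * v)
        ≈⟨ L.by (- (g * u * h * v) - + 3 * h * v * (g * v + h * u - + 3 * h * v)) (p g h u v) ⟩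
      g * g * (u * v) + u * u * (g * h)   ≈⟨ L.≋-+ (L.≋-*ʳ (square≋1 3∤g)) (L.≋-*ʳ (square≋1 3∤u)) ⟩
      1ℤ * (u * v) + 1ℤ * (g * h)         ≡⟨ q (u * v) (g * h) ⟩
      g * h + u * v                       ∎
      where
      open SetoidReasoning L.setoid
      p : ∀ g h u v → (g * u - + 3 * h * (+ 3 * v)) * (g * v + h * u - + 3 * h * v)
        ≡ g * g * (u * v) + u * u * (g * h) + + 3 * (- (g * u * h * v) - + 3 * h * v * (g * v + h * u - + 3 * h * v))
      p = solve-∀
      q : ∀ x y → 1ℤ * x + 1ℤ * y ≡ y + x
      q = solve-∀

  quotient : (∃[ y ] x ≡ ι (+ l) ⊗ y) → PrimarySymbol β (a * b)
  quotient (⟨ g , h ⟩ , eq) = case prime-∣* prime[3] h u 3∣hu of λ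
    { (inj₁ (divides h′ h≡)) → finish g h′ (trans β≡ (cong (λ h → ⟨ g , h ⟩ ⊗ π) (trans h≡ (ℤ.*-comm h′ (+ 3)))))
    ; (inj₂ 3∣u) → contradiction 3∣u 3∤u }
    where
    β≡ : β ≡ ⟨ g , h ⟩ ⊗ π
    β≡ = ⊗-cancel-norm l≢0 {β} {⟨ g , h ⟩} {π} norm≡l eq
    3∣hu : + 3 ∣ h * u
    3∣hu = divides (b - g * v + h * v) (trans (p g h u v) (trans (cong (λ e → e - g * (+ 3 * v) + h * (+ 3 * v)) (sym (cong im β≡))) (q b g h v)))
      where
      p : ∀ g h u v → h * u ≡ g * (+ 3 * v) + h * u - h * (+ 3 * v) - g * (+ 3 * v) + h * (+ 3 * v)
      p = solve-∀
      q : ∀ b g h v → + 3 * b - g * (+ 3 * v) + h * (+ 3 * v) ≡ (b - g * v + h * v) * + 3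
      q = solve-∀

-- A rational factor l has trivial symbol at 3, and dividing by it changes a b by the factor l² ≡ 1
-- modulo 3, so the exponent in the supplementary law is preserved.
divide-rational : ∀ {l} → Prime l → l ≢ 3 → ∀ a b → ¬ + 3 ∣ a → norm ⟨ a , + 3 * b ⟩ ≢ 0ℤ → Smaller ⟨ a , + 3 * b ⟩ →
  + l ∣ a → + l ∣ b → PrimarySymbol ⟨ a , + 3 * b ⟩ (a * b)
divide-rational {l} l-prime l≢3 a b 3∤a N≢0 smaller (divides c a≡) (divides d b≡) =
  cast-primarySymbol {e = 0ℤ + c * d} {f = a * b} (sym β≡) (L.≋-sym (L.≋-trans (L.≋-reflexive (cong₂ _*_ a≡ b≡)) exponent))
    (⊗-primarySymbol {e = 0ℤ} {c * d} (ι-symbol (+ l) , refl) (smaller c d 3∤c (*-∣∣-< {norm ⟨ c , + 3 * d ⟩} {norm ⟨ a , + 3 * b ⟩} {+ l * + l} N≢0 N≡ 1<l²)))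
  where
  module L = ℤ/ (+ 3)
  β≡ : ⟨ a , + 3 * b ⟩ ≡ ι (+ l) ⊗ ⟨ c , + 3 * d ⟩
  β≡ = cong₂ ⟨_,_⟩ (trans a≡ (p c d (+ l))) (trans (cong (+ 3 *_) b≡) (q c d (+ l)))
    where
    p : ∀ c d l → c * l ≡ l * c - 0ℤ * (+ 3 * d)
    p = solve-∀
    q : ∀ c d l → + 3 * (d * l) ≡ l * (+ 3 * d) + 0ℤ * c - 0ℤ * (+ 3 * d)
    q = solve-∀
  3∤l : ¬ + 3 ∣ + l
  3∤l 3∣l = case prime⇒irreducible l-prime (∣⇒∣ᵤ 3∣l) of λ
    { (inj₂ 3≡l) → l≢3 (sym 3≡l) }
  3∤c : ¬ + 3 ∣ c
  3∤c 3∣c = 3∤a (subst (+ 3 ∣_) (sym a≡) (∣m⇒∣m*n (+ l) 3∣c))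
  N≡ : norm ⟨ a , + 3 * b ⟩ ≡ norm ⟨ c , + 3 * d ⟩ * (+ l * + l)
  N≡ = trans (cong norm β≡) (trans (norm-⊗ (ι (+ l)) ⟨ c , + 3 * d ⟩) (trans (cong (_* norm ⟨ c , + 3 * d ⟩) (norm-ι (+ l))) (ℤ.*-comm (+ l * + l) (norm ⟨ c , + 3 * d ⟩))))
  1<l² : 1 ℕ.< ℤ.∣ + l * + l ∣
  1<l² = subst (1 ℕ.<_) (sym (ℤ.abs-* (+ l) (+ l))) (ℕ.≤-trans (1<prime l-prime) (ℕ.m≤m*n l l {{prime⇒nonZero l-prime}}))
  exponent : c * + l * (d * + l) L.≋ 0ℤ + c * d
  exponent with s , eq ← 3∤⇒square 3∤l = L.by (c * d * s) (trans (p c d (+ l)) (trans (cong (c * d *_) eq) (q c d s)))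
    where
    p : ∀ c d l → c * l * (d * l) ≡ c * d * (l * l)
    p = solve-∀
    q : ∀ c d s → c * d * (1ℤ + + 3 * s) ≡ 0ℤ + c * d + + 3 * (c * d * s)
    q = solve-∀

-- Let a prime l divide N(β). If l divides the imaginary part, it divides β. Otherwise -a/(3b) is a
-- root of r² + r + 1 modulo l, so l ≡ 1 (mod 3) and there is a Jacobi sum π of norm l. The product
-- of the imaginary parts of β π̄ and β π is a combination of N(π) and N(β), so l divides one of the
-- two, and π or π̄ can be split off.
primarySymbol : ∀ a b → ¬ + 3 ∣ a → PrimarySymbol ⟨ a , + 3 * b ⟩ (a * b)
primarySymbol a b = bounded (suc ℤ.∣ norm ⟨ a , + 3 * b ⟩ ∣) a b (ℕ.n<1+n _)
  where
  bounded : ∀ n a b → ℤ.∣ norm ⟨ a , + 3 * b ⟩ ∣ ℕ.< n → ¬ + 3 ∣ a → PrimarySymbol ⟨ a , + 3 * b ⟩ (a * b)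
  bounded (suc n) a b (ℕ.s≤s N≤n) 3∤a = rational? (b ℤ.≟ 0ℤ)
    where
    N = norm ⟨ a , + 3 * b ⟩
    smaller : Smaller ⟨ a , + 3 * b ⟩
    smaller g h 3∤g g<N = bounded n g h (ℕ.<-≤-trans g<N N≤n) 3∤g
    module _ (b≢0 : b ≢ 0ℤ) {l} (l-prime : Prime l) (l∣ᵤN : l ℕ∣.∣ ℤ.∣ N ∣) where
      l∣N : + l ∣ N
      l∣N = ∣ᵤ⇒∣ l∣ᵤN
      N≢0 : N ≢ 0ℤ
      N≢0 N≡0 = ℕ.<⇒≱ (norm-large a b b≢0) (subst (λ n → ℤ.∣ n ∣ ℕ.≤ 1) (sym N≡0) ℕ.z≤n)
      l≢3 : l ≢ 3
      l≢3 refl = case prime-∣* l-prime a a (subst (+ 3 ∣_) (p a b) (∣m∣n⇒∣m-n l∣N (∣m⇒∣m*n (- (a * b) + + 3 * b * b) (divides 1ℤ refl)))) of λ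
        { (inj₁ 3∣a) → 3∤a 3∣a
        ; (inj₂ 3∣a) → 3∤a 3∣a }
        where
        p : ∀ a b → a * a - a * (+ 3 * b) + + 3 * b * (+ 3 * b) - + 3 * (- (a * b) + + 3 * b * b) ≡ a * a
        p = solve-∀
      common : + l ∣ + 3 * b → PrimarySymbol ⟨ a , + 3 * b ⟩ (a * b)
      common l∣3b = case prime-∣* l-prime (+ 3) b l∣3b of λ
        { (inj₁ l∣3) → contradiction (prime-∣3 l-prime l∣3) l≢3
        ; (inj₂ l∣b) → divide-rational l-prime l≢3 a b 3∤a N≢0 smaller (re-im-norm l-prime ⟨ a , + 3 * b ⟩ l∣3b l∣N) l∣b }
      coprime : ¬ + l ∣ + 3 * b → PrimarySymbol ⟨ a , + 3 * b ⟩ (a * b)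
      coprime l∤3b = go (inverse-root l-prime a (+ 3 * b) l∣N l∤3b)
        where
        p : ∀ a b u v → b * b * (u * u - u * v + v * v) - v * v * (a * a - a * b + b * b)
          ≡ (a * (- v) + b * (u - v) - b * (- v)) * (a * v + b * u - b * v)
        p = solve-∀
        split : ∀ P → let open PrimeAbove P in
          + l ∣ (a * (- (+ 3 * v)) + + 3 * b * (u - + 3 * v) - + 3 * b * (- (+ 3 * v))) * (a * (+ 3 * v) + + 3 * b * u - + 3 * b * (+ 3 * v))
        split P = subst (+ l ∣_) (p a (+ 3 * b) u (+ 3 * v))
          (∣m∣n⇒∣m-n (∣n⇒∣m*n (+ 3 * b * (+ 3 * b)) (divides 1ℤ (trans norm≡l (sym (ℤ.*-identityˡ (+ l)))))) (∣n⇒∣m*n (+ 3 * v * (+ 3 * v)) l∣N))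
          where open PrimeAbove P
        use : PrimeAbove l → PrimarySymbol ⟨ a , + 3 * b ⟩ (a * b)
        use P = case prime-∣* l-prime _ _ (split P) of λ
          { (inj₁ l∣im) → divide-prime l-prime P a b 3∤a N≢0 smaller l∣N l∣im
          ; (inj₂ l∣im) → divide-prime l-prime (conj-primeAbove P) a b 3∤a N≢0 smaller l∣N
              (subst (λ π → + l ∣ im (⟨ a , + 3 * b ⟩ ⊗ π))
                (trans (sym (conj-involutive ⟨ PrimeAbove.u P , + 3 * PrimeAbove.v P ⟩)) (cong conj (conj-⟨3*⟩ (PrimeAbove.u P) (PrimeAbove.v P)))) l∣im) }
        go : ∃[ r ] + l ∣ r * r + r + 1ℤ → PrimarySymbol ⟨ a , + 3 * b ⟩ (a * b)
        go (r , l∣r) = case root⇒3k+1 l-prime l≢3 r l∣r of λ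
          { (k , l≡) → use (primeAbove k l-prime l≢3 l≡ r l∣r) }
      decide : Dec (+ l ∣ + 3 * b) → PrimarySymbol ⟨ a , + 3 * b ⟩ (a * b)
      decide (yes l∣3b) = common l∣3b
      decide (no l∤3b)  = coprime l∤3b
    rational? : Dec (b ≡ 0ℤ) → PrimarySymbol ⟨ a , + 3 * b ⟩ (a * b)
    rational? (yes refl) = ι-symbol a , cong W (sym (ℤ.*-zeroʳ a))
    rational? (no b≢0) = case prime-divisor ℤ.∣ N ∣ (norm-large a b b≢0) of λ
      { (l , l-prime , l∣N) → decide b≢0 l-prime l∣N (+ l ∣? + 3 * b) }

-- The Lucas sequence modulo p

coprime-neg : ∀ {a b} → Coprime a b → Coprime a (- b)
coprime-neg {a} {b} (bezout x y eq) = bezout x (- y) (trans (cong (_+_ (a * x)) (p b y)) eq)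
  where
  p : ∀ b y → - b * - y ≡ b * y
  p = solve-∀

-- An odd k would make p even and larger than 2. Evenness of k removes the sign from (-ᾱ)^k in
-- Binet's formula.
prime-3k+1-even : ∀ {p} k → Prime p → p ≡ 1 ℕ.+ 3 ℕ.* k → ∃[ j ] k ≡ 2 ℕ.* j
prime-3k+1-even {p} k p-prime p≡ = go (parity k)
  where
  parity : ∀ n → (∃[ j ] n ≡ 2 ℕ.* j) ⊎ (∃[ j ] n ≡ 1 ℕ.+ 2 ℕ.* j)
  parity zero = inj₁ (0 , refl)
  parity (suc n) = case parity n of λ
    { (inj₁ (j , n≡)) → inj₂ (j , cong suc n≡)
    ; (inj₂ (j , n≡)) → inj₁ (suc j , trans (cong suc n≡) (sym (ℕ.*-suc 2 j))) }
  odd : ∀ j → k ≡ 1 ℕ.+ 2 ℕ.* j → p ≡ 2 ℕ.* (2 ℕ.+ 3 ℕ.* j)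
  odd j k≡ = ℤ.+-injective (begin
    + p                              ≡⟨ cong +_ (trans p≡ (cong (λ k → 1 ℕ.+ 3 ℕ.* k) k≡)) ⟩
    1ℤ + + (3 ℕ.* (1 ℕ.+ 2 ℕ.* j))   ≡⟨ cong (_+_ 1ℤ) (trans (ℤ.pos-* 3 (1 ℕ.+ 2 ℕ.* j)) (cong (λ n → + 3 * (1ℤ + n)) (ℤ.pos-* 2 j))) ⟩
    1ℤ + + 3 * (1ℤ + + 2 * + j)      ≡⟨ q (+ j) ⟩
    + 2 * (+ 2 + + 3 * + j)          ≡⟨ trans (ℤ.pos-* 2 (2 ℕ.+ 3 ℕ.* j)) (cong (λ n → + 2 * (+ 2 + n)) (ℤ.pos-* 3 j)) ⟨
    + (2 ℕ.* (2 ℕ.+ 3 ℕ.* j))        ∎)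
    where
    open ≡-Reasoning
    q : ∀ j → 1ℤ + + 3 * (1ℤ + + 2 * j) ≡ + 2 * (+ 2 + + 3 * j)
    q = solve-∀
  go : (∃[ j ] k ≡ 2 ℕ.* j) ⊎ (∃[ j ] k ≡ 1 ℕ.+ 2 ℕ.* j) → ∃[ j ] k ≡ 2 ℕ.* j
  go (inj₁ even) = even
  go (inj₂ (j , k≡)) = case prime⇒irreducible p-prime {2} (ℕ∣.divides (2 ℕ.+ 3 ℕ.* j) (trans (odd j k≡) (ℕ.*-comm 2 (2 ℕ.+ 3 ℕ.* j)))) of λ
    { (inj₂ 2≡p) → contradiction (ℕ.*-cancelˡ-≡ 1 (2 ℕ.+ 3 ℕ.* j) 2 (trans 2≡p (odd j k≡))) λ () }

-- The element τ = z √−3 satisfies τ² ≡ α ᾱ and α − ᾱ = m τ, so that α/τ and −ᾱ/τ are the roots of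
-- X² − m X − 1.
module Core {p k : ℕ} (p-prime : Prime p) (p≡ : p ≡ 1 ℕ.+ 3 ℕ.* k)
  -- Here ν, M, y and z stand for n, m, y and 2y after removal of common factors. `mz≡2My` and `pν²`
  -- carry what is used of m² - d n² = -4 and p = x² + 3 d y², with d eliminated.
  (ν x M y z m : ℤ) (mz≡2My : m * z ≡ + 2 * M * y)
  (pν² : + p * (ν * ν) ≡ ν * ν * (x * x) + + 3 * (M * M) * (y * y) + + 3 * (z * z))
  (3∤ν : ¬ + 3 ∣ ν) (3∤z : ¬ + 3 ∣ z) (ν-z : Coprime ν z) (p-z : Coprime (+ p) z)
  (i a b : ℤ) (3∤a : ¬ + 3 ∣ a) (α≡ : ⟨ ν * x + M * y , + 2 * M * y ⟩ ≡ W i ⊗ ⟨ a , + 3 * b ⟩)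
  (s-z : ℤ) (z² : z * z ≡ 1ℤ + + 3 * s-z) (s-ν : ℤ) (ν² : ν * ν ≡ 1ℤ + + 3 * s-ν)
  where

  α β τ : E
  α = ⟨ ν * x + M * y , + 2 * M * y ⟩
  β = ⟨ a , + 3 * b ⟩
  τ = ι z ⊗ √-3

  private
    coprime-3 : ∀ {n} → ¬ + 3 ∣ n → Coprime n (+ 3)
    coprime-3 {n} 3∤n = coprime-sym (prime-∤⇒coprime prime[3] n 3∤n)

    3∤p : ¬ + 3 ∣ + p
    3∤p (divides c eq) = prime-∤1 prime[3] (divides (c - + k) (trans (q (+ k)) (trans (cong (_- + 3 * + k) (trans (sym p≡ℤ) eq)) (r c (+ k)))))
      where
      p≡ℤ : + p ≡ 1ℤ + + 3 * + k
      p≡ℤ = trans (cong +_ p≡) (cong (_+_ 1ℤ) (ℤ.pos-* 3 k))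
      q : ∀ k → 1ℤ ≡ 1ℤ + + 3 * k - + 3 * k
      q = solve-∀
      r : ∀ c k → c * + 3 - + 3 * k ≡ (c - k) * + 3
      r = solve-∀

  norm-α : norm α ≡ + p * (ν * ν) - + 3 * (z * z)
  norm-α = trans (q ν x M y) (trans (r (ν * ν * (x * x) + + 3 * (M * M) * (y * y)) (+ 3 * (z * z))) (cong (_- + 3 * (z * z)) (sym pν²)))
    where
    q : ∀ ν x M y → (ν * x + M * y) * (ν * x + M * y) - (ν * x + M * y) * (+ 2 * M * y) + + 2 * M * y * (+ 2 * M * y)
      ≡ ν * ν * (x * x) + + 3 * (M * M) * (y * y)
    q = solve-∀
    r : ∀ a b → a ≡ a + b - b
    r = solve-∀

  norm-β : norm β ≡ norm α
  norm-β = sym (trans (cong norm α≡) (trans (norm-⊗ (W i) β) (trans (cong (_* norm β) (norm-μ₃ (W-μ₃ i))) (ℤ.*-identityˡ (norm β)))))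
    where
    norm-μ₃ : ∀ {x} → μ₃ x → norm x ≡ 1ℤ
    norm-μ₃ one = refl
    norm-μ₃ ω   = refl
    norm-μ₃ ω²  = refl

  norm-≡ : norm β ≡ + p * (ν * ν) - + 3 * (z * z)
  norm-≡ = trans norm-β norm-α

  coprime-ν : Coprime (norm β) ν
  coprime-ν = coprime-sym (coprime-≋ {ν} { - (+ 3 * (z * z))} (ℤ/.by (- (+ p * ν)) (trans (q (+ p) ν z) (cong (_+ ν * (- (+ p * ν))) (sym norm-≡))))
    (coprime-neg (coprime-* (coprime-3 3∤ν) (coprime-* ν-z ν-z))))
    where
    q : ∀ p ν z → - (+ 3 * (z * z)) ≡ p * (ν * ν) - + 3 * (z * z) + ν * (- (p * ν))
    q = solve-∀

  coprime-z : Coprime (norm β) z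
  coprime-z = coprime-sym (coprime-≋ {z} {+ p * (ν * ν)} (ℤ/.by (+ 3 * z) (trans (q (+ p) ν z) (cong (_+ z * (+ 3 * z)) (sym norm-≡))))
    (coprime-* (coprime-sym p-z) (coprime-* (coprime-sym ν-z) (coprime-sym ν-z))))
    where
    q : ∀ p ν z → p * (ν * ν) ≡ p * (ν * ν) - + 3 * (z * z) + z * (+ 3 * z)
    q = solve-∀

  coprime-p : Coprime (+ p) (norm β)
  coprime-p = coprime-≋ {+ p} { - (+ 3 * (z * z))} (ℤ/.by (- (ν * ν)) (trans (q (+ p) ν z) (cong (_+ + p * (- (ν * ν))) (sym norm-≡))))
    (coprime-neg (coprime-* (coprime-3 3∤p) (coprime-* p-z p-z)))
    where
    q : ∀ p ν z → - (+ 3 * (z * z)) ≡ p * (ν * ν) - + 3 * (z * z) + p * (- (ν * ν))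
    q = solve-∀

  α-ᾱ : α ⊖ conj α ≡ ι m ⊗ τ
  α-ᾱ = cong₂ ⟨_,_⟩ (trans (q ν x M y) (trans (sym mz≡2My) (q′ m z))) (trans (r M y) (trans (cong (_*_ (+ 2)) (sym mz≡2My)) (r′ m z)))
    where
    q : ∀ ν x M y → ν * x + M * y + - (ν * x + M * y - + 2 * M * y) ≡ + 2 * M * y
    q = solve-∀
    q′ : ∀ m z → m * z ≡ m * (z * 1ℤ - 0ℤ * + 2) - 0ℤ * (z * + 2 + 0ℤ * 1ℤ - 0ℤ * + 2)
    q′ = solve-∀
    r : ∀ M y → + 2 * M * y + - (- (+ 2 * M * y)) ≡ + 2 * (+ 2 * M * y)
    r = solve-∀
    r′ : ∀ m z → + 2 * (m * z) ≡ m * (z * + 2 + 0ℤ * 1ℤ - 0ℤ * + 2) + 0ℤ * (z * 1ℤ - 0ℤ * + 2) - 0ℤ * (z * + 2 + 0ℤ * 1ℤ - 0ℤ * + 2)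
    r′ = solve-∀

  α+ᾱ : α ⊕ conj α ≡ ι (+ 2 * ν * x)
  α+ᾱ = cong₂ ⟨_,_⟩ (q ν x M y) (r M y)
    where
    q : ∀ ν x M y → ν * x + M * y + (ν * x + M * y - + 2 * M * y) ≡ + 2 * ν * x
    q = solve-∀
    r : ∀ M y → + 2 * M * y + - (+ 2 * M * y) ≡ 0ℤ
    r = solve-∀

  -- As β = w^(-i) α and β̄ = wⁱ ᾱ, the congruence α² ≡ ᾱ² modulo ν and z becomes β² ≡ w^(-4i) β̄².
  I : ℤ
  I = - (+ 4 * i)

  β-α : β ≡ W (- i) ⊗ α
  β-α = begin
    β                        ≡⟨ ⊗-identityˡ β ⟨
    1E ⊗ β                   ≡⟨ cong (_⊗ β) (trans (⊗-comm (W (- i)) (W i)) (W-⊗-neg i)) ⟨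
    W (- i) ⊗ W i ⊗ β        ≡⟨ ⊗-assoc (W (- i)) (W i) β ⟩
    W (- i) ⊗ (W i ⊗ β)      ≡⟨ cong (W (- i) ⊗_) α≡ ⟨
    W (- i) ⊗ α              ∎
    where open ≡-Reasoning

  β̄-ᾱ : conj β ≡ W i ⊗ conj α
  β̄-ᾱ = trans (cong conj β-α) (trans (conj-⊗ (W (- i)) α) (cong (_⊗ conj α)
    (trans (cong conj (W-neg i)) (conj-involutive (W i)))))

  -- β² − W I β̄² = W(−2i) (α² − ᾱ²), and α² − ᾱ² = (α − ᾱ)(α + ᾱ) is divisible by ν z.
  β²-β̄² : β ⊗ β ≡ W I ⊗ (conj β ⊗ conj β) ⊕ ι ν ⊗ ι z ⊗ (W (- i) ⊗ W (- i) ⊗ ι (+ 2 * x * m) ⊗ √-3)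
  β²-β̄² = begin
    β ⊗ β                                     ≡⟨ cong₂ _⊗_ β-α β-α ⟩
    u ⊗ α ⊗ (u ⊗ α)                           ≡⟨ q u α (conj α) ⟩
    u ⊗ u ⊗ (conj α ⊗ conj α) ⊕ u ⊗ u ⊗ ((α ⊖ conj α) ⊗ (α ⊕ conj α))
      ≡⟨ cong₂ (λ x y → u ⊗ u ⊗ (conj α ⊗ conj α) ⊕ u ⊗ u ⊗ (x ⊗ y)) α-ᾱ (trans α+ᾱ (trans (cong ι (2νx ν x)) (ι-* ν (+ 2 * x)))) ⟩
    u ⊗ u ⊗ (conj α ⊗ conj α) ⊕ u ⊗ u ⊗ (ι m ⊗ (ι z ⊗ √-3) ⊗ (ι ν ⊗ ι (+ 2 * x)))
      ≡⟨ cong₂ _⊕_ (trans (cong (_⊗ (conj α ⊗ conj α)) uu) (trans (r (W I) (W i) (conj α)) (cong₂ (λ a b → W I ⊗ (a ⊗ b)) (sym β̄-ᾱ) (sym β̄-ᾱ))))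
                   (trans (t u (ι m) (ι z) √-3 (ι ν) (ι (+ 2 * x))) (cong (λ e → ι ν ⊗ ι z ⊗ (u ⊗ u ⊗ e ⊗ √-3)) (sym (ι-* (+ 2 * x) m)))) ⟩
    W I ⊗ (conj β ⊗ conj β) ⊕ ι ν ⊗ ι z ⊗ (u ⊗ u ⊗ ι (+ 2 * x * m) ⊗ √-3) ∎
    where
    open ≡-Reasoning
    u = W (- i)
    2νx : ∀ ν x → + 2 * ν * x ≡ ν * (+ 2 * x)
    2νx = solve-∀
    q : ∀ u a c → u ⊗ a ⊗ (u ⊗ a) ≡ u ⊗ u ⊗ (c ⊗ c) ⊕ u ⊗ u ⊗ ((a ⊖ c) ⊗ (a ⊕ c))
    q = RingSolver.solve-∀ E-solver
    exponents : ∀ i → - i + - i ≡ - (+ 4 * i) + (i + i)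
    exponents = solve-∀
    uu : u ⊗ u ≡ W I ⊗ (W i ⊗ W i)
    uu = trans (sym (W-+ (- i) (- i))) (trans (cong W (exponents i)) (trans (W-+ I (i + i)) (cong (W I ⊗_) (W-+ i i))))
    r : ∀ v u c → v ⊗ (u ⊗ u) ⊗ (c ⊗ c) ≡ v ⊗ (u ⊗ c ⊗ (u ⊗ c))
    r = RingSolver.solve-∀ E-solver
    t : ∀ u m z s n x → u ⊗ u ⊗ (m ⊗ (z ⊗ s) ⊗ (n ⊗ x)) ≡ n ⊗ z ⊗ (u ⊗ u ⊗ (x ⊗ m) ⊗ s)
    t = RingSolver.solve-∀ E-solver

  open PrimarySymbol (primarySymbol a b 3∤a)
  open Symbol symbol

  private
    ζ = W (- i) ⊗ W (- i) ⊗ ι (+ 2 * x * m) ⊗ √-3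

  χ-ν : χ ν ≡ W (I * s-ν)
  χ-ν = SymbolValue.value symbol I ν s-ν ν² 3∤ν coprime-ν
    (E/.by (ι z ⊗ ζ) (trans β²-β̄² (cong (W I ⊗ (conj β ⊗ conj β) ⊕_) (⊗-assoc (ι ν) (ι z) ζ))))

  χ-z : χ z ≡ W (I * s-z)
  χ-z = SymbolValue.value symbol I z s-z z² 3∤z coprime-z
    (E/.by (ι ν ⊗ ζ) (trans β²-β̄² (cong (W I ⊗ (conj β ⊗ conj β) ⊕_) (q (ι ν) (ι z) ζ))))
    where
    q : ∀ a b c → a ⊗ b ⊗ c ≡ b ⊗ (a ⊗ c)
    q = RingSolver.solve-∀ E-solver

  -- Modulo N(β), p ν² ≡ 3 z², so the exponent of (p / β) is a b + 2 I (`s-z` - `s-ν`); and 2 I = -8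
  -- i ≡ i modulo 3.
  F : ℤ
  F = a * b + i * (s-z - s-ν)

  χ-p : χ (+ p) ≡ W F
  χ-p = begin
    χ (+ p)                                              ≡⟨ q (χ (+ p)) ⟩
    χ (+ p) ⊗ (1E ⊗ 1E)                                  ≡⟨ cong₂ (λ e f → χ (+ p) ⊗ (e ⊗ f)) (W-⊗-neg (I * s-ν)) (W-⊗-neg (I * s-ν)) ⟨
    χ (+ p) ⊗ (u ⊗ u′ ⊗ (u ⊗ u′))                        ≡⟨ r (χ (+ p)) u u′ ⟩
    χ (+ p) ⊗ (u ⊗ u) ⊗ (u′ ⊗ u′)                        ≡⟨ cong (_⊗ (u′ ⊗ u′)) relation ⟩
    W (a * b) ⊗ (v ⊗ v) ⊗ (u′ ⊗ u′)                      ≡⟨ cong₂ (λ e f → W (a * b) ⊗ e ⊗ f) (W-+ (I * s-z) (I * s-z)) (W-+ (- (I * s-ν)) (- (I * s-ν))) ⟨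
    W (a * b) ⊗ W (I * s-z + I * s-z) ⊗ W (- (I * s-ν) + - (I * s-ν))
      ≡⟨ trans (W-+ (a * b + (I * s-z + I * s-z)) (- (I * s-ν) + - (I * s-ν))) (cong (_⊗ W (- (I * s-ν) + - (I * s-ν))) (W-+ (a * b) (I * s-z + I * s-z))) ⟨
    W (a * b + (I * s-z + I * s-z) + (- (I * s-ν) + - (I * s-ν)))
      ≡⟨ W-≋ {a * b + (I * s-z + I * s-z) + (- (I * s-ν) + - (I * s-ν))} {F} (ℤ/.by (- (+ 3 * i * (s-z - s-ν))) (exponent (a * b) i s-z s-ν)) ⟩
    W F                                                  ∎
    where
    open ≡-Reasoning
    u = W (I * s-ν)
    u′ = W (- (I * s-ν))
    v = W (I * s-z)
    q : ∀ x → x ≡ x ⊗ (1E ⊗ 1E)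
    q = RingSolver.solve-∀ E-solver
    r : ∀ x u v → x ⊗ (u ⊗ v ⊗ (u ⊗ v)) ≡ x ⊗ (u ⊗ u) ⊗ (v ⊗ v)
    r = RingSolver.solve-∀ E-solver
    exponent : ∀ e i s t → e + (- (+ 4 * i) * s + - (+ 4 * i) * s) + (- (- (+ 4 * i) * t) + - (- (+ 4 * i) * t))
      ≡ e + i * (s - t) + + 3 * (- (+ 3 * i * (s - t)))
    exponent = solve-∀
    pν²≋3z² : ℤ/._≋_ (norm β) (+ p * (ν * ν)) (+ 3 * (z * z))
    pν²≋3z² = ℤ/.by 1ℤ (trans (t (+ p * (ν * ν)) (+ 3 * (z * z))) (cong (λ n → + 3 * (z * z) + n * 1ℤ) (sym norm-≡)))
      where
      t : ∀ a b → a ≡ b + (a - b) * 1ℤ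
      t = solve-∀
    relation : χ (+ p) ⊗ (u ⊗ u) ≡ W (a * b) ⊗ (v ⊗ v)
    relation = begin
      χ (+ p) ⊗ (u ⊗ u)         ≡⟨ cong₂ (λ e f → χ (+ p) ⊗ (e ⊗ f)) χ-ν χ-ν ⟨
      χ (+ p) ⊗ (χ ν ⊗ χ ν)     ≡⟨ trans (χ-* (+ p) (ν * ν)) (cong (χ (+ p) ⊗_) (χ-* ν ν)) ⟨
      χ (+ p * (ν * ν))         ≡⟨ χ-≋ pν²≋3z² ⟩
      χ (+ 3 * (z * z))         ≡⟨ trans (χ-* (+ 3) (z * z)) (cong (χ (+ 3) ⊗_) (χ-* z z)) ⟩
      χ (+ 3) ⊗ (χ z ⊗ χ z)     ≡⟨ cong₂ _⊗_ χ-3 (cong₂ _⊗_ χ-z χ-z) ⟩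
      W (a * b) ⊗ (v ⊗ v)       ∎

  open ModE (+ p)

  -- The law at p contains the factor N(β)^k, which is its own conjugate. Comparing the law with its
  -- conjugate eliminates it and leaves f β^k ≡ f̄ β̄^k, where f̄² = f.
  β^k : β ^ᴱ k ≋ W F ⊗ conj β ^ᴱ k
  β^k = begin
    β ^ᴱ k                                       ≡⟨ E+.*-identityʳ (β ^ᴱ k) ⟨
    β ^ᴱ k ⊗ 1E                                  ≈⟨ ≋-*ˡ reciprocity̅ ⟨
    β ^ᴱ k ⊗ (n ⊗ conj β ^ᴱ k ⊗ conj f)          ≡⟨ q (β ^ᴱ k) n (conj β ^ᴱ k) (conj f) ⟩
    n ⊗ β ^ᴱ k ⊗ 1E ⊗ (conj f ⊗ conj β ^ᴱ k)     ≡⟨ cong (λ e → n ⊗ β ^ᴱ k ⊗ e ⊗ (conj f ⊗ conj β ^ᴱ k)) (μ₃-⊗-conj μf) ⟨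
    n ⊗ β ^ᴱ k ⊗ (f ⊗ conj f) ⊗ (conj f ⊗ conj β ^ᴱ k)   ≡⟨ r (n ⊗ β ^ᴱ k) f (conj f) (conj β ^ᴱ k) ⟩
    n ⊗ β ^ᴱ k ⊗ f ⊗ (conj f ⊗ conj f ⊗ conj β ^ᴱ k)     ≈⟨ ≋-*ʳ reciprocity ⟩
    1E ⊗ (conj f ⊗ conj f ⊗ conj β ^ᴱ k)         ≡⟨ ⊗-identityˡ _ ⟩
    conj f ⊗ conj f ⊗ conj β ^ᴱ k                ≡⟨ cong (_⊗ conj β ^ᴱ k) (trans (sym (μ₃-conj≡² (μ₃-conj μf))) (conj-involutive f)) ⟩
    f ⊗ conj β ^ᴱ k                              ∎
    where
    n = ι (norm β) ^ᴱ k
    f = W F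
    μf = W-μ₃ F
    q : ∀ b n b′ c → b ⊗ (n ⊗ b′ ⊗ c) ≡ n ⊗ b ⊗ 1E ⊗ (c ⊗ b′)
    q = RingSolver.solve-∀ E-solver
    r : ∀ b f c b′ → b ⊗ (f ⊗ c) ⊗ (c ⊗ b′) ≡ b ⊗ f ⊗ (c ⊗ c ⊗ b′)
    r = RingSolver.solve-∀ E-solver
    κ^k : κ β ^ᴱ k ≡ n ⊗ β ^ᴱ k
    κ^k = trans (cong (_^ᴱ k) (trans (t β (conj β)) (cong (_⊗ β) (⊗-conj β)))) (E^.^-distrib-* (ι (norm β)) β k)
      where
      t : ∀ b c → b ⊗ b ⊗ c ≡ b ⊗ c ⊗ b
      t = RingSolver.solve-∀ E-solver
    reciprocity : n ⊗ β ^ᴱ k ⊗ f ≋ 1E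
    reciprocity = ≋-trans (≋-reflexive (cong₂ _⊗_ (sym κ^k) (sym χ-p))) (split k p-prime p≡ (coprime-sym coprime-p))
    reciprocity̅ : n ⊗ conj β ^ᴱ k ⊗ conj f ≋ 1E
    reciprocity̅ = ≋-trans (≋-reflexive (sym (trans (conj-⊗ (n ⊗ β ^ᴱ k) f) (cong (_⊗ conj f)
      (trans (conj-⊗ n (β ^ᴱ k)) (cong₂ _⊗_ (trans (conj-^ (ι (norm β)) k) (cong (_^ᴱ k) (conj-ι (norm β)))) (conj-^ β k))))))) (conj-≋ reciprocity)

  -- The exponent in α^k ≡ w^e ᾱ^k: one factor w^(ik) comes from α = wⁱ β and a second one from β̄ =
  -- wⁱ ᾱ.
  e : ℤ
  e = + 2 * + k * i + F

  A B T : E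
  A = α ^ᴱ k
  B = conj α ^ᴱ k
  T = τ ^ᴱ k

  A≋ : A ≋ W e ⊗ B
  A≋ = begin
    α ^ᴱ k                                     ≡⟨ trans (cong (_^ᴱ k) α≡) (E^.^-distrib-* (W i) β k) ⟩
    W i ^ᴱ k ⊗ β ^ᴱ k                          ≈⟨ ≋-*ˡ β^k ⟩
    W i ^ᴱ k ⊗ (W F ⊗ conj β ^ᴱ k)             ≡⟨ cong (λ x → W i ^ᴱ k ⊗ (W F ⊗ x)) (trans (cong (_^ᴱ k) β̄-ᾱ) (E^.^-distrib-* (W i) (conj α) k)) ⟩
    W i ^ᴱ k ⊗ (W F ⊗ (W i ^ᴱ k ⊗ B))          ≡⟨ q (W i ^ᴱ k) (W F) B ⟩
    W i ^ᴱ k ⊗ W i ^ᴱ k ⊗ W F ⊗ B              ≡⟨ cong (λ x → x ⊗ x ⊗ W F ⊗ B) (W-* i k) ⟨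
    W (+ k * i) ⊗ W (+ k * i) ⊗ W F ⊗ B        ≡⟨ cong (_⊗ B) (trans (W-+ (+ k * i + + k * i) F) (cong (_⊗ W F) (W-+ (+ k * i) (+ k * i)))) ⟨
    W (+ k * i + + k * i + F) ⊗ B              ≡⟨ cong (λ x → W x ⊗ B) (r (+ k) i F) ⟩
    W e ⊗ B                                    ∎
    where
    q : ∀ u f b → u ⊗ (f ⊗ (u ⊗ b)) ≡ u ⊗ u ⊗ f ⊗ b
    q = RingSolver.solve-∀ E-solver
    r : ∀ k i f → k * i + k * i + f ≡ + 2 * k * i + f
    r = solve-∀

  cube-^k : ∀ γ → Coprime (+ p) (norm γ) → γ ^ᴱ k ⊗ γ ^ᴱ k ⊗ γ ^ᴱ k ≋ 1E
  cube-^k γ co = ≋-cancelʳ {+ p} {γ} co (begin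
    γ ^ᴱ k ⊗ γ ^ᴱ k ⊗ γ ^ᴱ k ⊗ γ   ≡⟨ cong (λ x → x ⊗ γ ^ᴱ k ⊗ γ) (E^.^-distrib-* γ γ k) ⟨
    (γ ⊗ γ) ^ᴱ k ⊗ γ ^ᴱ k ⊗ γ      ≡⟨ cong (_⊗ γ) (E^.^-distrib-* (γ ⊗ γ) γ k) ⟨
    (γ ⊗ γ ⊗ γ) ^ᴱ k ⊗ γ           ≡⟨ trans (cong (_⊗ γ) (^-3* γ k)) (⊗-comm (γ ^ᴱ (3 ℕ.* k)) γ) ⟩
    γ ^ᴱ suc (3 ℕ.* k)             ≡⟨ cong (γ ^ᴱ_) p≡ ⟨
    γ ^ᴱ p                         ≈⟨ ^q-split p-prime {k} p≡ γ ⟩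
    γ                              ≡⟨ ⊗-identityˡ γ ⟨
    1E ⊗ γ                         ∎)

  B³ : B ⊗ B ⊗ B ≋ 1E
  B³ = cube-^k (conj α) (subst (Coprime (+ p)) (trans norm-β (sym (norm-conj α))) coprime-p)

  T³ : T ⊗ T ⊗ T ≋ 1E
  T³ = cube-^k τ (subst (Coprime (+ p)) (sym (trans (norm-⊗ (ι z) √-3) (cong (_* + 3) (norm-ι z))))
    (coprime-* (coprime-* p-z p-z) (coprime-3 3∤p)))

  τ² : τ ⊗ τ ≋ α ⊗ conj α
  τ² = begin
    τ ⊗ τ                      ≡⟨ q (ι z) ⟩
    ι z ⊗ ι z ⊗ ι (- (+ 3))    ≡⟨ trans (ι-* (z * z) (- (+ 3))) (cong (_⊗ ι (- (+ 3))) (ι-* z z)) ⟨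
    ι (z * z * - (+ 3))        ≈⟨ ι-≋ (ℤ/.by (- (ν * ν)) (trans (r (+ p) ν z) (cong (_+ + p * (- (ν * ν))) (sym norm-α)))) ⟩
    ι (norm α)                 ≡⟨ ⊗-conj α ⟨
    α ⊗ conj α                 ∎
    where
    q : ∀ x → x ⊗ √-3 ⊗ (x ⊗ √-3) ≡ x ⊗ x ⊗ ι (- (+ 3))
    q = RingSolver.solve-∀ E-solver
    r : ∀ p ν z → z * z * - (+ 3) ≡ p * (ν * ν) - + 3 * (z * z) + p * (- (ν * ν))
    r = solve-∀

  T² : T ⊗ T ≋ A ⊗ B
  T² = begin
    T ⊗ T                   ≡⟨ E^.^-distrib-* τ τ k ⟨
    (τ ⊗ τ) ^ᴱ k            ≈⟨ ^-≋ k τ² ⟩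
    (α ⊗ conj α) ^ᴱ k       ≡⟨ E^.^-distrib-* α (conj α) k ⟩
    A ⊗ B                   ∎

  -- Only T² ≡ A B ≡ w^e B² is known directly. As T³ ≡ 1, T ≡ (T²)², so the square root is
  -- determined without an ambiguity of sign.
  T≋ : T ≋ W e ⊗ W e ⊗ B
  T≋ = begin
    T                                       ≡⟨ E+.*-identityʳ T ⟨
    T ⊗ 1E                                  ≈⟨ ≋-*ˡ T³ ⟨
    T ⊗ (T ⊗ T ⊗ T)                         ≡⟨ q T ⟩
    T ⊗ T ⊗ (T ⊗ T)                         ≈⟨ ≋-* T²′ T²′ ⟩
    W e ⊗ B ⊗ B ⊗ (W e ⊗ B ⊗ B)             ≡⟨ r (W e) B ⟩
    W e ⊗ W e ⊗ B ⊗ (B ⊗ B ⊗ B)             ≈⟨ ≋-*ˡ B³ ⟩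
    W e ⊗ W e ⊗ B ⊗ 1E                      ≡⟨ E+.*-identityʳ _ ⟩
    W e ⊗ W e ⊗ B                           ∎
    where
    T²′ : T ⊗ T ≋ W e ⊗ B ⊗ B
    T²′ = ≋-trans T² (≋-*ʳ A≋)
    q : ∀ t → t ⊗ (t ⊗ t ⊗ t) ≡ t ⊗ t ⊗ (t ⊗ t)
    q = RingSolver.solve-∀ E-solver
    r : ∀ u b → u ⊗ b ⊗ b ⊗ (u ⊗ b ⊗ b) ≡ u ⊗ u ⊗ b ⊗ (b ⊗ b ⊗ b)
    r = RingSolver.solve-∀ E-solver

  V : ℕ → ℤ
  V n = U n m -1ℤ

  -- Binet's formula, multiplied through by τⁿ (α + ᾱ).
  binet : ∀ n → τ ^ᴱ n ⊗ ι (V n) ⊗ (α ⊕ conj α) ≋ τ ⊗ (α ^ᴱ n ⊖ (⊝ conj α) ^ᴱ n)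
  binet zero = ≋-reflexive (q (α ⊕ conj α) τ)
    where
    q : ∀ x t → 1E ⊗ 0E ⊗ x ≡ t ⊗ (1E ⊖ 1E)
    q = RingSolver.solve-∀ E-solver
  binet (suc zero) = ≋-reflexive (q α (conj α) τ)
    where
    q : ∀ a c t → t ⊗ 1E ⊗ 1E ⊗ (a ⊕ c) ≡ t ⊗ (a ⊗ 1E ⊖ ⊝ c ⊗ 1E)
    q = RingSolver.solve-∀ E-solver
  binet (suc (suc n)) = begin
    τ ⊗ (τ ⊗ t) ⊗ ι (V (suc (suc n))) ⊗ σ
      ≡⟨ cong (λ x → τ ⊗ (τ ⊗ t) ⊗ x ⊗ σ) recurrence ⟩
    τ ⊗ (τ ⊗ t) ⊗ (ι m ⊗ ι (V (suc n)) ⊕ ι (V n)) ⊗ σ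
      ≡⟨ q τ t (ι m) (ι (V (suc n))) (ι (V n)) σ ⟩
    ι m ⊗ τ ⊗ (τ ⊗ t ⊗ ι (V (suc n)) ⊗ σ) ⊕ τ ⊗ τ ⊗ (t ⊗ ι (V n) ⊗ σ)
      ≈⟨ ≋-+ (≋-* (≋-reflexive (sym α-ᾱ)) (binet (suc n))) (≋-* τ² (binet n)) ⟩
    (α ⊖ conj α) ⊗ (τ ⊗ (α ⊗ α ^ᴱ n ⊖ ⊝ conj α ⊗ c)) ⊕ α ⊗ conj α ⊗ (τ ⊗ (α ^ᴱ n ⊖ c))
      ≡⟨ r α (conj α) τ (α ^ᴱ n) c ⟩
    τ ⊗ (α ⊗ (α ⊗ α ^ᴱ n) ⊖ ⊝ conj α ⊗ (⊝ conj α ⊗ c)) ∎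
    where
    t = τ ^ᴱ n
    c = (⊝ conj α) ^ᴱ n
    σ = α ⊕ conj α
    p-1 : ∀ m v u → m * v - -1ℤ * u ≡ m * v + u
    p-1 = solve-∀
    recurrence : ι (V (suc (suc n))) ≡ ι m ⊗ ι (V (suc n)) ⊕ ι (V n)
    recurrence = trans (cong ι (p-1 m (V (suc n)) (V n))) (cong (_⊕ ι (V n)) (ι-* m (V (suc n))))
    q : ∀ τ t m v u σ → τ ⊗ (τ ⊗ t) ⊗ (m ⊗ v ⊕ u) ⊗ σ ≡ m ⊗ τ ⊗ (τ ⊗ t ⊗ v ⊗ σ) ⊕ τ ⊗ τ ⊗ (t ⊗ u ⊗ σ)
    q = RingSolver.solve-∀ E-solver
    r : ∀ a b τ c d → (a ⊖ b) ⊗ (τ ⊗ (a ⊗ c ⊖ ⊝ b ⊗ d)) ⊕ a ⊗ b ⊗ (τ ⊗ (c ⊖ d)) ≡ τ ⊗ (a ⊗ (a ⊗ c) ⊖ ⊝ b ⊗ (⊝ b ⊗ d))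
    r = RingSolver.solve-∀ E-solver

  ⊝-^k : (⊝ conj α) ^ᴱ k ≡ B
  ⊝-^k = case prime-3k+1-even k p-prime p≡ of λ { (j , k≡) →
      trans (cong ((⊝ conj α) ^ᴱ_) k≡) (trans (sym (E^.^-assocʳ (⊝ conj α) 2 j)) (trans (cong (_^ᴱ j) (q (conj α)))
        (trans (E^.^-assocʳ (conj α) 2 j) (cong (conj α ^ᴱ_) (sym k≡))))) }
    where
    q : ∀ x → ⊝ x ⊗ (⊝ x ⊗ 1E) ≡ x ⊗ (x ⊗ 1E)
    q = RingSolver.solve-∀ E-solver

  -- The unit 1 ≡ w^(3e) B³ is split as w^e B² times w^(2e) B. The second factor is T, which is what
  -- Binet's formula has on its left side; the first, multiplied by A - B ≡ (w^e - 1) B, leaves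
  -- w^(2e) - w^e.
  lucas : ι (V k * (+ 2 * ν * x)) ≋ τ ⊗ (conj (W e) ⊖ W e)
  lucas = begin
    ι (V k * (+ 2 * ν * x))                           ≡⟨ trans (ι-* (V k) (+ 2 * ν * x)) (cong (ι (V k) ⊗_) (sym α+ᾱ)) ⟩
    ι (V k) ⊗ σ                                       ≡⟨ ⊗-identityˡ _ ⟨
    1E ⊗ (ι (V k) ⊗ σ)                                ≡⟨ cong (_⊗ (ι (V k) ⊗ σ)) (μ₃-³ (W-μ₃ e)) ⟨
    u ⊗ u ⊗ u ⊗ (ι (V k) ⊗ σ)                         ≡⟨ E+.*-identityʳ _ ⟨
    u ⊗ u ⊗ u ⊗ (ι (V k) ⊗ σ) ⊗ 1E                    ≈⟨ ≋-*ˡ B³ ⟨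
    u ⊗ u ⊗ u ⊗ (ι (V k) ⊗ σ) ⊗ (B ⊗ B ⊗ B)           ≡⟨ q u (ι (V k)) σ B ⟩
    u ⊗ B ⊗ B ⊗ (u ⊗ u ⊗ B ⊗ ι (V k) ⊗ σ)             ≈⟨ ≋-*ˡ (≋-*ʳ (≋-*ʳ T≋)) ⟨
    u ⊗ B ⊗ B ⊗ (T ⊗ ι (V k) ⊗ σ)                     ≈⟨ ≋-*ˡ (binet k) ⟩
    u ⊗ B ⊗ B ⊗ (τ ⊗ (A ⊖ (⊝ conj α) ^ᴱ k))           ≡⟨ cong (λ x → u ⊗ B ⊗ B ⊗ (τ ⊗ (A ⊖ x))) ⊝-^k ⟩
    u ⊗ B ⊗ B ⊗ (τ ⊗ (A ⊖ B))                         ≈⟨ ≋-*ˡ (≋-*ˡ (≋-+ʳ A≋)) ⟩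
    u ⊗ B ⊗ B ⊗ (τ ⊗ (u ⊗ B ⊖ B))                     ≡⟨ r u B τ ⟩
    τ ⊗ (u ⊗ u ⊖ u) ⊗ (B ⊗ B ⊗ B)                     ≈⟨ ≋-*ˡ B³ ⟩
    τ ⊗ (u ⊗ u ⊖ u) ⊗ 1E                              ≡⟨ E+.*-identityʳ _ ⟩
    τ ⊗ (u ⊗ u ⊖ u)                                   ≡⟨ cong (λ x → τ ⊗ (x ⊖ u)) (μ₃-conj≡² (W-μ₃ e)) ⟨
    τ ⊗ (conj u ⊖ u)                                  ∎
    where
    u = W e
    σ = α ⊕ conj α
    q : ∀ u v σ b → u ⊗ u ⊗ u ⊗ (v ⊗ σ) ⊗ (b ⊗ b ⊗ b) ≡ u ⊗ b ⊗ b ⊗ (u ⊗ u ⊗ b ⊗ v ⊗ σ)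
    q = RingSolver.solve-∀ E-solver
    r : ∀ u b τ → u ⊗ b ⊗ b ⊗ (τ ⊗ (u ⊗ b ⊖ b)) ≡ τ ⊗ (u ⊗ u ⊖ u) ⊗ (b ⊗ b ⊗ b)
    r = RingSolver.solve-∀ E-solver

  lucas-value : ∀ {r} c → conj (W r) ⊖ W r ≡ ⊝ (ι c ⊗ √-3) → ℤ/._≋_ (+ 3) e r →
    ℤ/._≋_ (+ p) (V k * (+ 2 * ν * x)) (+ 3 * c * z)
  lucas-value {r} c eq e≋r = ι-≋⁻¹ (begin
    ι (V k * (+ 2 * ν * x))          ≈⟨ lucas ⟩
    τ ⊗ (conj (W e) ⊖ W e)           ≡⟨ cong (λ u → τ ⊗ (conj u ⊖ u)) (W-≋ {e} {r} e≋r) ⟩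
    τ ⊗ (conj (W r) ⊖ W r)           ≡⟨ cong (τ ⊗_) eq ⟩
    τ ⊗ ⊝ (ι c ⊗ √-3)                ≡⟨ q (ι z) (ι c) ⟩
    ι (+ 3) ⊗ ι c ⊗ ι z              ≡⟨ trans (ι-* (+ 3 * c) z) (cong (_⊗ ι z) (ι-* (+ 3) c)) ⟨
    ι (+ 3 * c * z)                  ∎)
    where
    q : ∀ z c → z ⊗ √-3 ⊗ ⊝ (c ⊗ √-3) ≡ ι (+ 3) ⊗ c ⊗ z
    q = RingSolver.solve-∀ E-solver

-- The residue of the Lucas number

≋-cancelℤ : ∀ {m a} → Coprime m a → ∀ {b c} → ℤ/._≋_ m (a * b) (a * c) → ℤ/._≋_ m b c
≋-cancelℤ {m} {a} co {b} {c} ab≋ac = ∣⇒≋ (coprime-∣ co (b - c) (subst (m ∣_) (p a b c) (≋⇒∣ ab≋ac)))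
  where
  p : ∀ a b c → a * b - a * c ≡ a * (b - c)
  p = solve-∀

-- The balanced residues modulo 3, which are also the values of the Legendre symbol.
data Sign : ℤ → Set where
  null  : Sign 0ℤ
  plus  : Sign 1ℤ
  minus : Sign -1ℤ

conj-W-sign : ∀ {r} → Sign r → conj (W r) ⊖ W r ≡ ⊝ (ι r ⊗ √-3)
conj-W-sign null  = refl
conj-W-sign plus  = refl
conj-W-sign minus = refl

3∤-* : ∀ {a b} → ¬ + 3 ∣ a → ¬ + 3 ∣ b → ¬ + 3 ∣ a * b
3∤-* {a} {b} 3∤a 3∤b 3∣ab = case prime-∣* prime[3] a b 3∣ab of λ
  { (inj₁ 3∣a) → 3∤a 3∣a
  ; (inj₂ 3∣b) → 3∤b 3∣b }

square⇒3∤ : ∀ {a s} → a * a ≡ 1ℤ + + 3 * s → ¬ + 3 ∣ a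
square⇒3∤ {a} {s} a² (divides c a≡) = prime-∤1 prime[3] (divides (c * a - s)
  (trans (p s) (trans (cong (_- + 3 * s) (trans (sym a²) (cong (_* a) a≡))) (q c a s))))
  where
  p : ∀ s → 1ℤ ≡ 1ℤ + + 3 * s - + 3 * s
  p = solve-∀
  q : ∀ c a s → c * + 3 * a - + 3 * s ≡ (c * a - s) * + 3
  q = solve-∀

prime-3k+1-∤2 : ∀ {p k} → Prime p → p ≡ 1 ℕ.+ 3 ℕ.* k → ¬ + p ∣ + 2
prime-3k+1-∤2 {p} {k} p-prime p≡ p∣2 = go k p≡
  where
  go : ∀ k → p ≢ 1 ℕ.+ 3 ℕ.* k
  go zero    p≡1 = ¬prime[1] (subst Prime p≡1 p-prime)
  go (suc k) p≡  = ℕ.<⇒≱ {2} {4} (ℕ.m≤m+n 3 1) (ℕ.≤-trans (subst (4 ℕ.≤_) (sym (trans p≡ (cong suc (ℕ.*-suc 3 k)))) (ℕ.m≤m+n 4 (3 ℕ.* k))) (ℕ∣.∣⇒≤ (∣⇒∣ᵤ p∣2)))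

-- The common factors of n and y are removed; the factor c = 2 of m and n is removed when m is even.
module Reduced {p k : ℕ} (p-prime : Prime p) (p≡ : p ≡ 1 ℕ.+ 3 ℕ.* k)
  (d m n x y : ℤ) (m² : m * m - d * (n * n) ≡ - (+ 4)) (p≡x²+3dy² : + p ≡ x * x + + 3 * d * (y * y))
  (3∤y : ¬ + 3 ∣ y) (3∤n : ¬ + 3 ∣ n) (x≋y : ℤ/._≋_ (+ 3) x y) (p∤y : ¬ + p ∣ y) (n≢0 : n ≢ 0ℤ)
  -- The pair (c , t) will be (1 , 2) or (2 , 1). One of the squares is 1 and the other 4 = 1 + 3,
  -- so `s-c+s-t` holds in both cases and they can be treated together.
  (c t s-c s-t : ℤ) (ct≡2 : c * t ≡ + 2) (c² : c * c ≡ 1ℤ + + 3 * s-c) (t² : t * t ≡ 1ℤ + + 3 * s-t) (s-c+s-t : s-c + s-t ≡ 1ℤ)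
  (M ν h y′ : ℤ) (m≡ : m ≡ c * M) (n≡ : n ≡ c * ν * h) (y≡ : y ≡ y′ * h) (ν-z : Coprime ν (t * y′))
  where

  private
    z = t * y′
    module P = ℤ/ (+ p)
    module T = ℤ/ (+ 3)
    module TR = CommutativeRing T.ring

  3∤c : ¬ + 3 ∣ c
  3∤c = square⇒3∤ {c} {s-c} c²

  3∤y′ : ¬ + 3 ∣ y′
  3∤y′ 3∣y′ = 3∤y (subst (+ 3 ∣_) (sym y≡) (∣m⇒∣m*n h 3∣y′))

  3∤z : ¬ + 3 ∣ z
  3∤z = 3∤-* {t} {y′} (square⇒3∤ {t} {s-t} t²) 3∤y′

  3∤ν : ¬ + 3 ∣ ν
  3∤ν 3∣ν = 3∤n (subst (+ 3 ∣_) (sym n≡) (∣m⇒∣m*n h (∣n⇒∣m*n c 3∣ν)))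

  3∤x : ¬ + 3 ∣ x
  3∤x 3∣x = 3∤y (≋0⇒∣ (T.≋-trans (T.≋-sym x≋y) (∣⇒≋0 3∣x)))

  coprime-2 : Coprime (+ p) (+ 2)
  coprime-2 = prime-∤⇒coprime p-prime (+ 2) (prime-3k+1-∤2 {k = k} p-prime p≡)

  coprime-3 : Coprime (+ p) (+ 3)
  coprime-3 = prime-∤⇒coprime p-prime (+ 3) λ p∣3 → p≢3 k (trans (sym (prime-∣3 p-prime p∣3)) p≡)
    where
    p≢3 : ∀ k → 3 ≢ 1 ℕ.+ 3 ℕ.* k
    p≢3 zero ()
    p≢3 (suc k) eq with trans eq (cong suc (ℕ.*-suc 3 k))
    ... | ()

  coprime-z : Coprime (+ p) z
  coprime-z = coprime-* {b = t} {c = y′}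
    (coprime-factorʳ c t (subst (Coprime (+ p)) (sym ct≡2) coprime-2))
    (coprime-factorˡ y′ h (subst (Coprime (+ p)) y≡ (prime-∤⇒coprime p-prime y p∤y)))

  mz≡2My′ : m * z ≡ + 2 * M * y′
  mz≡2My′ = trans (cong (_* z) m≡) (trans (q c t M y′) (cong (λ e → e * M * y′) ct≡2))
    where
    q : ∀ c t M y → c * M * (t * y) ≡ c * t * M * y
    q = solve-∀

  pν² : + p * (ν * ν) ≡ ν * ν * (x * x) + + 3 * (M * M) * (y′ * y′) + + 3 * (z * z)
  -- Multiplication by (c h)² restores n and y, and then d n² = m² + 4 gives p n² = n² x² + 3 y² (m²
  -- + 4).
  pν² = ℤ.*-cancelʳ-≡ _ _ (g * g) {{ℤ.≢-nonZero g²≢0}} (begin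
    + p * (ν * ν) * (g * g)                         ≡⟨ q₁ (+ p) ν c h ⟩
    + p * (c * ν * h * (c * ν * h))                 ≡⟨ cong₂ (λ p n → p * (n * n)) p≡x²+3dy² (sym n≡) ⟩
    (x * x + + 3 * d * (y * y)) * (n * n)           ≡⟨ q₂ x d y n ⟩
    n * n * (x * x) + + 3 * (y * y) * (d * (n * n))  ≡⟨ cong (λ e → n * n * (x * x) + + 3 * (y * y) * e) dn² ⟩
    n * n * (x * x) + + 3 * (y * y) * (m * m + + 2 * + 2)
      ≡⟨ cong₂ (λ n y → n * n * (x * x) + + 3 * (y * y) * (m * m + + 2 * + 2)) n≡ y≡ ⟩
    c * ν * h * (c * ν * h) * (x * x) + + 3 * (y′ * h * (y′ * h)) * (m * m + + 2 * + 2)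
      ≡⟨ cong₂ (λ m e → c * ν * h * (c * ν * h) * (x * x) + + 3 * (y′ * h * (y′ * h)) * (m * m + e * e)) m≡ (sym ct≡2) ⟩
    c * ν * h * (c * ν * h) * (x * x) + + 3 * (y′ * h * (y′ * h)) * (c * M * (c * M) + c * t * (c * t))
      ≡⟨ q₃ c t M ν h x y′ ⟩
    (ν * ν * (x * x) + + 3 * (M * M) * (y′ * y′) + + 3 * (z * z)) * (g * g) ∎)
    where
    open ≡-Reasoning
    g = c * h
    q₁ : ∀ p ν c h → p * (ν * ν) * (c * h * (c * h)) ≡ p * (c * ν * h * (c * ν * h))
    q₁ = solve-∀
    q₂ : ∀ x d y n → (x * x + + 3 * d * (y * y)) * (n * n) ≡ n * n * (x * x) + + 3 * (y * y) * (d * (n * n))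
    q₂ = solve-∀
    q₃ : ∀ c t M ν h x y → c * ν * h * (c * ν * h) * (x * x) + + 3 * (y * h * (y * h)) * (c * M * (c * M) + c * t * (c * t))
      ≡ (ν * ν * (x * x) + + 3 * (M * M) * (y * y) + + 3 * (t * y * (t * y))) * (c * h * (c * h))
    q₃ = solve-∀
    q₄ : ∀ e f → f ≡ e - (e - f)
    q₄ = solve-∀
    dn² : d * (n * n) ≡ m * m + + 2 * + 2
    dn² = trans (q₄ (m * m) (d * (n * n))) (cong (_-_ (m * m)) m²)
    q₅ : ∀ c ν h → c * ν * h ≡ c * h * ν
    q₅ = solve-∀
    g≢0 : g ≢ 0ℤ
    g≢0 g≡0 = n≢0 (trans n≡ (trans (q₅ c ν h) (trans (cong (_* ν) g≡0) (ℤ.*-zeroˡ ν))))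
    g²≢0 : g * g ≢ 0ℤ
    g²≢0 eq = case ℤ.i*j≡0⇒i≡0∨j≡0 g eq of λ
      { (inj₁ g≡0) → g≢0 g≡0
      ; (inj₂ g≡0) → g≢0 g≡0 }

  V : ℤ
  V = U k m -1ℤ

  -- The conclusion with its denominator cleared; `divide` inverts d n y at the end.
  Residue : ℤ → Set
  Residue r = d * n * y * V P.≋ - (r * x)

  -- Restoring the common factors gives n x V ≡ 3 r y. Multiplying by x and using x² ≡ -3 d y²
  -- produces the factor -3 y on both sides, which is invertible modulo p.
  residue : ∀ r → V * (+ 2 * ν * x) P.≋ + 3 * r * z → Residue r
  residue r V≋ = ≋-cancelℤ {+ p} { - (+ 3 * y)} (coprime-neg (coprime-* coprime-3 (prime-∤⇒coprime p-prime y p∤y))) (begin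
    - (+ 3 * y) * (d * n * y * V)      ≡⟨ q₁ y d n V ⟩
    - (+ 3 * d * (y * y)) * (n * V)    ≈⟨ P.≋-*ʳ {n * V} x² ⟨
    x * x * (n * V)                    ≡⟨ q₂ x n V ⟩
    x * (n * x * V)                    ≈⟨ P.≋-*ˡ {x} nxV ⟩
    x * (+ 3 * r * y)                  ≡⟨ q₃ x r y ⟩
    - (+ 3 * y) * (- (r * x))          ∎)
    where
    open SetoidReasoning P.setoid
    q₁ : ∀ y d n v → - (+ 3 * y) * (d * n * y * v) ≡ - (+ 3 * d * (y * y)) * (n * v)
    q₁ = solve-∀
    q₂ : ∀ x n v → x * x * (n * v) ≡ x * (n * x * v)
    q₂ = solve-∀
    q₃ : ∀ x r y → x * (+ 3 * r * y) ≡ - (+ 3 * y) * (- (r * x))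
    q₃ = solve-∀
    x² : x * x P.≋ - (+ 3 * d * (y * y))
    x² = P.by 1ℤ (trans (q (x * x) (+ 3 * d * (y * y))) (cong (λ e → - (+ 3 * d * (y * y)) + e * 1ℤ) (sym p≡x²+3dy²)))
      where
      q : ∀ a b → a ≡ - b + (a + b) * 1ℤ
      q = solve-∀
    nxV : n * x * V P.≋ + 3 * r * y
    nxV = ≋-cancelℤ coprime-2 (begin
      + 2 * (n * x * V)                 ≡⟨ cong (λ n → + 2 * (n * x * V)) n≡ ⟩
      + 2 * (c * ν * h * x * V)         ≡⟨ q₄ c ν h x V ⟩
      c * h * (V * (+ 2 * ν * x))       ≈⟨ P.≋-*ˡ {c * h} V≋ ⟩
      c * h * (+ 3 * r * (t * y′))      ≡⟨ q₅ c t h r y′ ⟩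
      c * t * (+ 3 * r * (y′ * h))      ≡⟨ cong₂ (λ e y → e * (+ 3 * r * y)) ct≡2 (sym y≡) ⟩
      + 2 * (+ 3 * r * y)               ∎)
      where
      q₄ : ∀ c ν h x v → + 2 * (c * ν * h * x * v) ≡ c * h * (v * (+ 2 * ν * x))
      q₄ = solve-∀
      q₅ : ∀ c t h r y → c * h * (+ 3 * r * (t * y)) ≡ c * t * (+ 3 * r * (y * h))
      q₅ = solve-∀

  -- 3 ∣ m: α is itself primary.
  residue-3∣m : ∀ m′ → m ≡ + 3 * m′ → ∀ {r} → Sign r → r T.≋ + 2 * m′ * n → Residue r
  residue-3∣m m′ m≡3m′ {r} sign r≋ = case prime-∣* prime[3] c M (divides m′ (trans (sym m≡) (trans m≡3m′ (ℤ.*-comm (+ 3) m′)))) of λ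
    { (inj₁ 3∣c) → contradiction 3∣c 3∤c
    ; (inj₂ (divides M′ M≡)) → go M′ (trans M≡ (ℤ.*-comm M′ (+ 3))) }
    where
    go : ∀ M′ → M ≡ + 3 * M′ → Residue r
    go M′ M≡ = residue r (lucas-value r (conj-W-sign sign) e≋r)
      where
      a b : ℤ
      a = ν * x + M * y′
      b = + 2 * M′ * y′
      3∤a : ¬ + 3 ∣ a
      3∤a = subst (λ e → ¬ + 3 ∣ ν * x + e) (trans (sym (ℤ.*-assoc (+ 3) M′ y′)) (cong (_* y′) (sym M≡))) (3∤-+3* (3∤-* {ν} {x} 3∤ν 3∤x) (M′ * y′))
      α≡ : ⟨ a , + 2 * M * y′ ⟩ ≡ W 0ℤ ⊗ ⟨ a , + 3 * b ⟩
      α≡ = trans (cong (λ M → ⟨ a , + 2 * M * y′ ⟩) M≡) (trans (cong (λ e → ⟨ a , e ⟩) (q M′ y′)) (sym (⊗-identityˡ ⟨ a , + 3 * b ⟩)))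
        where
        q : ∀ M y → + 2 * (+ 3 * M) * y ≡ + 3 * (+ 2 * M * y)
        q = solve-∀
      z-square = 3∤⇒square 3∤z
      ν-square = 3∤⇒square 3∤ν
      open Core {k = k} p-prime p≡ ν x M y′ z m mz≡2My′ pν² 3∤ν 3∤z ν-z coprime-z 0ℤ a b 3∤a α≡
        (proj₁ z-square) (proj₂ z-square) (proj₁ ν-square) (proj₂ ν-square) using (e; lucas-value)
      m′≡ : m′ ≡ c * M′
      m′≡ = ℤ.*-cancelˡ-≡ (+ 3) m′ (c * M′) (trans (sym m≡3m′) (trans m≡ (trans (cong (c *_) M≡) (q c M′))))
        where
        q : ∀ c M → c * (+ 3 * M) ≡ + 3 * (c * M)
        q = solve-∀
      e≋r : e T.≋ r
      -- With i = 0 the exponent e is a b ≡ 2 M′ y′ ν x modulo 3; x ≡ y = y′ h and y′² ≡ c² ≡ 1 turn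
      -- this into 2 m′ n.
      e≋r = T.≋-sym (T.≋-trans r≋ (begin
        + 2 * m′ * n                                  ≡⟨ cong₂ (λ m n → + 2 * m * n) m′≡ n≡ ⟩
        + 2 * (c * M′) * (c * ν * h)                  ≡⟨ q₁ c M′ ν h ⟩
        c * c * (+ 2 * M′ * ν * h)                    ≈⟨ T.≋-*ʳ {+ 2 * M′ * ν * h} c²≋1 ⟩
        1ℤ * (+ 2 * M′ * ν * h)                       ≈⟨ T.≋-*ʳ {+ 2 * M′ * ν * h} y′²≋1 ⟨
        y′ * y′ * (+ 2 * M′ * ν * h)                  ≡⟨ q₂ y′ M′ ν h ⟩
        + 2 * M′ * y′ * ν * (y′ * h)                  ≡⟨ cong (+ 2 * M′ * y′ * ν *_) y≡ ⟨
        + 2 * M′ * y′ * ν * y                         ≈⟨ T.≋-*ˡ {+ 2 * M′ * y′ * ν} x≋y ⟨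
        + 2 * M′ * y′ * ν * x                         ≈⟨ T.by (- (+ 2 * M′ * M′ * y′ * y′)) (q₃ M′ y′ ν x (+ k) (proj₁ z-square - proj₁ ν-square)) ⟩
        + 2 * + k * 0ℤ + ((ν * x + + 3 * M′ * y′) * (+ 2 * M′ * y′) + 0ℤ * (proj₁ z-square - proj₁ ν-square))
          ≡⟨ cong (λ M → + 2 * + k * 0ℤ + ((ν * x + M * y′) * (+ 2 * M′ * y′) + 0ℤ * (proj₁ z-square - proj₁ ν-square))) M≡ ⟨
        e                                             ∎))
        where
        open SetoidReasoning T.setoid
        c²≋1 : c * c T.≋ 1ℤ
        c²≋1 = T.by s-c c²
        y′²≋1 : y′ * y′ T.≋ 1ℤ
        y′²≋1 = T.by (proj₁ (3∤⇒square 3∤y′)) (proj₂ (3∤⇒square 3∤y′))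
        q₁ : ∀ c M ν h → + 2 * (c * M) * (c * ν * h) ≡ c * c * (+ 2 * M * ν * h)
        q₁ = solve-∀
        q₂ : ∀ y M ν h → y * y * (+ 2 * M * ν * h) ≡ + 2 * M * y * ν * (y * h)
        q₂ = solve-∀
        q₃ : ∀ M y ν x k s → + 2 * M * y * ν * x
          ≡ + 2 * k * 0ℤ + ((ν * x + + 3 * M * y) * (+ 2 * M * y) + 0ℤ * s) + + 3 * (- (+ 2 * M * M * y * y))
        q₃ = solve-∀

  -- 3 ∣ m + n: α / w is primary.
  residue-3∣m+n : ¬ + 3 ∣ m → + 3 ∣ n + m → ∀ s-m → m * m ≡ 1ℤ + + 3 * s-m → ∀ {r} → Sign r → r T.≋ -1ℤ - s-m → Residue r
  residue-3∣m+n 3∤m 3∣n+m s-m m-square {r} sign r≋ = go (≋0⇒∣ νx+My′≋0)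
    where
    3∤M : ¬ + 3 ∣ M
    3∤M 3∣M = 3∤m (subst (+ 3 ∣_) (sym m≡) (∣n⇒∣m*n c 3∣M))
    νh+M≋0 : ν * h + M T.≋ 0ℤ
    νh+M≋0 = ≋-cancelℤ (prime-∤⇒coprime prime[3] c 3∤c) {ν * h + M} {0ℤ}
      (T.≋-trans (T.≋-reflexive (trans (q c ν h M) (cong₂ _+_ (sym n≡) (sym m≡)))) (T.≋-trans (∣⇒≋0 3∣n+m) (T.≋-reflexive (sym (ℤ.*-zeroʳ c)))))
      where
      q : ∀ c ν h M → c * (ν * h + M) ≡ c * ν * h + c * M
      q = solve-∀
    νx+My′≋0 : ν * x + M * y′ T.≋ 0ℤ
    νx+My′≋0 = begin
      ν * x + M * y′            ≈⟨ TR.+-congʳ {M * y′} (T.≋-*ˡ {ν} x≋y) ⟩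
      ν * y + M * y′            ≡⟨ cong (λ y → ν * y + M * y′) y≡ ⟩
      ν * (y′ * h) + M * y′     ≡⟨ q ν y′ h M ⟩
      y′ * (ν * h + M)          ≈⟨ T.≋-*ˡ {y′} νh+M≋0 ⟩
      y′ * 0ℤ                   ≡⟨ ℤ.*-zeroʳ y′ ⟩
      0ℤ                        ∎
      where
      open SetoidReasoning T.setoid
      q : ∀ ν y h M → ν * (y * h) + M * y ≡ y * (ν * h + M)
      q = solve-∀
    go : + 3 ∣ ν * x + M * y′ → Residue r
    go (divides A A≡) = residue r (lucas-value r (conj-W-sign sign) e≋r)
      where
      -- Comparison of coefficients in w (a + 3b w) = -3b + (a - 3b) w, where α has coefficients 3A
      -- and 2 M y′.
      a b : ℤ
      a = + 2 * M * y′ + + 3 * (- A)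
      b = - A
      3∤a : ¬ + 3 ∣ a
      3∤a = 3∤-+3* (3∤-* {+ 2 * M} {y′} (3∤-* {+ 2} {M} (λ 3∣2 → ℕ.<⇒≱ {2} {3} ℕ.≤-refl (ℕ∣.∣⇒≤ (∣⇒∣ᵤ 3∣2))) 3∤M) 3∤y′) (- A)
      α≡ : ⟨ ν * x + M * y′ , + 2 * M * y′ ⟩ ≡ W 1ℤ ⊗ ⟨ a , + 3 * b ⟩
      α≡ = cong₂ ⟨_,_⟩ (trans A≡ (q₁ A (+ 2 * M * y′))) (q₂ A (+ 2 * M * y′))
        where
        q₁ : ∀ A B → A * + 3 ≡ 0ℤ * (B + + 3 * (- A)) - 1ℤ * (+ 3 * (- A))
        q₁ = solve-∀
        q₂ : ∀ A B → B ≡ 0ℤ * (+ 3 * (- A)) + 1ℤ * (B + + 3 * (- A)) - 1ℤ * (+ 3 * (- A))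
        q₂ = solve-∀
      z-square = 3∤⇒square 3∤z
      ν-square = 3∤⇒square 3∤ν
      y-square = 3∤⇒square 3∤y′
      M-square = 3∤⇒square 3∤M
      s-z = proj₁ z-square
      s-ν = proj₁ ν-square
      s-y = proj₁ y-square
      s-M = proj₁ M-square
      open Core {k = k} p-prime p≡ ν x M y′ z m mz≡2My′ pν² 3∤ν 3∤z ν-z coprime-z 1ℤ a b 3∤a α≡
        s-z (proj₂ z-square) s-ν (proj₂ ν-square) using (e; lucas-value)
      s-m≡ : s-m ≡ s-c + s-M + + 3 * (s-c * s-M)
      s-m≡ = 1+3*-injective (trans (sym m-square) (trans (cong (λ m → m * m) m≡) (square-* {c} {M} {s-c} {s-M} c² (proj₂ M-square))))
      s-z≡ : s-z ≡ s-t + s-y + + 3 * (s-t * s-y)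
      s-z≡ = 1+3*-injective (trans (sym (proj₂ z-square)) (square-* {t} {y′} {s-t} {s-y} t² (proj₂ y-square)))
      s-μ = s-M + s-y + + 3 * (s-M * s-y)
      -- p ν² = (3A − My′)² + 3M²y′² + 3z², read modulo 9.
      k+s-ν : + k + s-ν + + 3 * (+ k * s-ν) ≡ + 3 * (A * A) - + 2 * (A * (M * y′)) + + 2 + + 4 * s-μ + + 3 * s-z
      k+s-ν = 1+3*-injective (begin
        1ℤ + + 3 * (+ k + s-ν + + 3 * (+ k * s-ν))        ≡⟨ q₁ (+ k) s-ν ⟩
        (1ℤ + + 3 * + k) * (1ℤ + + 3 * s-ν)               ≡⟨ cong₂ _*_ (trans (cong +_ p≡) (cong (_+_ 1ℤ) (ℤ.pos-* 3 k))) (proj₂ ν-square) ⟨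
        + p * (ν * ν)                                     ≡⟨ pν² ⟩
        ν * ν * (x * x) + + 3 * (M * M) * (y′ * y′) + + 3 * (z * z)   ≡⟨ q₂ ν x M y′ (z * z) ⟩
        (ν * x + M * y′) * (ν * x + M * y′) - + 2 * ((ν * x + M * y′) * (M * y′)) + + 4 * (M * M * (y′ * y′)) + + 3 * (z * z)
          ≡⟨ cong₂ (λ u v → u * u - + 2 * (u * (M * y′)) + + 4 * v + + 3 * (z * z)) A≡ (cong₂ _*_ (proj₂ M-square) (proj₂ y-square)) ⟩
        A * + 3 * (A * + 3) - + 2 * (A * + 3 * (M * y′)) + + 4 * ((1ℤ + + 3 * s-M) * (1ℤ + + 3 * s-y)) + + 3 * (z * z)
          ≡⟨ cong (λ v → A * + 3 * (A * + 3) - + 2 * (A * + 3 * (M * y′)) + + 4 * ((1ℤ + + 3 * s-M) * (1ℤ + + 3 * s-y)) + + 3 * v) (proj₂ z-square) ⟩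
        A * + 3 * (A * + 3) - + 2 * (A * + 3 * (M * y′)) + + 4 * ((1ℤ + + 3 * s-M) * (1ℤ + + 3 * s-y)) + + 3 * (1ℤ + + 3 * s-z)
          ≡⟨ q₃ A (M * y′) s-M s-y s-z ⟩
        1ℤ + + 3 * (+ 3 * (A * A) - + 2 * (A * (M * y′)) + + 2 + + 4 * s-μ + + 3 * s-z) ∎)
        where
        open ≡-Reasoning
        q₁ : ∀ s t → 1ℤ + + 3 * (s + t + + 3 * (s * t)) ≡ (1ℤ + + 3 * s) * (1ℤ + + 3 * t)
        q₁ = solve-∀
        q₂ : ∀ ν x M y z² → ν * ν * (x * x) + + 3 * (M * M) * (y * y) + + 3 * z²
          ≡ (ν * x + M * y) * (ν * x + M * y) - + 2 * ((ν * x + M * y) * (M * y)) + + 4 * (M * M * (y * y)) + + 3 * z²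
        q₂ = solve-∀
        q₃ : ∀ A B s t u → A * + 3 * (A * + 3) - + 2 * (A * + 3 * B) + + 4 * ((1ℤ + + 3 * s) * (1ℤ + + 3 * t)) + + 3 * (1ℤ + + 3 * u)
          ≡ 1ℤ + + 3 * (+ 3 * (A * A) - + 2 * (A * B) + + 2 + + 4 * (s + t + + 3 * (s * t)) + + 3 * u)
        q₃ = solve-∀
      e≋r : e T.≋ r
      -- Here i = 1, and k and `s-ν` enter e only through -(k + `s-ν`) modulo 3. Substituting
      -- `k+s-ν` cancels the terms in A, `s-z≡` cancels `s-y`, and `s-c+s-t` leaves 2 - `s-m`: the
      -- exponent depends on m alone.
      e≋r = T.≋-trans (begin
        + 2 * + k * 1ℤ + ((+ 2 * M * y′ + + 3 * (- A)) * (- A) + 1ℤ * (s-z - s-ν))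
          ≡⟨ q₁ (+ k) M y′ A s-z s-ν ⟩
        + 3 * + k + + 3 * (A * A) + + 3 * (+ k * s-ν) - (+ k + s-ν + + 3 * (+ k * s-ν)) - + 2 * (A * (M * y′)) + s-z
          ≡⟨ cong (λ u → + 3 * + k + + 3 * (A * A) + + 3 * (+ k * s-ν) - u - + 2 * (A * (M * y′)) + s-z) k+s-ν ⟩
        + 3 * + k + + 3 * (A * A) + + 3 * (+ k * s-ν) - (+ 3 * (A * A) - + 2 * (A * (M * y′)) + + 2 + + 4 * s-μ + + 3 * s-z) - + 2 * (A * (M * y′)) + s-z
          ≈⟨ T.by (+ k + + k * s-ν - 1ℤ - s-μ - s-z) (q₂ (+ k) A (M * y′) s-ν s-μ s-z) ⟩
        1ℤ - s-μ + s-z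
          ≡⟨ cong (λ u → 1ℤ - s-μ + u) s-z≡ ⟩
        1ℤ - s-μ + (s-t + s-y + + 3 * (s-t * s-y))
          ≈⟨ T.by (s-t * s-y - s-M * s-y + s-c * s-M) (q₃ s-M s-y s-t s-c) ⟩
        1ℤ + (s-c + s-t) - (s-c + s-M + + 3 * (s-c * s-M))
          ≡⟨ cong₂ (λ u v → 1ℤ + u - v) s-c+s-t (sym s-m≡) ⟩
        1ℤ + 1ℤ - s-m
          ≈⟨ T.by 1ℤ (q₄ s-m) ⟩
        -1ℤ - s-m ∎) (T.≋-sym r≋)
        where
        open SetoidReasoning T.setoid
        q₁ : ∀ k M y A u v → + 2 * k * 1ℤ + ((+ 2 * M * y + + 3 * (- A)) * (- A) + 1ℤ * (u - v))
          ≡ + 3 * k + + 3 * (A * A) + + 3 * (k * v) - (k + v + + 3 * (k * v)) - + 2 * (A * (M * y)) + u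
        q₁ = solve-∀
        q₂ : ∀ k A B v μ u → + 3 * k + + 3 * (A * A) + + 3 * (k * v) - (+ 3 * (A * A) - + 2 * (A * B) + + 2 + + 4 * μ + + 3 * u) - + 2 * (A * B) + u
          ≡ 1ℤ - μ + u + + 3 * (k + k * v - 1ℤ - μ - u)
        q₂ = solve-∀
        q₃ : ∀ M y t c → 1ℤ - (M + y + + 3 * (M * y)) + (t + y + + 3 * (t * y))
          ≡ 1ℤ + (c + t) - (c + M + + 3 * (c * M)) + + 3 * (t * y - M * y + c * M)
        q₃ = solve-∀
        q₄ : ∀ s → 1ℤ + 1ℤ - s ≡ -1ℤ - s + + 3 * 1ℤ
        q₄ = solve-∀

-- The Legendre symbol at 3, common factors and parity

sign-unique : ∀ {r s} → Sign r → Sign s → ℤ/._≋_ (+ 3) r s → r ≡ s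
sign-unique null  null  _ = refl
sign-unique plus  plus  _ = refl
sign-unique minus minus _ = refl
sign-unique null  plus  eq = contradiction (W-≋ {0ℤ} {1ℤ} eq) λ ()
sign-unique null  minus eq = contradiction (W-≋ {0ℤ} { -1ℤ} eq) λ ()
sign-unique plus  null  eq = contradiction (W-≋ {1ℤ} {0ℤ} eq) λ ()
sign-unique plus  minus eq = contradiction (W-≋ {1ℤ} { -1ℤ} eq) λ ()
sign-unique minus null  eq = contradiction (W-≋ { -1ℤ} {0ℤ} eq) λ ()
sign-unique minus plus  eq = contradiction (W-≋ { -1ℤ} {1ℤ} eq) λ ()

-- Euler's criterion at 3, where the exponent (3 - 1)/2 is 1.
legendre-3 : ∀ a → Sign (legendre a 3) × ℤ/._≋_ (+ 3) (legendre a 3) a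
legendre-3 a with + 3 ∣? a
... | yes 3∣a = null , ℤ/.≋-sym (+ 3) (∣⇒≋0 3∣a)
... | no 3∤a with Fin.any? {n = 3} (λ r → + 3 ∣? (+ toℕ r * + toℕ r - a))
...   | yes (r , 3∣r²-a) = plus , T.≋-trans (T.≋-sym r²≋1) (∣⇒≋ 3∣r²-a)
  where
  module T = ℤ/ (+ 3)
  3∤r : ¬ + 3 ∣ + toℕ r
  3∤r 3∣r = 3∤a (≋0⇒∣ (T.≋-trans (T.≋-sym (∣⇒≋ 3∣r²-a)) (∣⇒≋0 (∣m⇒∣m*n (+ toℕ r) 3∣r))))
  r²≋1 : + toℕ r * + toℕ r T.≋ 1ℤ
  r²≋1 = T.by (proj₁ (3∤⇒square 3∤r)) (proj₂ (3∤⇒square 3∤r))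
...   | no ∄r = minus , (case mod3ℤ a of λ
  { (3c c a≡)   → contradiction (divides c (trans a≡ (ℤ.*-comm (+ 3) c))) 3∤a
  ; (3c+1 c a≡) → contradiction (Fin.suc Fin.zero , divides (- c) (trans (cong (_-_ 1ℤ) a≡) (p c))) ∄r
  ; (3c+2 c a≡) → ℤ/.by (- (c + 1ℤ)) (trans (q c) (cong (_+ + 3 * (- (c + 1ℤ))) (sym a≡))) })
  where
  p : ∀ c → 1ℤ - (1ℤ + + 3 * c) ≡ - c * + 3
  p = solve-∀
  q : ∀ c → -1ℤ ≡ + 2 + + 3 * c + + 3 * (- (c + 1ℤ))
  q = solve-∀

record CoprimeParts (n y : ℤ) : Set where
  field
    ν y′ h  : ℤ
    n≡      : n ≡ ν * h
    y≡      : y ≡ y′ * h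
    coprime : Coprime ν y′

coprimeParts : ∀ n y → n ≢ 0ℤ → CoprimeParts n y
coprimeParts n y n≢0 = go (∣ᵤ⇒∣ {+ g} {n} (ℕGCD.gcd[m,n]∣m N Y)) (∣ᵤ⇒∣ {+ g} {y} (ℕGCD.gcd[m,n]∣n N Y))
  where
  N = ℤ.∣ n ∣
  Y = ℤ.∣ y ∣
  g = ℕGCD.gcd N Y
  instance
    g≢0 : ℕ.NonZero g
    g≢0 = ℕ.≢-nonZero (ℕGCD.gcd[m,n]≢0 N Y (inj₁ (n≢0 ∘ ℤ.∣i∣≡0⇒i≡0)))
  quotient≡ : ∀ {a c} → a ≡ c * + g → ℤ.∣ a ∣ ℕ./ g ≡ ℤ.∣ c ∣
  quotient≡ {a} {c} a≡ = trans (cong (ℕ._/ g) (trans (cong ℤ.∣_∣ a≡) (ℤ.abs-* c (+ g)))) (ℕ/.m*n/n≡m ℤ.∣ c ∣ g)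
  coprime-∣∣ˡ : ∀ {a b} → Coprime (+ ℤ.∣ a ∣) (+ ℤ.∣ b ∣) → Coprime a b
  coprime-∣∣ˡ {a} {b} co = coprime-∣∣ b (coprime-sym (coprime-∣∣ a (coprime-sym co)))
  go : + g ∣ n → + g ∣ y → CoprimeParts n y
  go (divides ν n≡) (divides y′ y≡) = record
    { ν = ν ; y′ = y′ ; h = + g ; n≡ = n≡ ; y≡ = y≡
    ; coprime = coprime-∣∣ˡ {ν} {y′} (ℕcoprime⇒coprime (subst₂ ℕCoprimality.Coprime (quotient≡ {n} {ν} n≡) (quotient≡ {y} {y′} y≡) (ℕCoprimality.coprime-/gcd N Y))) }

odd-half : ∀ a → ¬ + 2 ∣ a → ∃[ j ] a ≡ 1ℤ + + 2 * j
odd-half a 2∤a = go (a ℤDivMod.%ℕ 2) (ℤDivMod.n%ℕd<d a 2) (trans (ℤDivMod.a≡a%ℕn+[a/ℕn]*n a 2)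
  (cong (_+_ (+ (a ℤDivMod.%ℕ 2))) (ℤ.*-comm (a ℤDivMod./ℕ 2) (+ 2))))
  where
  j = a ℤDivMod./ℕ 2
  go : ∀ r → r ℕ.< 2 → a ≡ + r + + 2 * j → ∃[ j ] a ≡ 1ℤ + + 2 * j
  go 0 _ a≡ = contradiction (divides j (trans a≡ (trans (ℤ.+-identityˡ _) (ℤ.*-comm (+ 2) j)))) 2∤a
  go 1 _ a≡ = j , a≡
  go (suc (suc _)) (ℕ.s≤s (ℕ.s≤s ()))

module _ {d m : ℤ} (square-free : SquareFree d) where

  -- If m is even and n odd, then n² ≡ 1 modulo 4 gives d ≡ d n² = m² + 4 ≡ 0 modulo 4, against d
  -- being squarefree.
  even-m⇒even-n : ∀ {n} → m * m - d * (n * n) ≡ - (+ 4) → + 2 ∣ m → + 2 ∣ n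
  even-m⇒even-n {n} m² (divides M m≡) = go (+ 2 ∣? n)
    where
    contra : ∀ j → n ≡ 1ℤ + + 2 * j → + 2 * + 2 ∣ d
    contra j n≡ = divides (M * M + 1ℤ - d * (j * j + j)) (trans (p d j) (trans (cong (λ e → e - + 4 * (d * (j * j + j)))
      (trans (cong (λ n → d * (n * n)) (sym n≡)) (trans (q (m * m) (d * (n * n))) (cong₂ (λ m e → m * m - e) m≡ m²)))) (r M d j)))
      where
      p : ∀ d j → d ≡ d * ((1ℤ + + 2 * j) * (1ℤ + + 2 * j)) - + 4 * (d * (j * j + j))
      p = solve-∀
      q : ∀ a b → b ≡ a - (a - b)
      q = solve-∀
      r : ∀ M d j → M * + 2 * (M * + 2) - - (+ 4) - + 4 * (d * (j * j + j)) ≡ (M * M + 1ℤ - d * (j * j + j)) * + 4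
      r = solve-∀
    go : Dec (+ 2 ∣ n) → + 2 ∣ n
    go (yes 2∣n) = 2∣n
    go (no 2∤n)  = case odd-half n 2∤n of λ
      { (j , n≡) → contradiction (square-free (+ 2) (contra j n≡)) λ () }

even-n⇒even-m : ∀ {d m n} → m * m - d * (n * n) ≡ - (+ 4) → + 2 ∣ n → + 2 ∣ m
even-n⇒even-m {d} {m} {n} m² 2∣n = case prime-∣* prime[2] m m (subst (+ 2 ∣_) (trans (cong (λ e → e + d * (n * n)) (sym m²)) (p (m * m) (d * (n * n))))
    (∣m∣n⇒∣m+n (divides (- (+ 2)) refl) (∣n⇒∣m*n d (∣n⇒∣m*n n 2∣n)))) of λ
  { (inj₁ 2∣m) → 2∣m
  ; (inj₂ 2∣m) → 2∣m }
  where
  p : ∀ a b → a - b + b ≡ a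
  p = solve-∀

-- The cases of m modulo 9

record Hypotheses (d m n : ℤ) (p k : ℕ) (x y : ℤ) : Set where
  field
    p-prime     : Prime p
    p≡          : p ≡ 1 ℕ.+ 3 ℕ.* k
    square-free : SquareFree d
    m²          : m * m - d * (n * n) ≡ - (+ 4)
    p≡x²+3dy²   : + p ≡ x * x + + 3 * d * (y * y)
    3∤y         : ¬ + 3 ∣ y
    3∤n         : ¬ + 3 ∣ n
    x≋y         : ℤ/._≋_ (+ 3) x y
    p∤y         : ¬ + p ∣ y
    n≢0         : n ≢ 0ℤ

  Residue : ℤ → Set
  Residue r = ℤ/._≋_ (+ p) (d * n * y * U k m -1ℤ) (- (r * x))

  Residues : Set
  Residues = (∀ m′ → m ≡ + 3 * m′ → ∀ {r} → Sign r → ℤ/._≋_ (+ 3) r (+ 2 * m′ * n) → Residue r)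
    × (¬ + 3 ∣ m → + 3 ∣ n + m → ∀ s → m * m ≡ 1ℤ + + 3 * s → ∀ {r} → Sign r → ℤ/._≋_ (+ 3) r (-1ℤ - s) → Residue r)

  residues : Residues
  residues = go (+ 2 ∣? m)
    where
    odd : ¬ + 2 ∣ m → CoprimeParts n y → Residues
    odd 2∤m parts = residue-3∣m , residue-3∣m+n
      where
      open CoprimeParts parts
      ν-2 : Coprime ν (+ 2)
      ν-2 = coprime-sym (prime-∤⇒coprime prime[2] ν λ 2∣ν →
        2∤m (even-n⇒even-m {d} {m} {n} m² (subst (+ 2 ∣_) (sym n≡) (∣m⇒∣m*n h 2∣ν))))
      open Reduced {k = k} p-prime p≡ d m n x y m² p≡x²+3dy² 3∤y 3∤n x≋y p∤y n≢0 1ℤ (+ 2) 0ℤ 1ℤ refl refl refl refl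
        m ν h y′ (sym (ℤ.*-identityˡ m)) (trans n≡ (cong (_* h) (sym (ℤ.*-identityˡ ν)))) y≡ (coprime-* ν-2 coprime)
    even : ∀ M n′ → m ≡ M * + 2 → n ≡ n′ * + 2 → CoprimeParts n′ y → Residues
    even M n′ m≡ n≡′ parts = residue-3∣m , residue-3∣m+n
      where
      open CoprimeParts parts
      open Reduced {k = k} p-prime p≡ d m n x y m² p≡x²+3dy² 3∤y 3∤n x≋y p∤y n≢0 (+ 2) 1ℤ 1ℤ 0ℤ refl refl refl refl
        M ν h y′ (trans m≡ (ℤ.*-comm M (+ 2)))
        (trans n≡′ (trans (ℤ.*-comm n′ (+ 2)) (trans (cong (+ 2 *_) n≡) (sym (ℤ.*-assoc (+ 2) ν h))))) y≡
        (subst (Coprime ν) (sym (ℤ.*-identityˡ y′)) coprime)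
    go : Dec (+ 2 ∣ m) → Residues
    go (no 2∤m)  = odd 2∤m (coprimeParts n y n≢0)
    go (yes 2∣m) = halve 2∣m (even-m⇒even-n {d} {m} square-free m² 2∣m)
      where
      halve : + 2 ∣ m → + 2 ∣ n → Residues
      halve (divides M m≡) (divides n′ n≡) = even M n′ m≡ n≡ (coprimeParts n′ y λ n′≡0 →
        n≢0 (trans n≡ (trans (cong (_* + 2) n′≡0) (ℤ.*-zeroˡ (+ 2)))))

*3/3 : ∀ q → q * + 3 / + 3 ≡ q
*3/3 q = go (q * + 3 ℤ.% + 3) (ℤDivMod.n%d<d (q * + 3) (+ 3)) (ℤDivMod.a≡a%n+[a/n]*n (q * + 3) (+ 3))
  where
  c = q * + 3 / + 3
  go : ∀ r → r ℕ.< 3 → q * + 3 ≡ + r + c * + 3 → c ≡ q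
  go 0 _ eq = ℤ.*-cancelʳ-≡ c q (+ 3) (trans (sym (ℤ.+-identityˡ (c * + 3))) (sym eq))
  go r@(suc _) r<3 eq = contradiction r<3 (ℕ.≤⇒≯ (ℕ∣.∣⇒≤ (∣⇒∣ᵤ (divides {+ 3} {+ r} (q - c) (trans (p (+ r) c) (trans (cong (_- c * + 3) (sym eq)) (s q c)))))))
    where
    p : ∀ r c → r ≡ r + c * + 3 - c * + 3
    p = solve-∀
    s : ∀ q c → q * + 3 - c * + 3 ≡ (q - c) * + 3
    s = solve-∀

module Cases {d m n : ℤ} {p k : ℕ} {x y : ℤ} (H : Hypotheses d m n p k x y) where
  open Hypotheses H
  private
    module P = ℤ/ (+ p)
    module T = ℤ/ (+ 3)
    V = U k m -1ℤ
    D = d * n * y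

  -- The data depend on n only through n², so the sign of n may be chosen to make n + m divisible by
  -- 3 when 3 does not divide m.
  negated : Hypotheses d m (- n) p k x y
  negated = record
    { p-prime = p-prime ; p≡ = p≡ ; square-free = square-free
    ; m² = trans (q m d n) m²
    ; p≡x²+3dy² = p≡x²+3dy² ; 3∤y = 3∤y
    ; 3∤n = λ 3∣-n → 3∤n (subst (+ 3 ∣_) (ℤ.neg-involutive n) (∣m⇒∣-m 3∣-n))
    ; x≋y = x≋y ; p∤y = p∤y
    ; n≢0 = λ -n≡0 → n≢0 (trans (sym (ℤ.neg-involutive n)) (cong -_ -n≡0)) }
    where
    q : ∀ m d n → m * m - d * (- n * - n) ≡ m * m - d * (n * n)
    q = solve-∀

  case-3∣m : ∀ m′ → m ≡ + 3 * m′ → D * V P.≋ legendre (m′ * n) 3 * x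
  case-3∣m m′ m≡ = P.≋-trans (proj₁ residues m′ m≡ (neg-sign (proj₁ (legendre-3 (m′ * n)))) -L≋) (P.≋-reflexive (q (legendre (m′ * n) 3) x))
    where
    neg-sign : ∀ {r} → Sign r → Sign (- r)
    neg-sign null  = null
    neg-sign plus  = minus
    neg-sign minus = plus
    q : ∀ l x → - (- l * x) ≡ l * x
    q = solve-∀
    -L≋ : - legendre (m′ * n) 3 T.≋ + 2 * m′ * n
    -L≋ = T.≋-trans (T.≋-neg (proj₂ (legendre-3 (m′ * n)))) (T.by (- (m′ * n)) (r m′ n))
      where
      r : ∀ m n → - (m * n) ≡ + 2 * m * n + + 3 * (- (m * n))
      r = solve-∀

  -- As m² ≡ n² ≡ 1 modulo 3, one of n + m and -n + m is divisible by 3, and correspondingly m n ≡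
  -- -1 or 1. In the second case n is replaced by -n, which reverses the sign of d n y; the Legendre
  -- symbol of m n records that sign.
  case-3∤m : ∀ s → m * m ≡ 1ℤ + + 3 * s → ∀ {r} → Sign r → r T.≋ -1ℤ - s → D * V P.≋ legendre (m * n) 3 * (r * x)
  case-3∤m s m-square {r} sign r≋ = case prime-∣* prime[3] (n + m) (- n + m) 3∣product of λ
    { (inj₁ 3∣n+m) → P.≋-trans (proj₂ residues 3∤m 3∣n+m s m-square sign r≋)
        (P.≋-reflexive (trans (q₁ (r * x)) (cong (_* (r * x)) (sym (sign-unique (proj₁ (legendre-3 (m * n))) minus
          (T.≋-trans (proj₂ (legendre-3 (m * n))) (mn≋-1 3∣n+m)))))))
    ; (inj₂ 3∣m-n) → P.≋-trans (P.≋-reflexive (q₂ d n y V)) (P.≋-trans (P.≋-neg (proj₂ (Hypotheses.residues negated) 3∤m 3∣m-n s m-square sign r≋))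
        (P.≋-reflexive (trans (q₃ (r * x)) (cong (_* (r * x)) (sym (sign-unique (proj₁ (legendre-3 (m * n))) plus
          (T.≋-trans (proj₂ (legendre-3 (m * n))) (mn≋1 3∣m-n))))))) ) }
    where
    3∤m : ¬ + 3 ∣ m
    3∤m = square⇒3∤ {m} {s} m-square
    n-square = 3∤⇒square 3∤n
    3∣product : + 3 ∣ (n + m) * (- n + m)
    3∣product = divides (s - proj₁ n-square) (trans (t n m) (trans (cong₂ _-_ m-square (proj₂ n-square)) (u s (proj₁ n-square))))
      where
      t : ∀ n m → (n + m) * (- n + m) ≡ m * m - n * n
      t = solve-∀
      u : ∀ s t → 1ℤ + + 3 * s - (1ℤ + + 3 * t) ≡ (s - t) * + 3
      u = solve-∀
    q₁ : ∀ x → - x ≡ -1ℤ * x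
    q₁ = solve-∀
    q₂ : ∀ d n y v → d * n * y * v ≡ - (d * - n * y * v)
    q₂ = solve-∀
    q₃ : ∀ x → - (- x) ≡ 1ℤ * x
    q₃ = solve-∀
    mn≋-1 : + 3 ∣ n + m → m * n T.≋ -1ℤ
    mn≋-1 (divides c eq) = T.by (m * c - s) (trans (t m n) (trans (cong₂ (λ u v → m * u - v) eq m-square) (u m c s)))
      where
      t : ∀ m n → m * n ≡ m * (n + m) - m * m
      t = solve-∀
      u : ∀ m c s → m * (c * + 3) - (1ℤ + + 3 * s) ≡ -1ℤ + + 3 * (m * c - s)
      u = solve-∀
    mn≋1 : + 3 ∣ - n + m → m * n T.≋ 1ℤ
    mn≋1 (divides c eq) = T.by (s - m * c) (trans (t m n) (trans (cong₂ (λ u v → v - m * u) eq m-square) (u m c s)))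
      where
      t : ∀ m n → m * n ≡ m * m - m * (- n + m)
      t = solve-∀
      u : ∀ m c s → 1ℤ + + 3 * s - m * (c * + 3) ≡ 1ℤ + + 3 * (s - m * c)
      u = solve-∀

  -- Modulo 3, -1 - (m² - 1)/3 depends only on ±m modulo 9: it is -1, 1 and 0 for m ≡ ±1, ±2 and ±4,
  -- which are the cases of the theorem with 3 ∤ m.
  case-mod9 : ∀ a s → a * a ≡ 1ℤ + + 3 * s → ∀ {r} → Sign r → r T.≋ -1ℤ - s → m ≡ a [mod 9 ] →
    D * V P.≋ legendre (m * n) 3 * (r * x)
  case-mod9 a s a² sign r≋ (divides q m-a) = case-3∤m (s + + 3 * (+ 2 * a * q + + 9 * q * q))
    (trans (t m a) (trans (cong (λ e → (a + e) * (a + e)) m-a) (trans (u a q) (trans (cong (_+ + 3 * (+ 3 * (+ 2 * a * q + + 9 * q * q))) a²)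
      (v s (+ 2 * a * q + + 9 * q * q))))))
    sign (T.≋-trans r≋ (T.by (+ 2 * a * q + + 9 * q * q) (w′ s (+ 2 * a * q + + 9 * q * q))))
    where
    t : ∀ m a → m * m ≡ (a + (m - a)) * (a + (m - a))
    t = solve-∀
    u : ∀ a q → (a + q * + 9) * (a + q * + 9) ≡ a * a + + 3 * (+ 3 * (+ 2 * a * q + + 9 * q * q))
    u = solve-∀
    v : ∀ s e → 1ℤ + + 3 * s + + 3 * (+ 3 * e) ≡ 1ℤ + + 3 * (s + + 3 * e)
    v = solve-∀
    w′ : ∀ s e → -1ℤ - s ≡ -1ℤ - (s + + 3 * e) + + 3 * e
    w′ = solve-∀

  case-mod9± : ∀ a s → a * a ≡ 1ℤ + + 3 * s → ∀ {r} → Sign r → r T.≋ -1ℤ - s → m ≡± a [mod 9 ] →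
    D * V P.≋ legendre (m * n) 3 * (r * x)
  case-mod9± a s a² sign r≋ (inj₁ m≡a)  = case-mod9 a s a² sign r≋ m≡a
  case-mod9± a s a² sign r≋ (inj₂ m≡-a) = case-mod9 (- a) s (trans (t a) a²) sign r≋ m≡-a
    where
    t : ∀ a → - a * - a ≡ a * a
    t = solve-∀

  module _ (p∤d : ¬ + p ∣ d) (p∤n : ¬ + p ∣ n) where

    coprime-D : Coprime (+ p) D
    coprime-D = coprime-* (coprime-* (prime-∤⇒coprime p-prime d p∤d) (prime-∤⇒coprime p-prime n p∤n)) (prime-∤⇒coprime p-prime y p∤y)

    divide : ∀ {a} → D * V P.≋ a → V ≡ a ÷ D [mod p ]
    divide {a} DV≋a = go coprime-D
      where
      go : Coprime (+ p) D → V ≡ a ÷ D [mod p ]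
      go (bezout u v eq) = v , ≋⇒∣ Dv≋1 , ≋⇒∣ (P.≋-trans (P.≋-reflexive (sym (ℤ.*-identityˡ V)))
          (P.≋-trans (P.≋-*ʳ {V} (P.≋-sym Dv≋1)) (P.≋-trans (P.≋-reflexive (q D v V)) (P.≋-*ʳ {v} DV≋a))))
        where
        r : ∀ p u D v → D * v ≡ p * u + D * v + p * (- u)
        r = solve-∀
        q : ∀ D v V → D * v * V ≡ D * V * v
        q = solve-∀
        Dv≋1 : D * v P.≋ 1ℤ
        Dv≋1 = P.by (- u) (trans (r (+ p) u D v) (cong (_+ + p * (- u)) eq))

    vanish : D * V P.≋ 0ℤ → V ≡ 0ℤ [mod p ]
    vanish DV≋0 = ≋⇒∣ (≋-cancelℤ coprime-D (P.≋-trans DV≋0 (P.≋-reflexive (sym (ℤ.*-zeroʳ D)))))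

    mod9-0 : m ≡ 0ℤ [mod 9 ] ⊎ m ≡± + 4 [mod 9 ] → V ≡ 0ℤ [mod p ]
    mod9-0 (inj₁ (divides q eq)) = vanish (proj₁ residues (+ 3 * q) (trans (r m) (trans eq (t q))) null (T.by (- (+ 2 * q * n)) (u q n)))
      where
      r : ∀ m → m ≡ m - 0ℤ
      r = solve-∀
      t : ∀ q → q * + 9 ≡ + 3 * (+ 3 * q)
      t = solve-∀
      u : ∀ q n → 0ℤ ≡ + 2 * (+ 3 * q) * n + + 3 * (- (+ 2 * q * n))
      u = solve-∀
    mod9-0 (inj₂ m≡±4) = vanish (P.≋-trans (case-mod9± (+ 4) (+ 5) refl null (T.by (+ 2) refl) m≡±4) (P.≋-reflexive (v (legendre (m * n) 3) x)))
      where
      v : ∀ l x → l * (0ℤ * x) ≡ 0ℤ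
      v = solve-∀

    mod9-3 : m ≡± + 3 [mod 9 ] → V ≡ legendre ((m * n) / + 3) 3 * x ÷ D [mod p ]
    mod9-3 m≡±3 = case 3∣m m≡±3 of λ
      { (m′ , m≡) → divide (subst (λ e → D * V P.≋ legendre e 3 * x)
          (sym (trans (cong (_/ + 3) (trans (cong (_* n) m≡) (s m′ n))) (*3/3 (m′ * n)))) (case-3∣m m′ m≡)) }
      where
      s : ∀ m n → + 3 * m * n ≡ m * n * + 3
      s = solve-∀
      3∣m : m ≡± + 3 [mod 9 ] → ∃[ m′ ] m ≡ + 3 * m′
      3∣m (inj₁ (divides q eq)) = 1ℤ + + 3 * q , trans (r m) (trans (cong (_+_ (+ 3)) eq) (t q))
        where
        r : ∀ m → m ≡ + 3 + (m - + 3)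
        r = solve-∀
        t : ∀ q → + 3 + q * + 9 ≡ + 3 * (1ℤ + + 3 * q)
        t = solve-∀
      3∣m (inj₂ (divides q eq)) = -1ℤ + + 3 * q , trans (r m) (trans (cong (_+_ (- (+ 3))) eq) (t q))
        where
        r : ∀ m → m ≡ - (+ 3) + (m - - (+ 3))
        r = solve-∀
        t : ∀ q → - (+ 3) + q * + 9 ≡ + 3 * (-1ℤ + + 3 * q)
        t = solve-∀

    mod9-1 : m ≡± + 1 [mod 9 ] → V ≡ - legendre (m * n) 3 * x ÷ D [mod p ]
    mod9-1 m≡±1 = divide (P.≋-trans (case-mod9± (+ 1) 0ℤ refl minus T.≋-refl m≡±1) (P.≋-reflexive (v (legendre (m * n) 3) x)))
      where
      v : ∀ l x → l * (-1ℤ * x) ≡ - l * x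
      v = solve-∀

    mod9-2 : m ≡± + 2 [mod 9 ] → V ≡ legendre (m * n) 3 * x ÷ D [mod p ]
    mod9-2 m≡±2 = divide (P.≋-trans (case-mod9± (+ 2) 1ℤ refl plus (T.by 1ℤ refl) m≡±2) (P.≋-reflexive (cong (legendre (m * n) 3 *_) (ℤ.*-identityˡ x))))

-- Consequences of the representation of p and the conclusion

3k+1-form : ∀ {p d x y} → Prime p → + p ≡ x * x + + 3 * d * (y * y) → ¬ + 3 ∣ x → ∃[ k ] p ≡ 1 ℕ.+ 3 ℕ.* k
3k+1-form {p} {d} {x} {y} p-prime p≡ 3∤x = case mod3 p of λ
  { (3k k p≡3k)     → contradiction (residue 0 k p≡3k) λ 3∣-1 → 3∤1 (∣m⇒∣-m 3∣-1)
  ; (3k+1 k p≡3k+1) → k , p≡3k+1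
  ; (3k+2 k p≡3k+2) → contradiction (residue 2 k p≡3k+2) 3∤1 }
  where
  3∤1 : ¬ + 3 ∣ 1ℤ
  3∤1 = prime-∤1 prime[3]
  s = proj₁ (3∤⇒square 3∤x)
  residue : ∀ r k → p ≡ r ℕ.+ 3 ℕ.* k → + 3 ∣ + r - 1ℤ
  residue r k p≡r = divides (s + d * (y * y) - + k) (trans (q (+ r) (+ k)) (trans (cong (λ e → e - + 3 * + k - 1ℤ)
    (trans (sym (trans (cong +_ p≡r) (cong (_+_ (+ r)) (ℤ.pos-* 3 k)))) (trans p≡ (cong (_+ + 3 * d * (y * y)) (proj₂ (3∤⇒square 3∤x)))))) (t s d (y * y) (+ k))))
    where
    q : ∀ r k → r - 1ℤ ≡ r + + 3 * k - + 3 * k - 1ℤ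
    q = solve-∀
    t : ∀ s d y² k → 1ℤ + + 3 * s + + 3 * d * y² - + 3 * k - 1ℤ ≡ (s + d * y² - k) * + 3
    t = solve-∀

-- Otherwise p divides x as well, and p² divides p.
prime-∤y : ∀ {p d x y} → Prime p → + p ≡ x * x + + 3 * d * (y * y) → ¬ + p ∣ y
prime-∤y {p} {d} {x} {y} p-prime p≡ p∣y@(divides b y≡) = case prime-∣* p-prime x x p∣x² of λ
  { (inj₁ p∣x) → both p∣x
  ; (inj₂ p∣x) → both p∣x }
  where
  q : ∀ a b → a + b - b ≡ a
  q = solve-∀
  p∣x² : + p ∣ x * x
  p∣x² = subst (+ p ∣_) (trans (cong (_- + 3 * d * (y * y)) p≡) (q (x * x) (+ 3 * d * (y * y))))
    (∣m∣n⇒∣m-n (divides 1ℤ (sym (ℤ.*-identityˡ (+ p)))) (∣n⇒∣m*n (+ 3 * d) (∣n⇒∣m*n y p∣y)))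
  r : ∀ a b d p → a * p * (a * p) + + 3 * d * (b * p * (b * p)) ≡ (a * a + + 3 * d * (b * b)) * p * p
  r = solve-∀
  both : ¬ + p ∣ x
  both (divides a x≡) = prime-∤1 p-prime (divides (a * a + + 3 * d * (b * b))
    (ℤ.*-cancelʳ-≡ 1ℤ ((a * a + + 3 * d * (b * b)) * + p) (+ p) {{prime⇒nonZero p-prime}}
      (trans (ℤ.*-identityˡ (+ p)) (trans p≡ (trans (cong₂ (λ x y → x * x + + 3 * d * (y * y)) x≡ y≡) (r a b d (+ p)))))))

-- By size: y ≠ 0 and d > 0 give p ≥ 3d > d.
prime-∤d : ∀ {p d x y} → Prime p → + p ≡ x * x + + 3 * d * (y * y) → 1ℤ < d → y ≢ 0ℤ → ¬ + p ∣ d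
prime-∤d {p} {+ suc D} {x} {y} p-prime p≡ _ y≢0 p∣d = ℕ.<⇒≱ D<p (ℕ∣.∣⇒≤ (∣⇒∣ᵤ p∣d))
  where
  X = ℤ.∣ x ∣
  Y = ℤ.∣ y ∣
  Y²≢0 : ℕ.NonZero (Y ℕ.* Y)
  Y²≢0 = ℕ.m*n≢0 Y Y {{ℕ.≢-nonZero (y≢0 ∘ ℤ.∣i∣≡0⇒i≡0)}} {{ℕ.≢-nonZero (y≢0 ∘ ℤ.∣i∣≡0⇒i≡0)}}
  p≡ℕ : p ≡ X ℕ.* X ℕ.+ 3 ℕ.* suc D ℕ.* (Y ℕ.* Y)
  p≡ℕ = ℤ.+-injective (trans p≡ (cong₂ _+_ (square-∣∣ x)
    (trans (cong (+ 3 * + suc D *_) (square-∣∣ y)) (sym (trans (ℤ.pos-* (3 ℕ.* suc D) (Y ℕ.* Y)) (cong (_* + (Y ℕ.* Y)) (ℤ.pos-* 3 (suc D))))))))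
  D<p : suc D ℕ.< p
  D<p = subst (suc D ℕ.<_) (sym p≡ℕ) (ℕ.<-≤-trans (subst (suc D ℕ.<_) (ℕ.*-comm (suc D) 3) (ℕ.m<m*n (suc D) 3 (ℕ.s≤s (ℕ.s≤s ℕ.z≤n))))
    (ℕ.≤-trans (ℕ.m≤m*n (3 ℕ.* suc D) (Y ℕ.* Y) {{Y²≢0}}) (ℕ.m≤n+m (3 ℕ.* suc D ℕ.* (Y ℕ.* Y)) (X ℕ.* X))))
prime-∤d {d = + zero} _ _ (ℤ.+<+ ())
prime-∤d {d = -[1+ _ ]} _ _ ()

-- Otherwise m² ≡ -4 ≡ 2 modulo 3, which is not a square.
3∤-n : ∀ {d m n} → m * m - d * (n * n) ≡ - (+ 4) → ¬ + 3 ∣ n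
3∤-n {d} {m} {n} m² (divides c n≡) = go (+ 3 ∣? m)
  where
  go : ¬ Dec (+ 3 ∣ m)
  go (yes (divides b m≡)) = prime-∤1 prime[3] (divides (d * c * c * + 3 - b * b * + 3 - 1ℤ)
    (trans (cong (λ e → - (+ 3) - e) (trans (sym m²) (cong₂ (λ m n → m * m - d * (n * n)) m≡ n≡))) (q b c d)))
    where
    q : ∀ b c d → - (+ 3) - (b * + 3 * (b * + 3) - d * (c * + 3 * (c * + 3))) ≡ (d * c * c * + 3 - b * b * + 3 - 1ℤ) * + 3
    q = solve-∀
  go (no 3∤m) = prime-∤1 prime[3] (divides (+ 2 + s - d * c * c * + 3)
    (trans (cong (λ e → e + + 5) (sym m²)) (trans (cong₂ (λ u n → u - d * (n * n) + + 5) (proj₂ (3∤⇒square 3∤m)) n≡) (q s c d))))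
    where
    s = proj₁ (3∤⇒square 3∤m)
    q : ∀ s c d → 1ℤ + + 3 * s - d * (c * + 3 * (c * + 3)) + + 5 ≡ (+ 2 + s - d * c * c * + 3) * + 3
    q = solve-∀

corollary8p3 : ∀ (d m n : ℤ) → 1ℤ < d → SquareFree d → m ≢ 0ℤ → n ≢ 0ℤ →
    m * m - d * (n * n) ≡ - (+ 4) →
    ∀ (p : ℕ) → Prime p → ¬ (+ p ∣ n) →
    ∀ (x y : ℤ) → + p ≡ x * x + + 3 * d * (y * y) →
    ¬ (+ 3 ∣ y) → x ≡ y [mod 3 ] →
    (m ≡ 0ℤ [mod 9 ] ⊎ m ≡± + 4 [mod 9 ] →
    U ((p ℕ.∸ 1) ℕ./ 3) m -1ℤ ≡ 0ℤ [mod p ])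
    × (m ≡± + 3 [mod 9 ] →
    U ((p ℕ.∸ 1) ℕ./ 3) m -1ℤ
    ≡ legendre ((m * n) / + 3) 3 * x ÷ (d * n * y) [mod p ])
    × (m ≡± + 1 [mod 9 ] →
    U ((p ℕ.∸ 1) ℕ./ 3) m -1ℤ
    ≡ - legendre (m * n) 3 * x ÷ (d * n * y) [mod p ])
    × (m ≡± + 2 [mod 9 ] →
    U ((p ℕ.∸ 1) ℕ./ 3) m -1ℤ
    ≡ legendre (m * n) 3 * x ÷ (d * n * y) [mod p ])
corollary8p3 d m n 1<d square-free _ n≢0 m² p p-prime p∤n x y p≡x²+3dy² 3∤y x≡y =
  case 3k+1-form {d = d} {x} {y} p-prime p≡x²+3dy² 3∤x of λ
    { (k , p≡) → subst Conclusion (sym (index k p≡)) (conclude k p≡) }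
  where
  Conclusion : ℕ → Set
  Conclusion k =
    (m ≡ 0ℤ [mod 9 ] ⊎ m ≡± + 4 [mod 9 ] → U k m -1ℤ ≡ 0ℤ [mod p ])
    × (m ≡± + 3 [mod 9 ] → U k m -1ℤ ≡ legendre ((m * n) / + 3) 3 * x ÷ (d * n * y) [mod p ])
    × (m ≡± + 1 [mod 9 ] → U k m -1ℤ ≡ - legendre (m * n) 3 * x ÷ (d * n * y) [mod p ])
    × (m ≡± + 2 [mod 9 ] → U k m -1ℤ ≡ legendre (m * n) 3 * x ÷ (d * n * y) [mod p ])
  x≋y : ℤ/._≋_ (+ 3) x y
  x≋y = ∣⇒≋ x≡y
  3∤x : ¬ + 3 ∣ x
  3∤x 3∣x = 3∤y (≋0⇒∣ (ℤ/.≋-trans (+ 3) (ℤ/.≋-sym (+ 3) x≋y) (∣⇒≋0 3∣x)))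
  y≢0 : y ≢ 0ℤ
  y≢0 y≡0 = 3∤y (divides 0ℤ y≡0)
  index : ∀ k → p ≡ 1 ℕ.+ 3 ℕ.* k → (p ℕ.∸ 1) ℕ./ 3 ≡ k
  index k p≡ = trans (cong (λ p → (p ℕ.∸ 1) ℕ./ 3) p≡)
    (trans (cong (ℕ._/ 3) (ℕ.*-comm 3 k)) (ℕ/.m*n/n≡m k 3))
  conclude : ∀ k → p ≡ 1 ℕ.+ 3 ℕ.* k → Conclusion k
  conclude k p≡ = mod9-0 p∤d p∤n , mod9-3 p∤d p∤n , mod9-1 p∤d p∤n , mod9-2 p∤d p∤n
    where
    p∤d : ¬ + p ∣ d
    p∤d = prime-∤d {x = x} {y} p-prime p≡x²+3dy² 1<d y≢0
    hypotheses : Hypotheses d m n p k x y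
    hypotheses = record
      { p-prime = p-prime ; p≡ = p≡ ; square-free = square-free ; m² = m²
      ; p≡x²+3dy² = p≡x²+3dy² ; 3∤y = 3∤y ; 3∤n = 3∤-n {d} {m} {n} m² ; x≋y = x≋y
      ; p∤y = prime-∤y {d = d} {x} {y} p-prime p≡x²+3dy² ; n≢0 = n≢0 }
    open Cases hypotheses
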